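{- Let $s\geq 2$, let $n=2^{s-1}$, let $H\leq\mathbb{F}_2^s$ be a hyperplane (a linear subspace of codimension $1$), and let $M=[v_0,v_1,\ldots,v_{n-1}]$ be a list of $n$ nonzero vectors of $\mathbb{F}_2^s$ (repetitions allowed) with $\sum_{i=0}^{n-1}v_i=0$. Suppose that exactly two of the indices $i\in\{0,\ldots,n-1\}$ satisfy $v_i\in H$ (so $M$ is a zero-sum two-hole instance with respect to $H$). Then $M$ has a Hadamard pair solution.
   Context: A Hadamard pair solution for a list $M=[v_0,\ldots,v_{n-1}]$ of $n=2^{s-1}$ nonzero vectors of $\mathbb{F}_2^s$ is a partition $\mathbb{F}_2^s=\bigsqcup_{i=0}^{n-1}\{x_i,y_i\}$ of the whole space into $n$ pairs such that $x_i+y_i=v_i$ for every $i$. A vector $v_i\in H$ is called an internal request (or hole) with respect to $H$, and $v_i\notin H$ a crossing request; a two-hole instance with respect to $H$ has exactly two internal requests, counted with multiplicity, all remaining requests being crossing. -}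

module Defs where

open import Algebra.Bundles.Raw using (RawMonoid)
import Algebra.Definitions.RawMonoid as RawMonoidDefinitions
open import Data.Bool.Base using (Bool; false; _∧_; _xor_)
open import Data.Fin.Base using (Fin)
open import Data.Nat.Base using (ℕ; _∸_; _^_)
open import Data.Product.Base using (_×_; ∃-syntax)
open import Data.Sum.Base using (_⊎_)
open import Data.Vec.Base as Vec using (Vec; zipWith)
open import Data.Vec.Functional using (Vector)
open import Level using (Level; 0ℓ)
open import Relation.Binary.PropositionalEquality using (_≡_; _≢_)
open import Relation.Nullary.Negation using (¬_)
open import Relation.Unary using (Pred; _∈_)

private
  variable
    s k n : ℕ
    ℓ : Level

infixl 6 _⊕_
infixr 7 _·_

-- The field with two elements is Bool with addition _xor_ and
-- multiplication _∧_, as in Data.Bool.Properties.xor-∧-commutativeRing.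

𝔽₂ : Set
𝔽₂ = Bool

𝔽₂^ : ℕ → Set
𝔽₂^ s = Vec 𝔽₂ s

_⊕_ : 𝔽₂^ s → 𝔽₂^ s → 𝔽₂^ s
_⊕_ = zipWith _xor_

𝟎 : 𝔽₂^ s
𝟎 = Vec.replicate _ false

_·_ : 𝔽₂ → 𝔽₂^ s → 𝔽₂^ s
c · v = Vec.map (c ∧_) v

⊕-rawMonoid : ℕ → RawMonoid 0ℓ 0ℓ
⊕-rawMonoid s = record
  { Carrier = 𝔽₂^ s
  ; _≈_     = _≡_
  ; _∙_     = _⊕_
  ; ε       = 𝟎
  }

∑ : Vector (𝔽₂^ s) n → 𝔽₂^ s
∑ {s} = RawMonoidDefinitions.sum (⊕-rawMonoid s)

linearCombination : Vector 𝔽₂ k → Vector (𝔽₂^ s) k → 𝔽₂^ s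
linearCombination c w = ∑ (λ j → c j · w j)

record IsSubspace {s : ℕ} (H : Pred (𝔽₂^ s) ℓ) : Set ℓ where
  field
    𝟎-closed : 𝟎 ∈ H
    ⊕-closed : ∀ {u v} → u ∈ H → v ∈ H → u ⊕ v ∈ H
    ·-closed : ∀ c {v} → v ∈ H → c · v ∈ H

-- The codimension of H is the dimension of the quotient of 𝔽₂^ s by H:
-- the cosets of the vectors in basis form a basis of this quotient.
-- Subtraction is _⊕_, the characteristic being two.

record HasCodimension {s : ℕ} (H : Pred (𝔽₂^ s) ℓ) (k : ℕ) : Set ℓ where
  field
    basis       : Vector (𝔽₂^ s) k
    independent : ∀ c → linearCombination c basis ∈ H → ∀ j → c j ≡ false
    spanning    : ∀ v → ∃[ c ] v ⊕ linearCombination c basis ∈ H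

record IsHyperplane {s : ℕ} (H : Pred (𝔽₂^ s) ℓ) : Set ℓ where
  field
    isSubspace   : IsSubspace H
    codimension1 : HasCodimension H 1

ExactlyTwo : Pred (Fin n) ℓ → Set ℓ
ExactlyTwo P =
  ∃[ i ] ∃[ j ] i ≢ j × i ∈ P × j ∈ P × (∀ k → k ∈ P → k ≡ i ⊎ k ≡ j)

Internal : Pred (𝔽₂^ s) ℓ → Vector (𝔽₂^ s) n → Pred (Fin n) ℓ
Internal H M i = M i ∈ H

record HadamardPairSolution {s : ℕ} (M : Vector (𝔽₂^ s) (2 ^ (s ∸ 1))) : Set where
  field
    x y : Vector (𝔽₂^ s) (2 ^ (s ∸ 1))

  Pair : Fin (2 ^ (s ∸ 1)) → Pred (𝔽₂^ s) 0ℓ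
  Pair i z = z ≡ x i ⊎ z ≡ y i

  field
    distinct : ∀ i → x i ≢ y i
    disjoint : ∀ {i j} → i ≢ j → ∀ z → ¬ (z ∈ Pair i × z ∈ Pair j)
    covering : ∀ z → ∃[ i ] z ∈ Pair i
    sums     : ∀ i → x i ⊕ y i ≡ M i

{-# OPTIONS --safe #-}

-- A signed count of solutions, carried out in an exterior algebra, is shown to
-- be nonzero modulo a power of two.  Choose coordinates in which H is the
-- kernel of the first one and both holes a, b have second coordinate 1.
-- Attach anticommuting U z with U z * U z = 0 to the points z, and to a
-- request v a signed sum of the products U x * U (x + v).  A nonzero product
-- of such forms exhibits disjoint pairs.  Writing U as a Fourier transform of
-- free generators diagonalises all forms simultaneously; the product of the
-- forms of a and of the n - 2 crossing requests, with the generators of two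
-- characters removed, is then T times a monomial, where T sums, over the
-- assignments of r = n / 2 - 1 characters χ to disjoint pairs of crossing
-- requests v, w with equal second coordinate, the sign χ(v) χ(w).  Since
-- r = 2 ^ m - 1, replacing all these signs by 1 does not change T modulo twice
-- the largest power of two dividing r !, and this turns T into r ! times a
-- number of perfect matchings, which is odd.  The two points left over sum to
-- b because all the sums involved are zero.
module Submission where

open import Defs
open import Algebra.Bundles using (CommutativeSemigroup)
import Algebra.Properties.CommutativeSemigroup as CommutativeSemigroupProperties
open import Data.Bool.Base using (Bool; false; true; not; _∧_; _xor_)
import Data.Bool.Properties as Bool
open import Data.Fin.Base as Fin using (Fin)
open import Data.Integer.Base as ℤ using (ℤ; 0ℤ; 1ℤ; -1ℤ; +_)
open import Data.Integer.Divisibility.Signed using (_∣_; divides; ∣m∣n⇒∣m+n; ∣m+n∣m⇒∣n; ∣m⇒∣m*n; ∣ᵤ⇒∣; ∣⇒∣ᵤ)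
import Data.Integer.Properties as ℤ
open import Data.Integer.Tactic.RingSolver using (solve-∀)
open import Data.List.Base using (List; []; _∷_; _++_; map; length; foldr; tabulate; allFin)
open import Data.List.Membership.Propositional using (_∈_; _∉_)
open import Data.List.Membership.Propositional.Properties using (∈-map⁺; ∈-map⁻; ∈-++⁺ˡ; ∈-++⁺ʳ; ∈-++⁻; ∈-∃++; ∈-allFin)
import Data.List.Properties as List
open import Data.List.Relation.Binary.Permutation.Propositional as ↭ using (_↭_; ↭-refl; ↭-sym; ↭-trans; ↭⇒↭ₛ; prep)
open import Data.List.Relation.Binary.Permutation.Propositional.Properties using (∈-resp-↭; shift; ++⁺ˡ; ↭-length; ++-comm; map⁺; ↭-map-inv)
import Data.List.Relation.Binary.Permutation.Setoid.Properties as ↭ₛ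
open import Data.List.Relation.Unary.All as All using (All; []; _∷_)
open import Data.List.Relation.Unary.All.Properties using (¬Any⇒All¬)
open import Data.List.Relation.Unary.AllPairs using ([]; _∷_)
open import Data.List.Relation.Unary.Any using (here; there)
open import Data.List.Relation.Unary.Unique.Propositional using (Unique)
import Data.List.Relation.Unary.Unique.Propositional.Properties as Unique
open import Data.Nat.Base as ℕ using (ℕ; zero; suc; _≤_; s≤s; _∸_; _^_; _!)
import Data.Nat.Divisibility as ℕ
import Data.Nat.Properties as ℕ
open import Data.Nat.Tactic.RingSolver renaming (solve-∀ to ℕ-solve-∀)
open import Data.Product.Base as Product using (_×_; _,_; ∃-syntax; proj₁; proj₂; uncurry)
open import Data.Sum.Base using (_⊎_; inj₁; inj₂)
open import Data.Vec.Base as Vec using (Vec; []; _∷_; head; tail)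
open import Data.Vec.Functional using (Vector)
import Data.Vec.Properties as Vec
open import Function.Base using (_∘_; _|>_)
open import Level using (Level)
open import Relation.Binary.PropositionalEquality
open import Relation.Nullary using (¬_; Dec; yes; no; contradiction)
open import Relation.Unary using (Pred)
open ≡-Reasoning

-- The coefficients are integers because each pairing squares to twice a monomial and each passage
-- to characters contributes `2 ^ m`, so that a computation modulo 2 would lose the product once m >
-- 0. This forces the 2-adic estimate. With every sign written as 1 - 2 d, a term that takes - 2 d
-- from k of the factors and 1 from the other i is divisible by 2 ^ k * i !. By Legendre's formula
-- the exponent of 2 in this number is r - s i, where s is the binary digit sum, while in r ! it is
-- r - s r. As r has only digits 1, s i < s r for every i < r, and all terms with k > 0 drop out.
--
-- The second coordinate 1 serves each hole differently. For a it keeps the form from being zero: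
-- within one class of points, x and x + a would occur in both orders and cancel. For b it cancels
-- that of a, so both classes of crossing requests have even size and can be perfectly matched.
--
-- Two generators are removed to match degrees: 2 r + 1 quadratic forms have degree 4 r + 2, which
-- is then the number of generators, so only the coefficient of a single monomial is in question.

private variable
  n m k s : ℕ
  A B C M M′ : Set

-- The exterior algebra

infix 5 _⊞_
infixl 6 _+_
infixl 7 _*_
infixr 7.5 _•_

-- a ⊞ b stands for a + e b, where e is the most recent generator.

data Λ : ℕ → Set where
  ⟨_⟩ : ℤ → Λ 0
  _⊞_ : ∀ {n} → Λ n → Λ n → Λ (suc n)

_+_ : Λ n → Λ n → Λ n
⟨ a ⟩ + ⟨ b ⟩ = ⟨ a ℤ.+ b ⟩
(a ⊞ b) + (c ⊞ d) = a + c ⊞ b + d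

_•_ : ℤ → Λ n → Λ n
k • ⟨ a ⟩ = ⟨ k ℤ.* a ⟩
k • (a ⊞ b) = k • a ⊞ k • b

0# : Λ n
0# {zero} = ⟨ 0ℤ ⟩
0# {suc n} = 0# ⊞ 0#

1# : Λ n
1# {zero} = ⟨ 1ℤ ⟩
1# {suc n} = 1# ⊞ 0#

-- The grade involution, which negates the parts of odd degree. It is the sign needed to move `e` to
-- the front: a e = e (bar a).
bar : Λ n → Λ n
bar ⟨ a ⟩ = ⟨ a ⟩
bar (a ⊞ b) = bar a ⊞ -1ℤ • bar b

_*_ : Λ n → Λ n → Λ n
⟨ a ⟩ * ⟨ b ⟩ = ⟨ a ℤ.* b ⟩
(a ⊞ b) * (c ⊞ d) = a * c ⊞ bar a * d + b * c

+-comm : (x y : Λ n) → x + y ≡ y + x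
+-comm ⟨ a ⟩ ⟨ b ⟩ = cong ⟨_⟩ (ℤ.+-comm a b)
+-comm (a ⊞ b) (c ⊞ d) = cong₂ _⊞_ (+-comm a c) (+-comm b d)

+-assoc : (x y z : Λ n) → (x + y) + z ≡ x + (y + z)
+-assoc ⟨ a ⟩ ⟨ b ⟩ ⟨ c ⟩ = cong ⟨_⟩ (ℤ.+-assoc a b c)
+-assoc (a ⊞ b) (c ⊞ d) (e ⊞ f) = cong₂ _⊞_ (+-assoc a c e) (+-assoc b d f)

+-identityˡ : (x : Λ n) → 0# + x ≡ x
+-identityˡ ⟨ a ⟩ = cong ⟨_⟩ (ℤ.+-identityˡ a)
+-identityˡ (a ⊞ b) = cong₂ _⊞_ (+-identityˡ a) (+-identityˡ b)

+-identityʳ : (x : Λ n) → x + 0# ≡ x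
+-identityʳ x = trans (+-comm x 0#) (+-identityˡ x)

+-commutativeSemigroup : ℕ → CommutativeSemigroup _ _
+-commutativeSemigroup n = record
  { Carrier = Λ n
  ; isCommutativeSemigroup = record
    { isSemigroup = record
      { isMagma = record { isEquivalence = isEquivalence ; ∙-cong = cong₂ _+_ }
      ; assoc = +-assoc }
    ; comm = +-comm } }

+-interchange : (w x y z : Λ n) → (w + x) + (y + z) ≡ (w + y) + (x + z)
+-interchange {n} = CommutativeSemigroupProperties.interchange (+-commutativeSemigroup n)

•-distribˡ : ∀ k (x y : Λ n) → k • (x + y) ≡ k • x + k • y
•-distribˡ k ⟨ a ⟩ ⟨ b ⟩ = cong ⟨_⟩ (ℤ.*-distribˡ-+ k a b)
•-distribˡ k (a ⊞ b) (c ⊞ d) = cong₂ _⊞_ (•-distribˡ k a c) (•-distribˡ k b d)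

•-distribʳ : ∀ k l (x : Λ n) → (k ℤ.+ l) • x ≡ k • x + l • x
•-distribʳ k l ⟨ a ⟩ = cong ⟨_⟩ (ℤ.*-distribʳ-+ a k l)
•-distribʳ k l (a ⊞ b) = cong₂ _⊞_ (•-distribʳ k l a) (•-distribʳ k l b)

•-assoc : ∀ k l (x : Λ n) → (k ℤ.* l) • x ≡ k • (l • x)
•-assoc k l ⟨ a ⟩ = cong ⟨_⟩ (ℤ.*-assoc k l a)
•-assoc k l (a ⊞ b) = cong₂ _⊞_ (•-assoc k l a) (•-assoc k l b)

•-comm : ∀ k l (x : Λ n) → k • (l • x) ≡ l • (k • x)
•-comm k l x = begin
  k • (l • x)    ≡⟨ •-assoc k l x ⟨
  (k ℤ.* l) • x  ≡⟨ cong (_• x) (ℤ.*-comm k l) ⟩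
  (l ℤ.* k) • x  ≡⟨ •-assoc l k x ⟩
  l • (k • x)    ∎

•-identity : (x : Λ n) → 1ℤ • x ≡ x
•-identity ⟨ a ⟩ = cong ⟨_⟩ (ℤ.*-identityˡ a)
•-identity (a ⊞ b) = cong₂ _⊞_ (•-identity a) (•-identity b)

•-zeroˡ : (x : Λ n) → 0ℤ • x ≡ 0#
•-zeroˡ ⟨ a ⟩ = refl
•-zeroˡ (a ⊞ b) = cong₂ _⊞_ (•-zeroˡ a) (•-zeroˡ b)

•-zeroʳ : ∀ k → k • 0# {n} ≡ 0#
•-zeroʳ {zero} k = cong ⟨_⟩ (ℤ.*-zeroʳ k)
•-zeroʳ {suc n} k = cong₂ _⊞_ (•-zeroʳ k) (•-zeroʳ k)

+-inverse : (x : Λ n) → x + -1ℤ • x ≡ 0#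
+-inverse x = begin
  x + -1ℤ • x       ≡⟨ cong (_+ -1ℤ • x) (•-identity x) ⟨
  1ℤ • x + -1ℤ • x  ≡⟨ •-distribʳ 1ℤ -1ℤ x ⟨
  0ℤ • x            ≡⟨ •-zeroˡ x ⟩
  0#                ∎

-- Torsion-freeness, needed to cancel the powers of two that the Fourier transform and the pairings
-- produce.
•-integral : ∀ k (x : Λ n) → k • x ≡ 0# → k ≡ 0ℤ ⊎ x ≡ 0#
•-integral k ⟨ a ⟩ eq with ℤ.i*j≡0⇒i≡0∨j≡0 k (⟨⟩-injective eq)
  where
  ⟨⟩-injective : ∀ {i j} → ⟨ i ⟩ ≡ ⟨ j ⟩ → i ≡ j
  ⟨⟩-injective refl = refl
... | inj₁ k≡0 = inj₁ k≡0
... | inj₂ refl = inj₂ refl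
•-integral k (a ⊞ b) eq
  with •-integral k a (cong (λ { (x ⊞ _) → x }) eq)
     | •-integral k b (cong (λ { (_ ⊞ y) → y }) eq)
... | inj₁ k≡0 | _ = inj₁ k≡0
... | inj₂ _ | inj₁ k≡0 = inj₁ k≡0
... | inj₂ a≡0 | inj₂ b≡0 = inj₂ (cong₂ _⊞_ a≡0 b≡0)

bar-+ : (x y : Λ n) → bar (x + y) ≡ bar x + bar y
bar-• : ∀ k (x : Λ n) → bar (k • x) ≡ k • bar x

bar-• k ⟨ a ⟩ = refl
bar-• k (a ⊞ b) = cong₂ _⊞_ (bar-• k a) (trans (cong (-1ℤ •_) (bar-• k b)) (•-comm -1ℤ k (bar b)))

bar-+ ⟨ a ⟩ ⟨ b ⟩ = refl
bar-+ (a ⊞ b) (c ⊞ d) = cong₂ _⊞_ (bar-+ a c)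
  (trans (cong (-1ℤ •_) (bar-+ b d)) (•-distribˡ -1ℤ (bar b) (bar d)))

bar-0# : bar (0# {n}) ≡ 0#
bar-0# {zero} = refl
bar-0# {suc n} = cong₂ _⊞_ bar-0# (trans (cong (-1ℤ •_) bar-0#) (•-zeroʳ -1ℤ))

bar-1# : bar (1# {n}) ≡ 1#
bar-1# {zero} = refl
bar-1# {suc n} = cong₂ _⊞_ bar-1# (trans (cong (-1ℤ •_) bar-0#) (•-zeroʳ -1ℤ))

bar-involutive : (x : Λ n) → bar (bar x) ≡ x
bar-involutive ⟨ a ⟩ = refl
bar-involutive (a ⊞ b) = cong₂ _⊞_ (bar-involutive a) (begin
  -1ℤ • bar (-1ℤ • bar b)    ≡⟨ cong (-1ℤ •_) (bar-• -1ℤ (bar b)) ⟩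
  -1ℤ • (-1ℤ • bar (bar b))  ≡⟨ •-assoc -1ℤ -1ℤ (bar (bar b)) ⟨
  1ℤ • bar (bar b)           ≡⟨ •-identity (bar (bar b)) ⟩
  bar (bar b)                ≡⟨ bar-involutive b ⟩
  b                          ∎)

*-distribˡ : (x y z : Λ n) → x * (y + z) ≡ x * y + x * z
*-distribˡ ⟨ a ⟩ ⟨ b ⟩ ⟨ c ⟩ = cong ⟨_⟩ (ℤ.*-distribˡ-+ a b c)
*-distribˡ (a ⊞ b) (c ⊞ d) (e ⊞ f) = cong₂ _⊞_ (*-distribˡ a c e) (begin
  bar a * (d + f) + b * (c + e)                  ≡⟨ cong₂ _+_ (*-distribˡ (bar a) d f) (*-distribˡ b c e) ⟩
  (bar a * d + bar a * f) + (b * c + b * e)      ≡⟨ +-interchange _ _ _ _ ⟩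
  (bar a * d + b * c) + (bar a * f + b * e)      ∎)

*-distribʳ : (x y z : Λ n) → (y + z) * x ≡ y * x + z * x
*-distribʳ ⟨ a ⟩ ⟨ b ⟩ ⟨ c ⟩ = cong ⟨_⟩ (ℤ.*-distribʳ-+ a b c)
*-distribʳ (a ⊞ b) (c ⊞ d) (e ⊞ f) = cong₂ _⊞_ (*-distribʳ a c e) (begin
  bar (c + e) * b + (d + f) * a                  ≡⟨ cong (λ x → x * b + (d + f) * a) (bar-+ c e) ⟩
  (bar c + bar e) * b + (d + f) * a              ≡⟨ cong₂ _+_ (*-distribʳ b (bar c) (bar e)) (*-distribʳ a d f) ⟩
  (bar c * b + bar e * b) + (d * a + f * a)      ≡⟨ +-interchange _ _ _ _ ⟩
  (bar c * b + d * a) + (bar e * b + f * a)      ∎)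

•-*ˡ : ∀ k (x y : Λ n) → (k • x) * y ≡ k • (x * y)
•-*ˡ k ⟨ a ⟩ ⟨ b ⟩ = cong ⟨_⟩ (ℤ.*-assoc k a b)
•-*ˡ k (a ⊞ b) (c ⊞ d) = cong₂ _⊞_ (•-*ˡ k a c) (begin
  bar (k • a) * d + (k • b) * c      ≡⟨ cong (λ x → x * d + (k • b) * c) (bar-• k a) ⟩
  (k • bar a) * d + (k • b) * c      ≡⟨ cong₂ _+_ (•-*ˡ k (bar a) d) (•-*ˡ k b c) ⟩
  k • (bar a * d) + k • (b * c)      ≡⟨ •-distribˡ k _ _ ⟨
  k • (bar a * d + b * c)            ∎)

•-*ʳ : ∀ k (x y : Λ n) → x * (k • y) ≡ k • (x * y)
•-*ʳ k ⟨ a ⟩ ⟨ b ⟩ = cong ⟨_⟩ (begin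
  a ℤ.* (k ℤ.* b)  ≡⟨ ℤ.*-assoc a k b ⟨
  a ℤ.* k ℤ.* b    ≡⟨ cong (ℤ._* b) (ℤ.*-comm a k) ⟩
  k ℤ.* a ℤ.* b    ≡⟨ ℤ.*-assoc k a b ⟩
  k ℤ.* (a ℤ.* b)  ∎)
•-*ʳ k (a ⊞ b) (c ⊞ d) = cong₂ _⊞_ (•-*ʳ k a c)
  (trans (cong₂ _+_ (•-*ʳ k (bar a) d) (•-*ʳ k b c)) (sym (•-distribˡ k _ _)))

*-zeroˡ : (x : Λ n) → 0# * x ≡ 0#
*-zeroˡ x = begin
  0# * x         ≡⟨ cong (_* x) (•-zeroˡ 0#) ⟨
  (0ℤ • 0#) * x  ≡⟨ •-*ˡ 0ℤ 0# x ⟩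
  0ℤ • (0# * x)  ≡⟨ •-zeroˡ _ ⟩
  0#             ∎

*-zeroʳ : (x : Λ n) → x * 0# ≡ 0#
*-zeroʳ x = begin
  x * 0#         ≡⟨ cong (x *_) (•-zeroˡ 0#) ⟨
  x * (0ℤ • 0#)  ≡⟨ •-*ʳ 0ℤ x 0# ⟩
  0ℤ • (x * 0#)  ≡⟨ •-zeroˡ _ ⟩
  0#             ∎

*-identityˡ : (x : Λ n) → 1# * x ≡ x
*-identityˡ ⟨ a ⟩ = cong ⟨_⟩ (ℤ.*-identityˡ a)
*-identityˡ (a ⊞ b) = cong₂ _⊞_ (*-identityˡ a) (begin
  bar 1# * b + 0# * a  ≡⟨ cong₂ _+_ (cong (_* b) bar-1#) (*-zeroˡ a) ⟩
  1# * b + 0#          ≡⟨ +-identityʳ _ ⟩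
  1# * b               ≡⟨ *-identityˡ b ⟩
  b                    ∎)

*-identityʳ : (x : Λ n) → x * 1# ≡ x
*-identityʳ ⟨ a ⟩ = cong ⟨_⟩ (ℤ.*-identityʳ a)
*-identityʳ (a ⊞ b) = cong₂ _⊞_ (*-identityʳ a) (begin
  bar a * 0# + b * 1#  ≡⟨ cong₂ _+_ (*-zeroʳ (bar a)) (*-identityʳ b) ⟩
  0# + b               ≡⟨ +-identityˡ b ⟩
  b                    ∎)

bar-* : (x y : Λ n) → bar (x * y) ≡ bar x * bar y
bar-* ⟨ a ⟩ ⟨ b ⟩ = refl
bar-* (a ⊞ b) (c ⊞ d) = cong₂ _⊞_ (bar-* a c) (begin
  -1ℤ • bar (bar a * d + b * c)                            ≡⟨ cong (-1ℤ •_) (bar-+ _ _) ⟩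
  -1ℤ • (bar (bar a * d) + bar (b * c))                    ≡⟨ cong (-1ℤ •_) (cong₂ _+_ (bar-* (bar a) d) (bar-* b c)) ⟩
  -1ℤ • (bar (bar a) * bar d + bar b * bar c)              ≡⟨ •-distribˡ -1ℤ _ _ ⟩
  -1ℤ • (bar (bar a) * bar d) + -1ℤ • (bar b * bar c)      ≡⟨ cong₂ _+_ (•-*ʳ -1ℤ _ _) (•-*ˡ -1ℤ _ _) ⟨
  bar (bar a) * (-1ℤ • bar d) + (-1ℤ • bar b) * bar c      ∎)

*-assoc : (x y z : Λ n) → (x * y) * z ≡ x * (y * z)
*-assoc ⟨ a ⟩ ⟨ b ⟩ ⟨ c ⟩ = cong ⟨_⟩ (ℤ.*-assoc a b c)
*-assoc (a ⊞ b) (c ⊞ d) (e ⊞ f) = cong₂ _⊞_ (*-assoc a c e) (begin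
  bar (a * c) * f + (bar a * d + b * c) * e              ≡⟨ cong₂ _+_ (trans (cong (_* f) (bar-* a c)) (*-assoc (bar a) (bar c) f)) (*-distribʳ e _ _) ⟩
  bar a * (bar c * f) + (bar a * d * e + b * c * e)      ≡⟨ cong (λ z → bar a * (bar c * f) + z) (cong₂ _+_ (*-assoc (bar a) d e) (*-assoc b c e)) ⟩
  bar a * (bar c * f) + (bar a * (d * e) + b * (c * e))  ≡⟨ +-assoc _ _ _ ⟨
  bar a * (bar c * f) + bar a * (d * e) + b * (c * e)    ≡⟨ cong (_+ b * (c * e)) (*-distribˡ (bar a) _ _) ⟨
  bar a * (bar c * f + d * e) + b * (c * e)              ∎)

_≟0 : (x : Λ n) → Dec (x ≡ 0#)
⟨ a ⟩ ≟0 with a ℤ.≟ 0ℤ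
... | yes refl = yes refl
... | no a≢0 = no λ { refl → a≢0 refl }
(a ⊞ b) ≟0 with a ≟0 | b ≟0
... | yes refl | yes refl = yes refl
... | no a≢0 | _ = no λ { refl → a≢0 refl }
... | _ | no b≢0 = no λ { refl → b≢0 refl }

-- Elements of degree one and central elements

Linear : Λ n → Set
Linear ⟨ a ⟩ = a ≡ 0ℤ
Linear (a ⊞ b) = Linear a × ∃[ k ] b ≡ k • 1#

linear-0# : Linear (0# {n})
linear-0# {zero} = refl
linear-0# {suc n} = linear-0# , 0ℤ , sym (•-zeroˡ 1#)

linear-+ : {x y : Λ n} → Linear x → Linear y → Linear (x + y)
linear-+ {x = ⟨ _ ⟩} {⟨ _ ⟩} refl refl = refl
linear-+ {x = _ ⊞ _} {_ ⊞ _} (p , k , refl) (q , l , refl) = linear-+ p q , k ℤ.+ l , sym (•-distribʳ k l 1#)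

linear-• : ∀ k {x : Λ n} → Linear x → Linear (k • x)
linear-• k {⟨ _ ⟩} refl = ℤ.*-zeroʳ k
linear-• k {_ ⊞ _} (p , l , refl) = linear-• k p , k ℤ.* l , sym (•-assoc k l 1#)

bar-linear : {x : Λ n} → Linear x → bar x ≡ -1ℤ • x
bar-linear {x = ⟨ _ ⟩} refl = refl
bar-linear {x = _ ⊞ _} (p , k , refl) =
  cong₂ _⊞_ (bar-linear p) (cong (-1ℤ •_) (trans (bar-• k 1#) (cong (k •_) bar-1#)))

-- Stated for arbitrary y, so that anticommutation, `linear-sandwich` and the centrality of products
-- of two elements of degree one all follow by moving one factor across.
linear-comm : {x : Λ n} → Linear x → ∀ y → x * y ≡ bar y * x
linear-comm {x = ⟨ _ ⟩} refl ⟨ b ⟩ = cong ⟨_⟩ (ℤ.*-comm 0ℤ b)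
linear-comm {x = a ⊞ _} (p , k , refl) (c ⊞ d) = cong₂ _⊞_ (linear-comm p c) (begin
  bar a * d + (k • 1#) * c
    ≡⟨ cong₂ _+_ (trans (cong (_* d) (bar-linear p)) (•-*ˡ -1ℤ a d)) (trans (•-*ˡ k 1# c) (cong (k •_) (*-identityˡ c))) ⟩
  -1ℤ • (a * d) + k • c
    ≡⟨ +-comm _ _ ⟩
  k • c + -1ℤ • (a * d)
    ≡⟨ cong₂ _+_ (cong (k •_) (sym (trans (*-identityʳ _) (bar-involutive c)))) (trans (cong (-1ℤ •_) (linear-comm p d)) (sym (•-*ˡ -1ℤ (bar d) a))) ⟩
  k • (bar (bar c) * 1#) + (-1ℤ • bar d) * a
    ≡⟨ cong (_+ (-1ℤ • bar d) * a) (•-*ʳ k (bar (bar c)) 1#) ⟨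
  bar (bar c) * (k • 1#) + (-1ℤ • bar d) * a ∎)

linear-anticomm : {x y : Λ n} → Linear x → Linear y → x * y ≡ -1ℤ • (y * x)
linear-anticomm {x = x} {y} p q = begin
  x * y            ≡⟨ linear-comm p y ⟩
  bar y * x        ≡⟨ cong (_* x) (bar-linear q) ⟩
  (-1ℤ • y) * x    ≡⟨ •-*ˡ -1ℤ y x ⟩
  -1ℤ • (y * x)    ∎

-- Anticommutation yields only 2 x x = 0, and torsion-freeness does the rest.
linear-square : {x : Λ n} → Linear x → x * x ≡ 0#
linear-square {x = x} p with •-integral (ℤ.+ 2) (x * x) (begin
  (ℤ.+ 2) • (x * x)               ≡⟨ •-distribʳ 1ℤ 1ℤ (x * x) ⟩
  1ℤ • (x * x) + 1ℤ • (x * x)     ≡⟨ cong₂ _+_ (•-identity _) (•-identity _) ⟩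
  x * x + x * x                   ≡⟨ cong (λ z → x * x + z) (linear-anticomm p p) ⟩
  x * x + -1ℤ • (x * x)           ≡⟨ +-inverse _ ⟩
  0#                              ∎)
... | inj₂ eq = eq

linear-sandwich : {x : Λ n} → Linear x → ∀ y → x * (y * x) ≡ 0#
linear-sandwich {x = x} p y = begin
  x * (y * x)      ≡⟨ *-assoc x y x ⟨
  (x * y) * x      ≡⟨ cong (_* x) (linear-comm p y) ⟩
  (bar y * x) * x  ≡⟨ *-assoc (bar y) x x ⟩
  bar y * (x * x)  ≡⟨ cong (bar y *_) (linear-square p) ⟩
  bar y * 0#       ≡⟨ *-zeroʳ _ ⟩
  0#               ∎

Central : Λ n → Set
Central x = ∀ y → x * y ≡ y * x

central-0# : Central (0# {n})
central-0# y = trans (*-zeroˡ y) (sym (*-zeroʳ y))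

central-+ : {x y : Λ n} → Central x → Central y → Central (x + y)
central-+ {x = x} {y} p q z = begin
  (x + y) * z    ≡⟨ *-distribʳ z x y ⟩
  x * z + y * z  ≡⟨ cong₂ _+_ (p z) (q z) ⟩
  z * x + z * y  ≡⟨ *-distribˡ z x y ⟨
  z * (x + y)    ∎

central-• : ∀ k {x : Λ n} → Central x → Central (k • x)
central-• k {x} p y = begin
  (k • x) * y  ≡⟨ •-*ˡ k x y ⟩
  k • (x * y)  ≡⟨ cong (k •_) (p y) ⟩
  k • (y * x)  ≡⟨ •-*ʳ k y x ⟨
  y * (k • x)  ∎

central-* : {x y : Λ n} → Central x → Central y → Central (x * y)
central-* {x = x} {y} p q z = begin
  (x * y) * z  ≡⟨ *-assoc x y z ⟩
  x * (y * z)  ≡⟨ cong (x *_) (q z) ⟩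
  x * (z * y)  ≡⟨ *-assoc x z y ⟨
  (x * z) * y  ≡⟨ cong (_* y) (p z) ⟩
  (z * x) * y  ≡⟨ *-assoc z x y ⟩
  z * (x * y)  ∎

-- Passing both factors applies `bar` twice. All forms below are sums of such products and hence
-- central.
linear-*-central : {x y : Λ n} → Linear x → Linear y → Central (x * y)
linear-*-central {x = x} {y} p q z = begin
  (x * y) * z            ≡⟨ *-assoc x y z ⟩
  x * (y * z)            ≡⟨ cong (x *_) (linear-comm q z) ⟩
  x * (bar z * y)        ≡⟨ *-assoc x (bar z) y ⟨
  (x * bar z) * y        ≡⟨ cong (_* y) (linear-comm p (bar z)) ⟩
  (bar (bar z) * x) * y  ≡⟨ cong (λ w → (w * x) * y) (bar-involutive z) ⟩
  (z * x) * y            ≡⟨ *-assoc z x y ⟩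
  z * (x * y)            ∎

central-swap : {x : Λ n} → Central x → ∀ y z → y * (x * z) ≡ x * (y * z)
central-swap {x = x} p y z = begin
  y * (x * z)  ≡⟨ *-assoc y x z ⟨
  (y * x) * z  ≡⟨ cong (_* z) (p y) ⟨
  (x * y) * z  ≡⟨ *-assoc x y z ⟩
  x * (y * z)  ∎

-- Pair removal in lists

-- `∂` and `Π` are used with values in `Λ n`, where products of forms are expanded, and in ℤ, where
-- the coefficient is computed. Only the operations are shared; maps between the two are handled by
-- `Equivariant`.
record Actions (M : Set) : Set where
  field
    plus : M → M → M
    none : M
    act  : ℤ → M → M

open Actions {{...}}

instance
  ℤ-actions : Actions ℤ
  ℤ-actions = record { plus = ℤ._+_ ; none = 0ℤ ; act = ℤ._*_ }

  Λ-actions : ∀ {n} → Actions (Λ n)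
  Λ-actions = record { plus = _+_ ; none = 0# ; act = _•_ }

-- ∂ f F l is the sum over i in l of f i times the value of F at l without i,
-- and Π w F l is the sum over all i before j in l of w i j times the value
-- of F at l without i and j.

∂ : {{Actions M}} → (A → ℤ) → (List A → M) → List A → M
∂ f F [] = none
∂ f F (i ∷ l) = plus (act (f i) (F l)) (∂ f (F ∘ (i ∷_)) l)

Π : {{Actions M}} → (A → A → ℤ) → (List A → M) → List A → M
Π w F [] = none
Π w F (i ∷ l) = plus (∂ (w i) F l) (Π w (F ∘ (i ∷_)) l)

module _ {{_ : Actions M}} where

  -- Equality is asked only for lists one shorter than l, because the later vanishing statements
  -- depend on the length.
  ∂-cong : ∀ f {F G : List A → M} l → (∀ l′ → suc (length l′) ≡ length l → F l′ ≡ G l′) →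
           ∂ f F l ≡ ∂ f G l
  ∂-cong f [] F≡G = refl
  ∂-cong f (i ∷ l) F≡G = cong₂ plus (cong (act (f i)) (F≡G l refl))
    (∂-cong f l λ l′ eq → F≡G (i ∷ l′) (cong suc eq))

  Π-cong : ∀ w {F G : List A → M} l → (∀ l′ → suc (suc (length l′)) ≡ length l → F l′ ≡ G l′) →
           Π w F l ≡ Π w G l
  Π-cong w [] F≡G = refl
  Π-cong w (i ∷ l) F≡G = cong₂ plus (∂-cong (w i) l λ l′ eq → F≡G l′ (cong suc eq))
    (Π-cong w l λ l′ eq → F≡G (i ∷ l′) (cong suc eq))

record Equivariant {{_ : Actions M}} {{_ : Actions M′}} (h : M → M′) : Set where
  field
    h-plus : ∀ x y → h (plus x y) ≡ plus (h x) (h y)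
    h-none : h none ≡ none
    h-act  : ∀ k x → h (act k x) ≡ act k (h x)

module _ {{_ : Actions M}} {{_ : Actions M′}} {h : M → M′} (eqv : Equivariant h) where
  open Equivariant eqv

  ∂-natural : ∀ f (F : List A → M) l → ∂ f (h ∘ F) l ≡ h (∂ f F l)
  ∂-natural f F [] = sym h-none
  ∂-natural f F (i ∷ l) = trans
    (cong₂ plus (sym (h-act (f i) (F l))) (∂-natural f (F ∘ (i ∷_)) l))
    (sym (h-plus _ _))

  Π-natural : ∀ w (F : List A → M) l → Π w (h ∘ F) l ≡ h (Π w F l)
  Π-natural w F [] = sym h-none
  Π-natural w F (i ∷ l) = trans
    (cong₂ plus (∂-natural (w i) F l) (Π-natural w (F ∘ (i ∷_)) l))
    (sym (h-plus _ _))

scaling : ∀ k → Equivariant (k ℤ.*_)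
scaling k = record
  { h-plus = ℤ.*-distribˡ-+ k
  ; h-none = ℤ.*-zeroʳ k
  ; h-act  = (λ k l x → trans (sym (ℤ.*-assoc k l x)) (trans (cong (ℤ._* x) (ℤ.*-comm k l)) (ℤ.*-assoc l k x))) k }

private
  interchange : ∀ a b c d → (a ℤ.+ b) ℤ.+ (c ℤ.+ d) ≡ (a ℤ.+ c) ℤ.+ (b ℤ.+ d)
  interchange = solve-∀

  swap : ∀ a b c → a ℤ.+ (b ℤ.+ c) ≡ b ℤ.+ (a ℤ.+ c)
  swap = solve-∀

∂-+ : ∀ f (F G : List A → ℤ) l → ∂ f (λ l → F l ℤ.+ G l) l ≡ ∂ f F l ℤ.+ ∂ f G l
∂-+ f F G [] = refl
∂-+ f F G (i ∷ l) = trans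
  (cong₂ ℤ._+_ (ℤ.*-distribˡ-+ (f i) (F l) (G l)) (∂-+ f _ _ l))
  (interchange (f i ℤ.* F l) (f i ℤ.* G l) _ _)

Π-+ : ∀ w (F G : List A → ℤ) l → Π w (λ l → F l ℤ.+ G l) l ≡ Π w F l ℤ.+ Π w G l
Π-+ w F G [] = refl
Π-+ w F G (i ∷ l) = trans
  (cong₂ ℤ._+_ (∂-+ (w i) F G l) (Π-+ w _ _ l))
  (interchange (∂ (w i) F l) (∂ (w i) G l) _ _)

-- Removing two elements in either order visits the same pairs of positions. With the next two
-- lemmas, operators for different weights commute, so a product of them can be multiplied out as in
-- a polynomial ring.
∂-comm : ∀ f g (F : List A → ℤ) l → ∂ f (∂ g F) l ≡ ∂ g (∂ f F) l
∂-comm f g F [] = refl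
∂-comm f g F (i ∷ l) = begin
  f i ℤ.* ∂ g F l ℤ.+ ∂ f (λ l → g i ℤ.* F l ℤ.+ ∂ g F′ l) l
    ≡⟨ cong (λ x → f i ℤ.* ∂ g F l ℤ.+ x) (trans (∂-+ f _ _ l) (cong (ℤ._+ ∂ f (∂ g F′) l) (∂-natural (scaling (g i)) f F l))) ⟩
  f i ℤ.* ∂ g F l ℤ.+ (g i ℤ.* ∂ f F l ℤ.+ ∂ f (∂ g F′) l)
    ≡⟨ cong (λ x → f i ℤ.* ∂ g F l ℤ.+ (g i ℤ.* ∂ f F l ℤ.+ x)) (∂-comm f g F′ l) ⟩
  f i ℤ.* ∂ g F l ℤ.+ (g i ℤ.* ∂ f F l ℤ.+ ∂ g (∂ f F′) l)
    ≡⟨ swap (f i ℤ.* ∂ g F l) (g i ℤ.* ∂ f F l) (∂ g (∂ f F′) l) ⟩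
  g i ℤ.* ∂ f F l ℤ.+ (f i ℤ.* ∂ g F l ℤ.+ ∂ g (∂ f F′) l)
    ≡⟨ cong (λ x → g i ℤ.* ∂ f F l ℤ.+ x) (trans (∂-+ g _ _ l) (cong (ℤ._+ ∂ g (∂ f F′) l) (∂-natural (scaling (f i)) g F l))) ⟨
  g i ℤ.* ∂ f F l ℤ.+ ∂ g (λ l → f i ℤ.* F l ℤ.+ ∂ f F′ l) l ∎
  where
  F′ = F ∘ (i ∷_)

∂-Π-comm : ∀ f w (F : List A → ℤ) l → ∂ f (Π w F) l ≡ Π w (∂ f F) l
∂-Π-comm f w F [] = refl
∂-Π-comm f w F (i ∷ l) = begin
  f i ℤ.* Π w F l ℤ.+ ∂ f (λ l → ∂ (w i) F l ℤ.+ Π w F′ l) l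
    ≡⟨ cong (λ x → f i ℤ.* Π w F l ℤ.+ x) (trans (∂-+ f _ _ l) (cong₂ ℤ._+_ (∂-comm f (w i) F l) (∂-Π-comm f w F′ l))) ⟩
  f i ℤ.* Π w F l ℤ.+ (∂ (w i) (∂ f F) l ℤ.+ Π w (∂ f F′) l)
    ≡⟨ swap (f i ℤ.* Π w F l) (∂ (w i) (∂ f F) l) (Π w (∂ f F′) l) ⟩
  ∂ (w i) (∂ f F) l ℤ.+ (f i ℤ.* Π w F l ℤ.+ Π w (∂ f F′) l)
    ≡⟨ cong (λ x → ∂ (w i) (∂ f F) l ℤ.+ x) (trans (Π-+ w _ _ l) (cong (ℤ._+ Π w (∂ f F′) l) (Π-natural (scaling (f i)) w F l))) ⟨
  ∂ (w i) (∂ f F) l ℤ.+ Π w (λ l → f i ℤ.* F l ℤ.+ ∂ f F′ l) l ∎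
  where
  F′ = F ∘ (i ∷_)

Π-comm : ∀ v w (F : List A → ℤ) l → Π v (Π w F) l ≡ Π w (Π v F) l
Π-comm v w F [] = refl
Π-comm v w F (i ∷ l) = begin
  ∂ (v i) (Π w F) l ℤ.+ Π v (λ l → ∂ (w i) F l ℤ.+ Π w F′ l) l
    ≡⟨ cong₂ ℤ._+_ (∂-Π-comm (v i) w F l) (trans (Π-+ v _ _ l) (cong₂ ℤ._+_ (sym (∂-Π-comm (w i) v F l)) (Π-comm v w F′ l))) ⟩
  Π w (∂ (v i) F) l ℤ.+ (∂ (w i) (Π v F) l ℤ.+ Π w (Π v F′) l)
    ≡⟨ swap (Π w (∂ (v i) F) l) (∂ (w i) (Π v F) l) (Π w (Π v F′) l) ⟩
  ∂ (w i) (Π v F) l ℤ.+ (Π w (∂ (v i) F) l ℤ.+ Π w (Π v F′) l)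
    ≡⟨ cong (λ x → ∂ (w i) (Π v F) l ℤ.+ x) (Π-+ w _ _ l) ⟨
  ∂ (w i) (Π v F) l ℤ.+ Π w (λ l → ∂ (v i) F l ℤ.+ Π v F′ l) l ∎
  where
  F′ = F ∘ (i ∷_)

∂-weight : ∀ k {f g h : A → ℤ} → (∀ i → f i ≡ g i ℤ.+ k ℤ.* h i) →
           ∀ F l → ∂ f F l ≡ ∂ g F l ℤ.+ k ℤ.* ∂ h F l
∂-weight k eq F [] = sym (trans (ℤ.+-identityˡ _) (ℤ.*-zeroʳ k))
∂-weight k {f} {g} {h} eq F (i ∷ l) = trans
  (cong₂ ℤ._+_ (cong (ℤ._* F l) (eq i)) (∂-weight k eq _ l))
  (rearrange k (g i) (h i) (F l) _ _)
  where
  rearrange : ∀ k a b x c d → (a ℤ.+ k ℤ.* b) ℤ.* x ℤ.+ (c ℤ.+ k ℤ.* d)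
              ≡ (a ℤ.* x ℤ.+ c) ℤ.+ k ℤ.* (b ℤ.* x ℤ.+ d)
  rearrange = solve-∀

-- The case k = - 2 splits a signed weight into the unsigned one and a correction.
Π-weight : ∀ k {u v w : A → A → ℤ} → (∀ i j → u i j ≡ v i j ℤ.+ k ℤ.* w i j) →
           ∀ F l → Π u F l ≡ Π v F l ℤ.+ k ℤ.* Π w F l
Π-weight k eq F [] = sym (trans (ℤ.+-identityˡ _) (ℤ.*-zeroʳ k))
Π-weight k {u} {v} {w} eq F (i ∷ l) = trans
  (cong₂ ℤ._+_ (∂-weight k (eq i) F l) (Π-weight k eq _ l))
  (rearrange k (∂ (v i) F l) (∂ (w i) F l) _ _)
  where
  rearrange : ∀ k a b c d → (a ℤ.+ k ℤ.* b) ℤ.+ (c ℤ.+ k ℤ.* d)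
              ≡ (a ℤ.+ c) ℤ.+ k ℤ.* (b ℤ.+ d)
  rearrange = solve-∀

-- The divided powers of Π w.

Γ : (A → A → ℤ) → ℕ → (List A → ℤ) → List A → ℤ
Γ w zero F l = F l
Γ w (suc j) F [] = 0ℤ
Γ w (suc j) F (i ∷ l) = Γ w (suc j) (F ∘ (i ∷_)) l ℤ.+ ∂ (w i) (Γ w j F) l

-- The rule w * w^j / j ! = (j + 1) * w^(j + 1) / (j + 1) !: a set of j + 1 disjoint pairs arises j
-- + 1 times, once for each choice of the pair that `Π w` removes.
Π-Γ : ∀ (w : A → A → ℤ) j F l → Π w (Γ w j F) l ≡ + suc j ℤ.* Γ w (suc j) F l
Π-Γ w j F [] = sym (ℤ.*-zeroʳ (+ suc j))
Π-Γ w zero F (i ∷ l) = begin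
  ∂ (w i) F l ℤ.+ Π w (F ∘ (i ∷_)) l                ≡⟨ cong (λ x → ∂ (w i) F l ℤ.+ x) (Π-Γ w zero (F ∘ (i ∷_)) l) ⟩
  ∂ (w i) F l ℤ.+ 1ℤ ℤ.* Γ w 1 (F ∘ (i ∷_)) l        ≡⟨ rearrange (∂ (w i) F l) _ ⟩
  1ℤ ℤ.* (Γ w 1 (F ∘ (i ∷_)) l ℤ.+ ∂ (w i) F l)      ∎
  where
  rearrange : ∀ a b → a ℤ.+ 1ℤ ℤ.* b ≡ 1ℤ ℤ.* (b ℤ.+ a)
  rearrange = solve-∀
Π-Γ w (suc j) F (i ∷ l) = begin
  ∂ (w i) (Γ w (suc j) F) l ℤ.+ Π w (λ l → Γ w (suc j) F′ l ℤ.+ ∂ (w i) (Γ w j F) l) l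
    ≡⟨ cong (λ x → ∂ (w i) (Γ w (suc j) F) l ℤ.+ x) (Π-+ w _ _ l) ⟩
  ∂ (w i) (Γ w (suc j) F) l ℤ.+ (Π w (Γ w (suc j) F′) l ℤ.+ Π w (∂ (w i) (Γ w j F)) l)
    ≡⟨ cong₂ (λ x y → ∂ (w i) (Γ w (suc j) F) l ℤ.+ (x ℤ.+ y)) (Π-Γ w (suc j) F′ l) step ⟩
  ∂ (w i) (Γ w (suc j) F) l ℤ.+ (+ suc (suc j) ℤ.* Γ w (suc (suc j)) F′ l ℤ.+ + suc j ℤ.* ∂ (w i) (Γ w (suc j) F) l)
    ≡⟨ rearrange (+ suc j) (∂ (w i) (Γ w (suc j) F) l) (Γ w (suc (suc j)) F′ l) ⟩
  + suc (suc j) ℤ.* (Γ w (suc (suc j)) F′ l ℤ.+ ∂ (w i) (Γ w (suc j) F) l) ∎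
  where
  F′ = F ∘ (i ∷_)
  step : Π w (∂ (w i) (Γ w j F)) l ≡ + suc j ℤ.* ∂ (w i) (Γ w (suc j) F) l
  step = begin
    Π w (∂ (w i) (Γ w j F)) l                       ≡⟨ ∂-Π-comm (w i) w (Γ w j F) l ⟨
    ∂ (w i) (Π w (Γ w j F)) l                       ≡⟨ ∂-cong (w i) l (λ l′ _ → Π-Γ w j F l′) ⟩
    ∂ (w i) (λ l → + suc j ℤ.* Γ w (suc j) F l) l   ≡⟨ ∂-natural (scaling (+ suc j)) (w i) (Γ w (suc j) F) l ⟩
    + suc j ℤ.* ∂ (w i) (Γ w (suc j) F) l           ∎
  rearrange : ∀ s a b → a ℤ.+ ((1ℤ ℤ.+ s) ℤ.* b ℤ.+ s ℤ.* a) ≡ (1ℤ ℤ.+ s) ℤ.* (b ℤ.+ a)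
  rearrange = solve-∀

Π^ : (A → A → ℤ) → ℕ → (List A → ℤ) → List A → ℤ
Π^ w zero F = F
Π^ w (suc j) F = Π w (Π^ w j F)

-- The source of the factorials in all divisibility arguments: the j pairs may be removed in any
-- order.
Π^-Γ : ∀ (w : A → A → ℤ) j F l → Π^ w j F l ≡ + (j !) ℤ.* Γ w j F l
Π^-Γ w zero F l = sym (ℤ.*-identityˡ (F l))
Π^-Γ w (suc j) F l = begin
  Π w (Π^ w j F) l                               ≡⟨ Π-cong w l (λ l′ _ → Π^-Γ w j F l′) ⟩
  Π w (λ l → + (j !) ℤ.* Γ w j F l) l            ≡⟨ Π-natural (scaling (+ (j !))) w (Γ w j F) l ⟩
  + (j !) ℤ.* Π w (Γ w j F) l                    ≡⟨ cong (+ (j !) ℤ.*_) (Π-Γ w j F l) ⟩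
  + (j !) ℤ.* (+ suc j ℤ.* Γ w (suc j) F l)      ≡⟨ rearrange (+ (j !)) (+ suc j) _ ⟩
  + suc j ℤ.* + (j !) ℤ.* Γ w (suc j) F l        ≡⟨ cong (ℤ._* Γ w (suc j) F l) (ℤ.pos-* (suc j) (j !)) ⟨
  + (suc j !) ℤ.* Γ w (suc j) F l                ∎
  where
  rearrange : ∀ a b c → a ℤ.* (b ℤ.* c) ≡ b ℤ.* a ℤ.* c
  rearrange = solve-∀

Π^-Π-comm : ∀ (v w : A → A → ℤ) j F l → Π^ v j (Π w F) l ≡ Π w (Π^ v j F) l
Π^-Π-comm v w zero F l = refl
Π^-Π-comm v w (suc j) F l = trans (Π-cong v l (λ l′ _ → Π^-Π-comm v w j F l′)) (Π-comm v w (Π^ v j F) l)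

module _ (w : C → A → A → ℤ) where

  -- For F = `δ`, a weighted sum over all ways to assign disjoint pairs to the members of the list
  -- so that nothing is left over; with the weights `characterMatch` it is the number T.
  ΠΠ : List C → (List A → ℤ) → List A → ℤ
  ΠΠ [] F = F
  ΠΠ (χ ∷ X) F = Π (w χ) (ΠΠ X F)

  ΠΠ-cong : ∀ X {F G} → (∀ l → F l ≡ G l) → ∀ l → ΠΠ X F l ≡ ΠΠ X G l
  ΠΠ-cong [] F≡G l = F≡G l
  ΠΠ-cong (χ ∷ X) F≡G l = Π-cong (w χ) l λ l′ _ → ΠΠ-cong X F≡G l′

  ΠΠ-affine : ∀ X k F G l → ΠΠ X (λ l → F l ℤ.+ k ℤ.* G l) l ≡ ΠΠ X F l ℤ.+ k ℤ.* ΠΠ X G l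
  ΠΠ-affine [] k F G l = refl
  ΠΠ-affine (χ ∷ X) k F G l = begin
    Π (w χ) (ΠΠ X (λ l → F l ℤ.+ k ℤ.* G l)) l            ≡⟨ Π-cong (w χ) l (λ l′ _ → ΠΠ-affine X k F G l′) ⟩
    Π (w χ) (λ l → ΠΠ X F l ℤ.+ k ℤ.* ΠΠ X G l) l         ≡⟨ Π-+ (w χ) _ _ l ⟩
    ΠΠ (χ ∷ X) F l ℤ.+ Π (w χ) (λ l → k ℤ.* ΠΠ X G l) l   ≡⟨ cong (λ x → ΠΠ (χ ∷ X) F l ℤ.+ x) (Π-natural (scaling k) (w χ) _ l) ⟩
    ΠΠ (χ ∷ X) F l ℤ.+ k ℤ.* ΠΠ (χ ∷ X) G l               ∎

  ΠΠ-Π-comm : ∀ X v F l → ΠΠ X (Π v F) l ≡ Π v (ΠΠ X F) l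
  ΠΠ-Π-comm [] v F l = refl
  ΠΠ-Π-comm (χ ∷ X) v F l = trans (Π-cong (w χ) l (λ l′ _ → ΠΠ-Π-comm X v F l′)) (Π-comm (w χ) v (ΠΠ X F) l)

  module _ (v : A → A → ℤ) (d : C → A → A → ℤ)
           (w≡v-2d : ∀ χ i j → w χ i j ≡ v i j ℤ.+ ℤ.- (+ 2) ℤ.* d χ i j) where

    -- One factor v - 2 d of the product is multiplied out: v joins the power of `Π v`, while d is
    -- absorbed into the arbitrary F.
    ΠΠ-step : ∀ χ X j F l → ΠΠ (χ ∷ X) (Π^ v j F) l ≡
              ΠΠ X (Π^ v (suc j) F) l ℤ.+ ℤ.- (+ 2) ℤ.* ΠΠ X (Π^ v j (Π (d χ) F)) l
    ΠΠ-step χ X j F l = begin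
      Π (w χ) (ΠΠ X (Π^ v j F)) l
        ≡⟨ ΠΠ-Π-comm X (w χ) (Π^ v j F) l ⟨
      ΠΠ X (Π (w χ) (Π^ v j F)) l
        ≡⟨ ΠΠ-cong X (λ l → trans (Π-weight (ℤ.- (+ 2)) (w≡v-2d χ) (Π^ v j F) l)
             (cong (λ x → Π v (Π^ v j F) l ℤ.+ ℤ.- (+ 2) ℤ.* x) (sym (Π^-Π-comm v (d χ) j F l)))) l ⟩
      ΠΠ X (λ l → Π^ v (suc j) F l ℤ.+ ℤ.- (+ 2) ℤ.* Π^ v j (Π (d χ) F) l) l
        ≡⟨ ΠΠ-affine X (ℤ.- (+ 2)) _ _ l ⟩
      ΠΠ X (Π^ v (suc j) F) l ℤ.+ ℤ.- (+ 2) ℤ.* ΠΠ X (Π^ v j (Π (d χ) F)) l ∎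

    -- Multiplying out the remaining factors with i choices of v and k choices of - 2 d gives a term
    -- divisible by `2 ^ k * (j + i) !`, the factorial coming from `Π^-Γ`. The number μ holds the
    -- powers of two already collected.
    ΠΠ-divisible : ∀ N μ X j F l →
                   (∀ i k → i ℕ.+ k ≡ length X → N ∣ μ ℤ.* + (2 ℕ.^ k ℕ.* (j ℕ.+ i) !)) →
                   N ∣ μ ℤ.* ΠΠ X (Π^ v j F) l
    ΠΠ-divisible N μ [] j F l N∣ = subst (N ∣_) (begin
      μ ℤ.* + (1 ℕ.* (j ℕ.+ 0) !) ℤ.* Γ v j F l   ≡⟨ cong (λ x → μ ℤ.* + x ℤ.* Γ v j F l) (trans (ℕ.*-identityˡ _) (cong _! (ℕ.+-identityʳ j))) ⟩
      μ ℤ.* + (j !) ℤ.* Γ v j F l                 ≡⟨ ℤ.*-assoc μ _ _ ⟩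
      μ ℤ.* (+ (j !) ℤ.* Γ v j F l)               ≡⟨ cong (μ ℤ.*_) (Π^-Γ v j F l) ⟨
      μ ℤ.* Π^ v j F l                            ∎)
      (∣m⇒∣m*n (Γ v j F l) (N∣ 0 0 refl))
    ΠΠ-divisible N μ (χ ∷ X) j F l N∣ = subst (N ∣_) (begin
      μ ℤ.* ΠΠ X (Π^ v (suc j) F) l ℤ.+ μ ℤ.* ℤ.- (+ 2) ℤ.* ΠΠ X (Π^ v j (Π (d χ) F)) l
        ≡⟨ factor μ (ΠΠ X (Π^ v (suc j) F) l) _ ⟩
      μ ℤ.* (ΠΠ X (Π^ v (suc j) F) l ℤ.+ ℤ.- (+ 2) ℤ.* ΠΠ X (Π^ v j (Π (d χ) F)) l)
        ≡⟨ cong (μ ℤ.*_) (ΠΠ-step χ X j F l) ⟨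
      μ ℤ.* ΠΠ (χ ∷ X) (Π^ v j F) l ∎)
      (∣m∣n⇒∣m+n
        (ΠΠ-divisible N μ X (suc j) F l λ i k eq →
          subst (λ x → N ∣ μ ℤ.* + (2 ℕ.^ k ℕ.* x !)) (ℕ.+-suc j i) (N∣ (suc i) k (cong suc eq)))
        (ΠΠ-divisible N (μ ℤ.* ℤ.- (+ 2)) X j (Π (d χ) F) l λ i k eq →
          subst (N ∣_) (double k (j ℕ.+ i)) (∣m⇒∣m*n -1ℤ (N∣ i (suc k) (trans (ℕ.+-suc i k) (cong suc eq))))))
      where
      factor : ∀ a x y → a ℤ.* x ℤ.+ a ℤ.* ℤ.- (+ 2) ℤ.* y ≡ a ℤ.* (x ℤ.+ ℤ.- (+ 2) ℤ.* y)
      factor = solve-∀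
      regroup : ∀ a x → a ℤ.* (+ 2 ℤ.* x) ℤ.* -1ℤ ≡ a ℤ.* ℤ.- (+ 2) ℤ.* x
      regroup = solve-∀
      double : ∀ k t → μ ℤ.* + (2 ℕ.^ suc k ℕ.* t !) ℤ.* -1ℤ ≡ μ ℤ.* ℤ.- (+ 2) ℤ.* + (2 ℕ.^ k ℕ.* t !)
      double k t = trans
        (cong (λ x → μ ℤ.* x ℤ.* -1ℤ) (trans (cong +_ (ℕ.*-assoc 2 (2 ℕ.^ k) (t !))) (ℤ.pos-* 2 (2 ℕ.^ k ℕ.* t !))))
        (regroup μ (+ (2 ℕ.^ k ℕ.* t !)))

    -- Subtracting the pure power of `Π v` leaves the terms with at least one factor - 2 d, whence
    -- `suc k` in the hypothesis.
    ΠΠ-congruent : ∀ N X j F l →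
                   (∀ i k → i ℕ.+ suc k ≡ length X → N ∣ + (2 ℕ.^ suc k ℕ.* (j ℕ.+ i) !)) →
                   N ∣ ΠΠ X (Π^ v j F) l ℤ.- Π^ v (j ℕ.+ length X) F l
    ΠΠ-congruent N [] j F l N∣ = subst (N ∣_)
      (sym (trans (cong (λ x → Π^ v j F l ℤ.- Π^ v x F l) (ℕ.+-identityʳ j)) (ℤ.+-inverseʳ (Π^ v j F l))))
      (divides 0ℤ refl)
    ΠΠ-congruent N (χ ∷ X) j F l N∣ = subst (N ∣_) (begin
      (ΠΠ X (Π^ v (suc j) F) l ℤ.- Π^ v (suc j ℕ.+ length X) F l) ℤ.+ ℤ.- (+ 2) ℤ.* ΠΠ X (Π^ v j (Π (d χ) F)) l
        ≡⟨ rearrange (ΠΠ X (Π^ v (suc j) F) l) _ _ ⟩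
      (ΠΠ X (Π^ v (suc j) F) l ℤ.+ ℤ.- (+ 2) ℤ.* ΠΠ X (Π^ v j (Π (d χ) F)) l) ℤ.- Π^ v (suc j ℕ.+ length X) F l
        ≡⟨ cong₂ (λ x y → x ℤ.- Π^ v y F l) (ΠΠ-step χ X j F l) (ℕ.+-suc j (length X)) ⟨
      ΠΠ (χ ∷ X) (Π^ v j F) l ℤ.- Π^ v (j ℕ.+ suc (length X)) F l ∎)
      (∣m∣n⇒∣m+n
        (ΠΠ-congruent N X (suc j) F l λ i k eq →
          subst (λ x → N ∣ + (2 ℕ.^ suc k ℕ.* x !)) (ℕ.+-suc j i) (N∣ (suc i) k (cong suc eq)))
        -- Once - 2 d has been chosen, the remaining choices are unrestricted.
        (ΠΠ-divisible N (ℤ.- (+ 2)) X j (Π (d χ) F) l λ i k eq →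
          subst (N ∣_) (double k (j ℕ.+ i)) (∣m⇒∣m*n -1ℤ (N∣ i k (trans (ℕ.+-suc i k) (cong suc eq))))))
      where
      rearrange : ∀ x y z → (x ℤ.- y) ℤ.+ z ≡ (x ℤ.+ z) ℤ.- y
      rearrange = solve-∀
      negate : ∀ x → (+ 2 ℤ.* x) ℤ.* -1ℤ ≡ ℤ.- (+ 2) ℤ.* x
      negate = solve-∀
      double : ∀ k t → + (2 ℕ.^ suc k ℕ.* t !) ℤ.* -1ℤ ≡ ℤ.- (+ 2) ℤ.* + (2 ℕ.^ k ℕ.* t !)
      double k t = trans
        (cong (ℤ._* -1ℤ) (trans (cong +_ (ℕ.*-assoc 2 (2 ℕ.^ k) (t !))) (ℤ.pos-* 2 (2 ℕ.^ k ℕ.* t !))))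
        (negate (+ (2 ℕ.^ k ℕ.* t !)))

-- Counting matchings modulo powers of two

same : Bool → Bool → ℕ
same false false = 1
same true  true  = 1
same _     _     = 0

count : Bool → List (Bool × B) → ℕ
count ε [] = 0
count ε ((ε′ , _) ∷ l) = same ε ε′ ℕ.+ count ε l

match : Bool × B → Bool × B → ℤ
match (ε , _) (ε′ , _) = + same ε ε′

-- Elements of the other class have weight 0, so F has to be constant only on lists that have lost
-- an element of the class of i.
∂-constant : ∀ i (F : List (Bool × B) → ℤ) K l →
             (∀ l′ → suc (count (proj₁ i) l′) ≡ count (proj₁ i) l →
                     count (not (proj₁ i)) l′ ≡ count (not (proj₁ i)) l → F l′ ≡ K) →
             ∂ (match i) F l ≡ + count (proj₁ i) l ℤ.* K
∂-constant i F K [] F≡K = refl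
∂-constant i@(false , _) F K (j@(false , _) ∷ l) F≡K = trans
  (cong₂ ℤ._+_ (trans (ℤ.*-identityˡ (F l)) (F≡K l refl refl))
    (∂-constant i (F ∘ (j ∷_)) K l λ l′ p q → F≡K (j ∷ l′) (cong suc p) q))
  (sym (ℤ.suc-* (+ count false l) K))
∂-constant i@(false , _) F K (j@(true , _) ∷ l) F≡K = trans
  (ℤ.+-identityˡ _)
  (∂-constant i (F ∘ (j ∷_)) K l λ l′ p q → F≡K (j ∷ l′) p (cong suc q))
∂-constant i@(true , _) F K (j@(true , _) ∷ l) F≡K = trans
  (cong₂ ℤ._+_ (trans (ℤ.*-identityˡ (F l)) (F≡K l refl refl))
    (∂-constant i (F ∘ (j ∷_)) K l λ l′ p q → F≡K (j ∷ l′) (cong suc p) q))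
  (sym (ℤ.suc-* (+ count true l) K))
∂-constant i@(true , _) F K (j@(false , _) ∷ l) F≡K = trans
  (ℤ.+-identityˡ _)
  (∂-constant i (F ∘ (j ∷_)) K l λ l′ p q → F≡K (j ∷ l′) p (cong suc q))

-- The double factorial (2j - 1)!!, the number of perfect matchings of 2j
-- points.

matchings : ℕ → ℕ
matchings zero = 1
matchings (suc j) = suc (2 ℕ.* j) ℕ.* matchings j

δ : {A : Set} → List A → ℤ
δ [] = 1ℤ
δ (_ ∷ _) = 0ℤ

Γ-zero : ∀ {A : Set} (w : A → A → ℤ) r l → Γ w r (λ _ → 0ℤ) l ≡ 0ℤ
Γ-zero w zero l = refl
Γ-zero w (suc r) [] = refl
Γ-zero w (suc r) (i ∷ l) = cong₂ ℤ._+_ (Γ-zero w (suc r) l)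
  (trans (∂-cong (w i) l (λ l′ _ → Γ-zero w r l′)) (∂-natural zeroMap (w i) (λ _ → 0ℤ) l))
  where
  zeroMap : Equivariant {ℤ} {ℤ} (λ _ → 0ℤ)
  zeroMap = record { h-plus = λ _ _ → refl ; h-none = refl ; h-act = λ k _ → sym (ℤ.*-zeroʳ k) }

-- The first element cannot be left over because of `δ`. It has an odd number of possible partners
-- in its class, and the rest can be matched in equally many ways for each of them, whence the
-- product of two double factorials.
Γ-match : ∀ r j k (l : List (Bool × B)) → r ≡ j ℕ.+ k →
          count false l ≡ 2 ℕ.* j → count true l ≡ 2 ℕ.* k →
          Γ match r δ l ≡ + (matchings j ℕ.* matchings k)
Γ-match zero zero zero [] refl _ _ = refl
Γ-match (suc r) (suc j) k [] _ () _
Γ-match (suc r) zero (suc k) [] _ _ ()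
Γ-match zero zero zero ((false , _) ∷ l) refl () _
Γ-match zero zero zero ((true , _) ∷ l) refl _ ()
Γ-match (suc r) zero k ((false , _) ∷ l) _ () _
Γ-match (suc r) j zero ((true , _) ∷ l) _ _ ()
Γ-match (suc r) (suc j) k (i@(false , _) ∷ l) r≡ f≡ t≡ = begin
  Γ match (suc r) (λ _ → 0ℤ) l ℤ.+ ∂ (match i) (Γ match r δ) l
    ≡⟨ cong₂ ℤ._+_ (Γ-zero match (suc r) l) (∂-constant i _ (+ (matchings j ℕ.* matchings k)) l λ l′ p q →
         Γ-match r j k l′ (ℕ.suc-injective r≡) (ℕ.suc-injective (trans p f≡′)) (trans q t≡)) ⟩
  0ℤ ℤ.+ + count false l ℤ.* + (matchings j ℕ.* matchings k)
    ≡⟨ ℤ.+-identityˡ _ ⟩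
  + count false l ℤ.* + (matchings j ℕ.* matchings k)
    ≡⟨ ℤ.pos-* (count false l) _ ⟨
  + (count false l ℕ.* (matchings j ℕ.* matchings k))
    ≡⟨ cong +_ (trans (cong (ℕ._* (matchings j ℕ.* matchings k)) f≡′) (sym (ℕ.*-assoc (suc (2 ℕ.* j)) (matchings j) (matchings k)))) ⟩
  + (matchings (suc j) ℕ.* matchings k) ∎
  where
  f≡′ : count false l ≡ suc (2 ℕ.* j)
  f≡′ = trans (ℕ.suc-injective f≡) (ℕ.+-suc j (j ℕ.+ 0))
Γ-match (suc r) j (suc k) (i@(true , _) ∷ l) r≡ f≡ t≡ = begin
  Γ match (suc r) (λ _ → 0ℤ) l ℤ.+ ∂ (match i) (Γ match r δ) l
    ≡⟨ cong₂ ℤ._+_ (Γ-zero match (suc r) l) (∂-constant i _ (+ (matchings j ℕ.* matchings k)) l λ l′ p q →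
         Γ-match r j k l′ (ℕ.suc-injective (trans r≡ (ℕ.+-suc j k))) (trans q f≡) (ℕ.suc-injective (trans p t≡′))) ⟩
  0ℤ ℤ.+ + count true l ℤ.* + (matchings j ℕ.* matchings k)
    ≡⟨ ℤ.+-identityˡ _ ⟩
  + count true l ℤ.* + (matchings j ℕ.* matchings k)
    ≡⟨ ℤ.pos-* (count true l) _ ⟨
  + (count true l ℕ.* (matchings j ℕ.* matchings k))
    ≡⟨ cong +_ (trans (cong (ℕ._* (matchings j ℕ.* matchings k)) t≡′) (swap-factors (suc (2 ℕ.* k)) (matchings j) (matchings k))) ⟩
  + (matchings j ℕ.* matchings (suc k)) ∎
  where
  t≡′ : count true l ≡ suc (2 ℕ.* k)
  t≡′ = trans (ℕ.suc-injective t≡) (ℕ.+-suc k (k ℕ.+ 0))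
  swap-factors : ∀ a b c → a ℕ.* (b ℕ.* c) ≡ b ℕ.* (a ℕ.* c)
  swap-factors = ℕ-solve-∀

-- Powers of two dividing factorials

Odd : ℕ → Set
Odd m = ∃[ k ] m ≡ suc (2 ℕ.* k)

odd-* : ∀ {m n} → Odd m → Odd n → Odd (m ℕ.* n)
odd-* (j , refl) (k , refl) = j ℕ.+ k ℕ.+ 2 ℕ.* (j ℕ.* k) , expand j k
  where
  expand : ∀ j k → suc (2 ℕ.* j) ℕ.* suc (2 ℕ.* k) ≡ suc (2 ℕ.* (j ℕ.+ k ℕ.+ 2 ℕ.* (j ℕ.* k)))
  expand = ℕ-solve-∀

odd-matchings : ∀ j → Odd (matchings j)
odd-matchings zero = 0 , refl
odd-matchings (suc j) = odd-* (j , refl) (odd-matchings j)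

2∤odd : ∀ {m} → Odd m → ¬ (2 ℕ.∣ m)
2∤odd (k , refl) (ℕ.divides q eq) = ℕ.even≢odd q k (trans (ℕ.*-comm 2 q) (sym eq))

-- Even factors yield `2 ^ j * j !`, odd ones the double factorial. Since the latter is odd, the
-- exponent of 2 is found by repeated halving, as in Legendre's formula.
[2j]! : ∀ j → (2 ℕ.* j) ! ≡ 2 ℕ.^ j ℕ.* j ! ℕ.* matchings j
[2j]! zero = refl
[2j]! (suc j) = begin
  (2 ℕ.* suc j) !
    ≡⟨ cong _! (ℕ.*-suc 2 j) ⟩
  suc (suc (2 ℕ.* j)) ℕ.* (suc (2 ℕ.* j) ℕ.* (2 ℕ.* j) !)
    ≡⟨ cong (λ x → suc (suc (2 ℕ.* j)) ℕ.* (suc (2 ℕ.* j) ℕ.* x)) ([2j]! j) ⟩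
  suc (suc (2 ℕ.* j)) ℕ.* (suc (2 ℕ.* j) ℕ.* (2 ℕ.^ j ℕ.* j ! ℕ.* matchings j))
    ≡⟨ rearrange j (2 ℕ.^ j) (j !) (matchings j) ⟩
  2 ℕ.* 2 ℕ.^ j ℕ.* (suc j ℕ.* j !) ℕ.* (suc (2 ℕ.* j) ℕ.* matchings j) ∎
  where
  rearrange : ∀ j p f d → suc (suc (2 ℕ.* j)) ℕ.* (suc (2 ℕ.* j) ℕ.* (p ℕ.* f ℕ.* d)) ≡ 2 ℕ.* p ℕ.* (suc j ℕ.* f) ℕ.* (suc (2 ℕ.* j) ℕ.* d)
  rearrange = ℕ-solve-∀

[1+2j]! : ∀ j → suc (2 ℕ.* j) ! ≡ 2 ℕ.^ j ℕ.* j ! ℕ.* matchings (suc j)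
[1+2j]! j = trans (cong (suc (2 ℕ.* j) ℕ.*_) ([2j]! j)) (rearrange (suc (2 ℕ.* j)) (2 ℕ.^ j ℕ.* j !) (matchings j))
  where
  rearrange : ∀ a b c → a ℕ.* (b ℕ.* c) ≡ b ℕ.* (a ℕ.* c)
  rearrange = ℕ-solve-∀

-- The numbers `2 ^ m - 1`, built by appending a binary digit 1, in step with `[1+2j]!`.
mersenne : ℕ → ℕ
mersenne zero = 0
mersenne (suc m) = suc (2 ℕ.* mersenne m)

-- Equal to `2 ^ m - 1 - m`, the exponent of 2 in the factorial of `mersenne m`.
exponent : ℕ → ℕ
exponent zero = 0
exponent (suc m) = mersenne m ℕ.+ exponent m

mersenne! : ∀ m → ∃[ u ] Odd u × mersenne m ! ≡ 2 ℕ.^ exponent m ℕ.* u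
mersenne! zero = 1 , (0 , refl) , refl
mersenne! (suc m) with mersenne! m
... | u , odd-u , eq = u ℕ.* matchings (suc r) , odd-* odd-u (odd-matchings (suc r)) , (begin
  suc (2 ℕ.* r) !                                                   ≡⟨ [1+2j]! r ⟩
  2 ℕ.^ r ℕ.* r ! ℕ.* matchings (suc r)                             ≡⟨ cong (λ x → 2 ℕ.^ r ℕ.* x ℕ.* matchings (suc r)) eq ⟩
  2 ℕ.^ r ℕ.* (2 ℕ.^ exponent m ℕ.* u) ℕ.* matchings (suc r)        ≡⟨ rearrange (2 ℕ.^ r) (2 ℕ.^ exponent m) u _ ⟩
  2 ℕ.^ r ℕ.* 2 ℕ.^ exponent m ℕ.* (u ℕ.* matchings (suc r))        ≡⟨ cong (ℕ._* (u ℕ.* matchings (suc r))) (ℕ.^-distribˡ-+-* 2 r (exponent m)) ⟨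
  2 ℕ.^ (r ℕ.+ exponent m) ℕ.* (u ℕ.* matchings (suc r))            ∎)
  where
  r = mersenne m
  rearrange : ∀ a b c d → a ℕ.* (b ℕ.* c) ℕ.* d ≡ a ℕ.* b ℕ.* (c ℕ.* d)
  rearrange = ℕ-solve-∀

halve : ∀ i → (∃[ j ] i ≡ 2 ℕ.* j) ⊎ Odd i
halve zero = inj₁ (0 , refl)
halve (suc i) with halve i
... | inj₁ (j , refl) = inj₂ (j , refl)
... | inj₂ (j , refl) = inj₁ (suc j , sym (ℕ.*-suc 2 j))

-- The induction strips the last binary digit of i. It ends at the highest digit 0 of i, above which
-- i agrees with `mersenne m`, and that digit supplies the additional factor 2.
mersenne-divisible : ∀ m i k → i ℕ.+ suc k ≡ mersenne m → 2 ℕ.^ suc (exponent m) ℕ.∣ 2 ℕ.^ suc k ℕ.* i !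
mersenne-divisible zero i k eq with trans (sym (ℕ.+-suc i k)) eq
... | ()
mersenne-divisible (suc m) i k eq with halve i | halve k
-- `i + k` is twice `mersenne m`, so i and k have equal parity.
... | inj₁ (j , refl) | inj₂ (l , refl) =
  contradiction (begin
    2 ℕ.* mersenne m                ≡⟨ ℕ.suc-injective (trans (sym (ℕ.+-suc (2 ℕ.* j) (suc (2 ℕ.* l)))) eq) ⟨
    2 ℕ.* j ℕ.+ suc (2 ℕ.* l)       ≡⟨ rearrange j l ⟩
    suc (2 ℕ.* (j ℕ.+ l))           ∎) (ℕ.even≢odd (mersenne m) (j ℕ.+ l))
  where
  rearrange : ∀ j l → 2 ℕ.* j ℕ.+ suc (2 ℕ.* l) ≡ suc (2 ℕ.* (j ℕ.+ l))
  rearrange = ℕ-solve-∀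
... | inj₂ (j , refl) | inj₁ (l , refl) =
  contradiction (begin
    2 ℕ.* mersenne m                ≡⟨ ℕ.suc-injective (trans (sym (ℕ.+-suc (suc (2 ℕ.* j)) (2 ℕ.* l))) eq) ⟨
    suc (2 ℕ.* j) ℕ.+ 2 ℕ.* l       ≡⟨ cong suc (ℕ.*-distribˡ-+ 2 j l) ⟨
    suc (2 ℕ.* (j ℕ.+ l))           ∎) (ℕ.even≢odd (mersenne m) (j ℕ.+ l))
-- The only digit 0 of i is the last one: i is twice `mersenne m`, and the single factor 2 makes up
-- for it.
... | inj₁ (j , refl) | inj₁ (zero , refl) with mersenne! m
...   | u , _ , r!≡ = ℕ.divides (u ℕ.* matchings r) (begin
    2 ℕ.* (2 ℕ.* j) !
      ≡⟨ cong (λ x → 2 ℕ.* (2 ℕ.* x) !) j≡r ⟩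
    2 ℕ.* (2 ℕ.* r) !
      ≡⟨ cong (2 ℕ.*_) ([2j]! r) ⟩
    2 ℕ.* (2 ℕ.^ r ℕ.* r ! ℕ.* matchings r)
      ≡⟨ cong (λ x → 2 ℕ.* (2 ℕ.^ r ℕ.* x ℕ.* matchings r)) r!≡ ⟩
    2 ℕ.* (2 ℕ.^ r ℕ.* (2 ℕ.^ exponent m ℕ.* u) ℕ.* matchings r)
      ≡⟨ rearrange (2 ℕ.^ r) (2 ℕ.^ exponent m) u (matchings r) ⟩
    u ℕ.* matchings r ℕ.* (2 ℕ.* (2 ℕ.^ r ℕ.* 2 ℕ.^ exponent m))
      ≡⟨ cong (λ x → u ℕ.* matchings r ℕ.* (2 ℕ.* x)) (ℕ.^-distribˡ-+-* 2 r (exponent m)) ⟨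
    u ℕ.* matchings r ℕ.* 2 ℕ.^ suc (r ℕ.+ exponent m) ∎)
  where
  r = mersenne m
  j≡r : j ≡ r
  j≡r = ℕ.*-cancelˡ-≡ j r 2 (ℕ.suc-injective (trans (ℕ.+-comm 1 (2 ℕ.* j)) eq))
  rearrange : ∀ a b c d → 2 ℕ.* (a ℕ.* (b ℕ.* c) ℕ.* d) ≡ c ℕ.* d ℕ.* (2 ℕ.* (a ℕ.* b))
  rearrange = ℕ-solve-∀
mersenne-divisible (suc m) i k eq | inj₁ (j , refl) | inj₁ (suc l , refl) =
  subst₂ ℕ._∣_ (begin
      2 ℕ.^ suc r ℕ.* 2 ℕ.^ suc (exponent m)
        ≡⟨ rearrange₁ (2 ℕ.^ r) (2 ℕ.^ exponent m) ⟩
      2 ℕ.* (2 ℕ.* (2 ℕ.^ r ℕ.* 2 ℕ.^ exponent m))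
        ≡⟨ cong (λ x → 2 ℕ.* (2 ℕ.* x)) (ℕ.^-distribˡ-+-* 2 r (exponent m)) ⟨
      2 ℕ.* (2 ℕ.^ suc (r ℕ.+ exponent m)) ∎)
    (begin
      2 ℕ.^ suc r ℕ.* (2 ℕ.^ suc l ℕ.* j ! ℕ.* (2 ℕ.* matchings j))
        ≡⟨ cong (λ x → 2 ℕ.^ suc x ℕ.* (2 ℕ.^ suc l ℕ.* j ! ℕ.* (2 ℕ.* matchings j))) r≡ ⟨
      2 ℕ.^ suc (j ℕ.+ suc l) ℕ.* (2 ℕ.^ suc l ℕ.* j ! ℕ.* (2 ℕ.* matchings j))
        ≡⟨ cong (λ x → 2 ℕ.* x ℕ.* (2 ℕ.^ suc l ℕ.* j ! ℕ.* (2 ℕ.* matchings j))) (ℕ.^-distribˡ-+-* 2 j (suc l)) ⟩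
      2 ℕ.* (2 ℕ.^ j ℕ.* 2 ℕ.^ suc l) ℕ.* (2 ℕ.^ suc l ℕ.* j ! ℕ.* (2 ℕ.* matchings j))
        ≡⟨ rearrange₂ (2 ℕ.^ j) (2 ℕ.^ suc l) (j !) (matchings j) ⟩
      2 ℕ.* (2 ℕ.* (2 ℕ.^ suc l ℕ.* 2 ℕ.^ suc l) ℕ.* (2 ℕ.^ j ℕ.* j ! ℕ.* matchings j))
        ≡⟨ cong₂ (λ x y → 2 ℕ.* (2 ℕ.* x ℕ.* y)) (trans (sym (ℕ.^-distribˡ-+-* 2 (suc l) (suc l))) (cong (λ x → 2 ℕ.^ (suc l ℕ.+ x)) (sym (ℕ.+-identityʳ (suc l))))) (sym ([2j]! j)) ⟩
      2 ℕ.* (2 ℕ.^ suc (2 ℕ.* suc l) ℕ.* (2 ℕ.* j) !) ∎)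
    (ℕ.*-monoʳ-∣ (2 ℕ.^ suc r) (ℕ.∣m⇒∣m*n (2 ℕ.* matchings j) (mersenne-divisible m j l r≡)))
  |> ℕ.*-cancelˡ-∣ 2
  where
  r = mersenne m
  r≡ : j ℕ.+ suc l ≡ r
  r≡ = ℕ.*-cancelˡ-≡ _ r 2 (trans (ℕ.*-distribˡ-+ 2 j (suc l)) (ℕ.suc-injective (trans (sym (ℕ.+-suc (2 ℕ.* j) (2 ℕ.* suc l))) eq)))
  rearrange₁ : ∀ a b → 2 ℕ.* a ℕ.* (2 ℕ.* b) ≡ 2 ℕ.* (2 ℕ.* (a ℕ.* b))
  rearrange₁ = ℕ-solve-∀
  rearrange₂ : ∀ a b f d → 2 ℕ.* (a ℕ.* b) ℕ.* (b ℕ.* f ℕ.* (2 ℕ.* d)) ≡ 2 ℕ.* (2 ℕ.* (b ℕ.* b) ℕ.* (a ℕ.* f ℕ.* d))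
  rearrange₂ = ℕ-solve-∀
mersenne-divisible (suc m) i k eq | inj₂ (j , refl) | inj₂ (l , refl) =
  subst₂ ℕ._∣_ (begin
      2 ℕ.^ r ℕ.* 2 ℕ.^ suc (exponent m)
        ≡⟨ rearrange₁ (2 ℕ.^ r) (2 ℕ.^ exponent m) ⟩
      2 ℕ.* (2 ℕ.^ r ℕ.* 2 ℕ.^ exponent m)
        ≡⟨ cong (2 ℕ.*_) (ℕ.^-distribˡ-+-* 2 r (exponent m)) ⟨
      2 ℕ.^ suc (r ℕ.+ exponent m) ∎)
    (begin
      2 ℕ.^ r ℕ.* (2 ℕ.^ suc l ℕ.* j ! ℕ.* matchings (suc j))
        ≡⟨ cong (λ x → 2 ℕ.^ x ℕ.* (2 ℕ.^ suc l ℕ.* j ! ℕ.* matchings (suc j))) r≡ ⟨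
      2 ℕ.^ (j ℕ.+ suc l) ℕ.* (2 ℕ.^ suc l ℕ.* j ! ℕ.* matchings (suc j))
        ≡⟨ cong (ℕ._* (2 ℕ.^ suc l ℕ.* j ! ℕ.* matchings (suc j))) (ℕ.^-distribˡ-+-* 2 j (suc l)) ⟩
      2 ℕ.^ j ℕ.* 2 ℕ.^ suc l ℕ.* (2 ℕ.^ suc l ℕ.* j ! ℕ.* matchings (suc j))
        ≡⟨ rearrange₂ (2 ℕ.^ j) (2 ℕ.^ suc l) (j !) (matchings (suc j)) ⟩
      2 ℕ.^ suc l ℕ.* 2 ℕ.^ suc l ℕ.* (2 ℕ.^ j ℕ.* j ! ℕ.* matchings (suc j))
        ≡⟨ cong₂ ℕ._*_ (trans (sym (ℕ.^-distribˡ-+-* 2 (suc l) (suc l))) (cong (2 ℕ.^_) (exponents l))) (sym ([1+2j]! j)) ⟩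
      2 ℕ.^ suc (suc (2 ℕ.* l)) ℕ.* suc (2 ℕ.* j) ! ∎)
    (ℕ.*-monoʳ-∣ (2 ℕ.^ r) (ℕ.∣m⇒∣m*n (matchings (suc j)) (mersenne-divisible m j l r≡)))
  where
  r = mersenne m
  exponents : ∀ l → suc l ℕ.+ suc l ≡ suc (suc (2 ℕ.* l))
  exponents = ℕ-solve-∀
  odds : ∀ j l → suc (2 ℕ.* j) ℕ.+ suc (2 ℕ.* l) ≡ 2 ℕ.* (j ℕ.+ suc l)
  odds = ℕ-solve-∀
  r≡ : j ℕ.+ suc l ≡ r
  r≡ = ℕ.*-cancelˡ-≡ _ r 2 (trans (sym (odds j l)) (ℕ.suc-injective (trans (sym (ℕ.+-suc (suc (2 ℕ.* j)) (suc (2 ℕ.* l)))) eq)))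
  rearrange₁ : ∀ a b → a ℕ.* (2 ℕ.* b) ≡ 2 ℕ.* (a ℕ.* b)
  rearrange₁ = ℕ-solve-∀
  rearrange₂ : ∀ a b f d → a ℕ.* b ℕ.* (b ℕ.* f ℕ.* d) ≡ b ℕ.* b ℕ.* (a ℕ.* f ℕ.* d)
  rearrange₂ = ℕ-solve-∀

module _ {C : Set} (m : ℕ) (s d : C → B → B → ℤ) (s≡1-2d : ∀ χ b c → s χ b c ≡ 1ℤ ℤ.+ ℤ.- (+ 2) ℤ.* d χ b c) where

  signedMatch : C → Bool × B → Bool × B → ℤ
  signedMatch χ i j = match i j ℤ.* s χ (proj₂ i) (proj₂ j)

  -- Modulo `2 ^ suc e` the sum is `r !` times the number of matchings, that is `2 ^ e` times an odd
  -- number; were it 0, that odd number would be even.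
  ΠΠ-nonzero : ∀ (X : List C) l j k → length X ≡ mersenne m → mersenne m ≡ j ℕ.+ k →
               count false l ≡ 2 ℕ.* j → count true l ≡ 2 ℕ.* k →
               ΠΠ signedMatch X δ l ≢ 0ℤ
  ΠΠ-nonzero X l j k ∣X∣≡r r≡ f≡ t≡ ≡0 with mersenne! m
  ... | u , odd-u , r!≡ = 2∤odd (odd-* odd-u (odd-* (odd-matchings j) (odd-matchings k)))
    (ℕ.*-cancelˡ-∣ (2 ℕ.^ e) {{ℕ.m^n≢0 2 e}} (subst₂ ℕ._∣_ (ℕ.*-comm 2 (2 ℕ.^ e)) refl (∣⇒∣ᵤ N∣value)))
    where
    e = exponent m
    N = + (2 ℕ.^ suc e)
    v≡ : ∀ χ i j → signedMatch χ i j ≡ match i j ℤ.+ ℤ.- (+ 2) ℤ.* (match i j ℤ.* d χ (proj₂ i) (proj₂ j))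
    v≡ χ i j = trans (cong (match i j ℤ.*_) (s≡1-2d χ (proj₂ i) (proj₂ j))) (expand (match i j) _)
      where
      expand : ∀ x y → x ℤ.* (1ℤ ℤ.+ ℤ.- (+ 2) ℤ.* y) ≡ x ℤ.+ ℤ.- (+ 2) ℤ.* (x ℤ.* y)
      expand = solve-∀
    value : Π^ match (length X) δ l ≡ + (2 ℕ.^ e ℕ.* (u ℕ.* (matchings j ℕ.* matchings k)))
    value = begin
      Π^ match (length X) δ l                                  ≡⟨ cong (λ r → Π^ match r δ l) ∣X∣≡r ⟩
      Π^ match (mersenne m) δ l                                ≡⟨ Π^-Γ match (mersenne m) δ l ⟩
      + (mersenne m !) ℤ.* Γ match (mersenne m) δ l            ≡⟨ cong₂ (λ x y → + x ℤ.* y) r!≡ (Γ-match (mersenne m) j k l r≡ f≡ t≡) ⟩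
      + (2 ℕ.^ e ℕ.* u) ℤ.* + (matchings j ℕ.* matchings k)    ≡⟨ ℤ.pos-* (2 ℕ.^ e ℕ.* u) _ ⟨
      + (2 ℕ.^ e ℕ.* u ℕ.* (matchings j ℕ.* matchings k))      ≡⟨ cong +_ (ℕ.*-assoc (2 ℕ.^ e) u _) ⟩
      + (2 ℕ.^ e ℕ.* (u ℕ.* (matchings j ℕ.* matchings k)))    ∎
    N∣value : N ∣ + (2 ℕ.^ e ℕ.* (u ℕ.* (matchings j ℕ.* matchings k)))
    N∣value = subst (N ∣_) value (∣m+n∣m⇒∣n
      (subst (N ∣_) (sym (trans (cong₂ ℤ._+_ (cong (ℤ._- Π^ match (length X) δ l) ≡0) refl) (cancel (Π^ match (length X) δ l)))) (divides 0ℤ refl))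
      (ΠΠ-congruent signedMatch match (λ χ i j → match i j ℤ.* d χ (proj₂ i) (proj₂ j)) v≡ N X 0 δ l λ i k eq →
        ∣ᵤ⇒∣ (mersenne-divisible m i k (trans eq ∣X∣≡r))))
      where
      cancel : ∀ x → (0ℤ ℤ.- x) ℤ.+ x ≡ 0ℤ
      cancel = solve-∀

-- Characters and generators

sumV : (Vec Bool m → Λ n) → Λ n
sumV {zero} f = f []
sumV {suc m} f = sumV (f ∘ (false ∷_)) + sumV (f ∘ (true ∷_))

sumV-cong : {f g : Vec Bool m → Λ n} → (∀ x → f x ≡ g x) → sumV f ≡ sumV g
sumV-cong {zero} f≡g = f≡g []
sumV-cong {suc m} f≡g = cong₂ _+_ (sumV-cong (f≡g ∘ (false ∷_))) (sumV-cong (f≡g ∘ (true ∷_)))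

sumV-+ : (f g : Vec Bool m → Λ n) → sumV (λ x → f x + g x) ≡ sumV f + sumV g
sumV-+ {zero} f g = refl
sumV-+ {suc m} f g = trans (cong₂ _+_ (sumV-+ (f ∘ (false ∷_)) _) (sumV-+ (f ∘ (true ∷_)) _)) (+-interchange _ _ _ _)

sumV-natural : (h : Λ n → Λ n) → (∀ x y → h (x + y) ≡ h x + h y) →
               (f : Vec Bool m → Λ n) → h (sumV f) ≡ sumV (h ∘ f)
sumV-natural {m = zero} h h-+ f = refl
sumV-natural {m = suc m} h h-+ f = trans (h-+ _ _)
  (cong₂ _+_ (sumV-natural h h-+ (f ∘ (false ∷_))) (sumV-natural h h-+ (f ∘ (true ∷_))))

+-nonzero : {x y : Λ n} → x + y ≢ 0# → x ≢ 0# ⊎ y ≢ 0#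
+-nonzero {x = x} {y} x+y≢0 with x ≟0
... | no x≢0 = inj₁ x≢0
... | yes refl = inj₂ λ { refl → x+y≢0 (+-identityˡ 0#) }

-- Since equality with 0 is decidable, the witness is found by search; this is what makes the pairs
-- explicit.
sumV-nonzero : (f : Vec Bool m → Λ n) → sumV f ≢ 0# → ∃[ x ] f x ≢ 0#
sumV-nonzero {zero} f f≢0 = [] , f≢0
sumV-nonzero {suc m} f f≢0 with +-nonzero f≢0
... | inj₁ ≢0 = let x , fx≢0 = sumV-nonzero (f ∘ (false ∷_)) ≢0 in false ∷ x , fx≢0
... | inj₂ ≢0 = let x , fx≢0 = sumV-nonzero (f ∘ (true ∷_)) ≢0 in true ∷ x , fx≢0

sign : Bool → ℤ
sign false = 1ℤ
sign true = -1ℤ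

character : Vec Bool m → Vec Bool m → ℤ
character [] [] = 1ℤ
character (p ∷ χ) (q ∷ x) = sign (p ∧ q) ℤ.* character χ x

-- The unnormalised transform, whose value at x is the sum of `character χ x • α χ`, unfolded one
-- coordinate at a time to suit the induction in `plancherel`.
fourier : (Vec Bool m → Λ n) → Vec Bool m → Λ n
fourier α [] = α []
fourier α (b ∷ x) = fourier (α ∘ (false ∷_)) x + sign b • fourier (α ∘ (true ∷_)) x

fourier-linear : {α : Vec Bool m → Λ n} → (∀ χ → Linear (α χ)) → ∀ x → Linear (fourier α x)
fourier-linear α-linear [] = α-linear []
fourier-linear α-linear (b ∷ x) = linear-+ (fourier-linear (α-linear ∘ (false ∷_)) x)
  (linear-• (sign b) (fourier-linear (α-linear ∘ (true ∷_)) x))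

*-expand : ∀ s t (a b c d : Λ n) → (a + s • b) * (c + t • d) ≡
           (a * c + (s ℤ.* t) • (b * d)) + (t • (a * d) + s • (b * c))
*-expand s t a b c d = begin
  (a + s • b) * (c + t • d)
    ≡⟨ *-distribˡ (a + s • b) c (t • d) ⟩
  (a + s • b) * c + (a + s • b) * (t • d)
    ≡⟨ cong₂ _+_ (trans (*-distribʳ c a (s • b)) (cong (λ x → a * c + x) (•-*ˡ s b c)))
         (trans (•-*ʳ t _ d) (trans (cong (t •_) (trans (*-distribʳ d a (s • b)) (cong (λ x → a * d + x) (•-*ˡ s b d)))) (•-distribˡ t _ _))) ⟩
  (a * c + s • (b * c)) + (t • (a * d) + t • (s • (b * d)))
    ≡⟨ cong₂ _+_ (refl {x = a * c + s • (b * c)}) (+-comm _ _) ⟩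
  (a * c + s • (b * c)) + (t • (s • (b * d)) + t • (a * d))
    ≡⟨ +-interchange _ _ _ _ ⟩
  (a * c + t • (s • (b * d))) + (s • (b * c) + t • (a * d))
    ≡⟨ cong₂ _+_ (cong (λ x → a * c + x) (trans (•-comm t s _) (sym (•-assoc s t _)))) (+-comm _ _) ⟩
  (a * c + (s ℤ.* t) • (b * d)) + (t • (a * d) + s • (b * c)) ∎

-- Orthogonality of characters in a single coordinate: the cross terms carry opposite signs in the
-- two summands.
*-expand-twice : ∀ t (a b c d : Λ n) →
                 (a + 1ℤ • b) * (c + t • d) + (a + -1ℤ • b) * (c + (-1ℤ ℤ.* t) • d) ≡
                 + 2 • (a * c + t • (b * d))
*-expand-twice t a b c d = begin
  (a + 1ℤ • b) * (c + t • d) + (a + -1ℤ • b) * (c + (-1ℤ ℤ.* t) • d)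
    ≡⟨ cong₂ _+_ (*-expand 1ℤ t a b c d) (*-expand -1ℤ (-1ℤ ℤ.* t) a b c d) ⟩
  ((a * c + (1ℤ ℤ.* t) • (b * d)) + (t • (a * d) + 1ℤ • (b * c))) +
  ((a * c + (-1ℤ ℤ.* (-1ℤ ℤ.* t)) • (b * d)) + ((-1ℤ ℤ.* t) • (a * d) + -1ℤ • (b * c)))
    ≡⟨ +-interchange _ _ _ _ ⟩
  ((a * c + (1ℤ ℤ.* t) • (b * d)) + (a * c + (-1ℤ ℤ.* (-1ℤ ℤ.* t)) • (b * d))) +
  ((t • (a * d) + 1ℤ • (b * c)) + ((-1ℤ ℤ.* t) • (a * d) + -1ℤ • (b * c)))
    ≡⟨ cong₂ _+_ (cong₂ (λ x y → (a * c + x • (b * d)) + (a * c + y • (b * d))) (ℤ.*-identityˡ t) (cancel t)) cross ⟩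
  ((a * c + t • (b * d)) + (a * c + t • (b * d))) + 0#
    ≡⟨ +-identityʳ _ ⟩
  (a * c + t • (b * d)) + (a * c + t • (b * d))
    ≡⟨ twice _ ⟨
  + 2 • (a * c + t • (b * d)) ∎
  where
  twice : (x : Λ n) → + 2 • x ≡ x + x
  twice x = trans (•-distribʳ 1ℤ 1ℤ x) (cong₂ _+_ (•-identity x) (•-identity x))
  cancel : ∀ t → -1ℤ ℤ.* (-1ℤ ℤ.* t) ≡ t
  cancel = solve-∀
  cross : (t • (a * d) + 1ℤ • (b * c)) + ((-1ℤ ℤ.* t) • (a * d) + -1ℤ • (b * c)) ≡ 0#
  cross = begin
    (t • (a * d) + 1ℤ • (b * c)) + ((-1ℤ ℤ.* t) • (a * d) + -1ℤ • (b * c))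
      ≡⟨ cong₂ (λ x y → (t • (a * d) + x) + (y + -1ℤ • (b * c))) (•-identity _) (•-assoc -1ℤ t _) ⟩
    (t • (a * d) + b * c) + (-1ℤ • (t • (a * d)) + -1ℤ • (b * c))
      ≡⟨ cong (λ x → (t • (a * d) + b * c) + x) (•-distribˡ -1ℤ _ _) ⟨
    (t • (a * d) + b * c) + -1ℤ • (t • (a * d) + b * c)
      ≡⟨ +-inverse _ ⟩
    0# ∎

correlation : (α β : Vec Bool m → Λ n) → Vec Bool m → Λ n
correlation α β c = sumV λ x → fourier α x * fourier β (x ⊕ c)

-- Orthogonality, coordinate by coordinate. A shift by c acts on the transform as multiplication by
-- `character χ c`, so all shifts become diagonal in the same generators.
plancherel : (α β : Vec Bool m → Λ n) → ∀ c →
             correlation α β c ≡ + (2 ℕ.^ m) • sumV (λ χ → character χ c • (α χ * β χ))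
plancherel α β [] = trans (sym (•-identity _)) (cong (1ℤ •_) (sym (•-identity _)))
plancherel {suc m} {n} α β (b ∷ c) = begin
  sumV (λ x → (A₀ x + 1ℤ • A₁ x) * (B₀ x + sign b • B₁ x)) + sumV (λ x → (A₀ x + -1ℤ • A₁ x) * (B₀ x + sign (not b) • B₁ x))
    ≡⟨ sumV-+ {m = m} _ _ ⟨
  sumV (λ x → (A₀ x + 1ℤ • A₁ x) * (B₀ x + sign b • B₁ x) + (A₀ x + -1ℤ • A₁ x) * (B₀ x + sign (not b) • B₁ x))
    ≡⟨ sumV-cong (λ x → trans
         (cong (λ t → (A₀ x + 1ℤ • A₁ x) * (B₀ x + sign b • B₁ x) + (A₀ x + -1ℤ • A₁ x) * (B₀ x + t • B₁ x)) (sign-not b))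
         (*-expand-twice (sign b) (A₀ x) (A₁ x) (B₀ x) (B₁ x))) ⟩
  sumV (λ x → + 2 • (A₀ x * B₀ x + sign b • (A₁ x * B₁ x)))
    ≡⟨ sumV-natural {m = m} (+ 2 •_) (•-distribˡ (+ 2)) _ ⟨
  + 2 • sumV (λ x → A₀ x * B₀ x + sign b • (A₁ x * B₁ x))
    ≡⟨ cong (+ 2 •_) (trans (sumV-+ {m = m} (λ x → A₀ x * B₀ x) _) (cong (λ x → sumV (λ x → A₀ x * B₀ x) + x) (sym (sumV-natural {m = m} (sign b •_) (•-distribˡ (sign b)) _)))) ⟩
  + 2 • (correlation (α ∘ (false ∷_)) (β ∘ (false ∷_)) c + sign b • correlation (α ∘ (true ∷_)) (β ∘ (true ∷_)) c)
    ≡⟨ cong₂ (λ x y → + 2 • (x + sign b • y)) (plancherel (α ∘ (false ∷_)) _ c) (plancherel (α ∘ (true ∷_)) _ c) ⟩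
  + 2 • (+ (2 ℕ.^ m) • S₀ + sign b • (+ (2 ℕ.^ m) • S₁))
    ≡⟨ cong (λ x → + 2 • (+ (2 ℕ.^ m) • S₀ + x)) (•-comm (sign b) (+ (2 ℕ.^ m)) S₁) ⟩
  + 2 • (+ (2 ℕ.^ m) • S₀ + + (2 ℕ.^ m) • (sign b • S₁))
    ≡⟨ cong (+ 2 •_) (•-distribˡ (+ (2 ℕ.^ m)) _ _) ⟨
  + 2 • (+ (2 ℕ.^ m) • (S₀ + sign b • S₁))
    ≡⟨ •-assoc (+ 2) (+ (2 ℕ.^ m)) _ ⟨
  (+ 2 ℤ.* + (2 ℕ.^ m)) • (S₀ + sign b • S₁)
    ≡⟨ cong₂ _•_ (sym (ℤ.pos-* 2 (2 ℕ.^ m))) (cong₂ _+_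
         (sumV-cong (λ χ → cong (_• (α (false ∷ χ) * β (false ∷ χ))) (sym (ℤ.*-identityˡ (character χ c)))))
         (trans (sumV-natural {m = m} (sign b •_) (•-distribˡ (sign b)) _) (sumV-cong λ χ → sym (•-assoc (sign b) (character χ c) _)))) ⟩
  + (2 ℕ.^ suc m) • sumV (λ χ → character χ (b ∷ c) • (α χ * β χ)) ∎
  where
  A₀ A₁ B₀ B₁ : Vec Bool m → Λ n
  A₀ = fourier (α ∘ (false ∷_))
  A₁ = fourier (α ∘ (true ∷_))
  B₀ x = fourier (β ∘ (false ∷_)) (x ⊕ c)
  B₁ x = fourier (β ∘ (true ∷_)) (x ⊕ c)
  S₀ S₁ : Λ n
  S₀ = sumV (λ χ → character χ c • (α (false ∷ χ) * β (false ∷ χ)))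
  S₁ = sumV (λ χ → character χ c • (α (true ∷ χ) * β (true ∷ χ)))
  sign-not : ∀ b → sign (not b) ≡ -1ℤ ℤ.* sign b
  sign-not false = refl
  sign-not true = refl

prod : List (Λ n) → Λ n
prod = foldr _*_ 1#

-- Generators named by the elements of a list; any other name denotes 0.

module _ {I : Set} (_≟_ : (i j : I) → Dec (i ≡ j)) where

  generator : (is : List I) → I → Λ (length is)
  generator [] j = 0#
  generator (i ∷ is) j with j ≟ i
  ... | yes _ = 0# ⊞ 1#
  ... | no  _ = generator is j ⊞ 0#

  generator-linear : ∀ is j → Linear (generator is j)
  generator-linear [] j = refl
  generator-linear (i ∷ is) j with j ≟ i
  ... | yes _ = linear-0# , 1ℤ , sym (•-identity 1#)
  ... | no  _ = generator-linear is j , 0ℤ , sym (•-zeroˡ 1#)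

  generator-∉ : ∀ is {j} → j ∉ is → generator is j ≡ 0#
  generator-∉ [] j∉is = refl
  generator-∉ (i ∷ is) {j} j∉is with j ≟ i
  ... | yes j≡i = contradiction (here j≡i) j∉is
  ... | no  _ = cong (_⊞ 0#) (generator-∉ is (j∉is ∘ there))

  -- Only the factor named i involves the newest generator, whose coefficient in the product is
  -- therefore the product of the other factors.
  prod-generator : ∀ is → Unique is → prod (map (generator is) is) ≢ 0#
  prod-generator [] _ ()
  prod-generator (i ∷ is) (i∉is ∷ is!) eq with i ≟ i
  ... | no i≢i = i≢i refl
  ... | yes _ = prod-generator is is! (begin
    prod (map (generator is) is)                 ≡⟨ trans (cong₂ _+_ (*-zeroʳ (bar 0#)) (*-identityˡ _)) (+-identityˡ _) ⟨
    bar 0# * 0# + 1# * prod (map (generator is) is) ≡⟨ second (trans (cong ((0# ⊞ 1#) *_) (sym (rest is i∉is))) eq) ⟩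
    0#                                           ∎)
    where
    second : ∀ {n} {a b c d : Λ n} → (a ⊞ b) ≡ (c ⊞ d) → b ≡ d
    second refl = refl
    rest : ∀ js → All (i ≢_) js → prod (map (generator (i ∷ is)) js) ≡ prod (map (generator is) js) ⊞ 0#
    rest [] [] = refl
    rest (j ∷ js) (i≢j ∷ i∉js) with j ≟ i
    ... | yes j≡i = contradiction (sym j≡i) i≢j
    ... | no _ = trans (cong ((generator is j ⊞ 0#) *_) (rest js i∉js))
      (cong₂ _⊞_ refl (trans (cong₂ _+_ (*-zeroʳ _) (*-zeroˡ _)) (+-identityˡ 0#)))

-- Products of crossing forms

+-both-zero : {x y : Λ n} → x ≡ 0# → y ≡ 0# → x + y ≡ 0#
+-both-zero refl refl = +-identityˡ 0#

•-zero : ∀ k {x : Λ n} → x ≡ 0# → k • x ≡ 0#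
•-zero k refl = •-zeroʳ k

*-repeatedˡ : {a : Λ n} → Linear a → ∀ y z → (a * y) * (a * z) ≡ 0#
*-repeatedˡ {a = a} a-lin y z = begin
  (a * y) * (a * z)  ≡⟨ *-assoc (a * y) a z ⟨
  (a * y * a) * z    ≡⟨ cong (_* z) (trans (*-assoc a y a) (linear-sandwich a-lin y)) ⟩
  0# * z             ≡⟨ *-zeroˡ z ⟩
  0#                 ∎

*-repeatedʳ : {b : Λ n} → Linear b → ∀ y z → (y * b) * (z * b) ≡ 0#
*-repeatedʳ {b = b} b-lin y z = begin
  (y * b) * (z * b)  ≡⟨ *-assoc y b (z * b) ⟩
  y * (b * (z * b))  ≡⟨ cong (y *_) (linear-sandwich b-lin z) ⟩
  y * 0#             ≡⟨ *-zeroʳ y ⟩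
  0#                 ∎

module Quadruple {n} {a b a′ b′ : Λ n} (a-lin : Linear a) (b-lin : Linear b)
                 (a′-lin : Linear a′) (b′-lin : Linear b′) where

  volume : Λ n
  volume = a * (b * (a′ * b′))

  volume-assoc : volume ≡ (a * b) * (a′ * b′)
  volume-assoc = sym (*-assoc a b (a′ * b′))

  -- The two products differ by exchanging b and b′, an odd permutation. The coefficient -1 in
  -- `pairing true` compensates this sign.
  volume-crossed : (a * b′) * (a′ * b) ≡ -1ℤ • volume
  volume-crossed = begin
    (a * b′) * (a′ * b)       ≡⟨ *-assoc a b′ (a′ * b) ⟩
    a * (b′ * (a′ * b))       ≡⟨ cong (a *_) (linear-*-central a′-lin b-lin b′) ⟨
    a * (a′ * b * b′)         ≡⟨ cong (a *_) (trans (*-assoc a′ b b′) (cong (a′ *_) (linear-anticomm b-lin b′-lin))) ⟩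
    a * (a′ * (-1ℤ • (b′ * b))) ≡⟨ cong (a *_) (•-*ʳ -1ℤ a′ (b′ * b)) ⟩
    a * (-1ℤ • (a′ * (b′ * b))) ≡⟨ •-*ʳ -1ℤ a _ ⟩
    -1ℤ • (a * (a′ * (b′ * b))) ≡⟨ cong (λ x → -1ℤ • (a * x)) (trans (sym (*-assoc a′ b′ b)) (linear-*-central a′-lin b′-lin b)) ⟩
    -1ℤ • volume              ∎

  pairing : Bool → Λ n
  pairing false = a * b + 1ℤ • (a′ * b′)
  pairing true = a * b′ + -1ℤ • (a′ * b)

  pairing-central : ∀ ε → Central (pairing ε)
  pairing-central false = central-+ (linear-*-central a-lin b-lin) (central-• 1ℤ (linear-*-central a′-lin b′-lin))
  pairing-central true = central-+ (linear-*-central a-lin b′-lin) (central-• -1ℤ (linear-*-central a′-lin b-lin))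

  volume-central : Central volume
  volume-central = subst Central (sym volume-assoc) (central-* (linear-*-central a-lin b-lin) (linear-*-central a′-lin b′-lin))

  -- Two rows can share a column only if their second coordinates agree. The factor 2 comes from the
  -- two equal cross terms of the square.
  pairing-* : ∀ ε ε′ → pairing ε * pairing ε′ ≡ + (2 ℕ.* same ε ε′) • volume
  pairing-* false false = begin
    (a * b + 1ℤ • (a′ * b′)) * (a * b + 1ℤ • (a′ * b′))
      ≡⟨ *-expand 1ℤ 1ℤ _ _ _ _ ⟩
    ((a * b) * (a * b) + 1ℤ • ((a′ * b′) * (a′ * b′))) + (1ℤ • ((a * b) * (a′ * b′)) + 1ℤ • ((a′ * b′) * (a * b)))
      ≡⟨ cong₂ _+_ (+-both-zero (*-repeatedˡ a-lin b b) (•-zero 1ℤ (*-repeatedˡ a′-lin b′ b′)))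
           (cong₂ (λ x y → 1ℤ • x + 1ℤ • y) (sym volume-assoc) (trans (linear-*-central a′-lin b′-lin (a * b)) (sym volume-assoc))) ⟩
    0# + (1ℤ • volume + 1ℤ • volume)
      ≡⟨ +-identityˡ _ ⟩
    1ℤ • volume + 1ℤ • volume
      ≡⟨ •-distribʳ 1ℤ 1ℤ volume ⟨
    + 2 • volume ∎
  pairing-* true true = begin
    (a * b′ + -1ℤ • (a′ * b)) * (a * b′ + -1ℤ • (a′ * b))
      ≡⟨ *-expand -1ℤ -1ℤ _ _ _ _ ⟩
    ((a * b′) * (a * b′) + 1ℤ • ((a′ * b) * (a′ * b))) + (-1ℤ • ((a * b′) * (a′ * b)) + -1ℤ • ((a′ * b) * (a * b′)))
      ≡⟨ cong₂ _+_ (+-both-zero (*-repeatedˡ a-lin b′ b′) (•-zero 1ℤ (*-repeatedˡ a′-lin b b)))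
           (cong₂ (λ x y → -1ℤ • x + -1ℤ • y) volume-crossed (trans (linear-*-central a′-lin b-lin (a * b′)) volume-crossed)) ⟩
    0# + (-1ℤ • (-1ℤ • volume) + -1ℤ • (-1ℤ • volume))
      ≡⟨ +-identityˡ _ ⟩
    -1ℤ • (-1ℤ • volume) + -1ℤ • (-1ℤ • volume)
      ≡⟨ cong₂ _+_ (•-assoc -1ℤ -1ℤ volume) (•-assoc -1ℤ -1ℤ volume) ⟨
    1ℤ • volume + 1ℤ • volume
      ≡⟨ •-distribʳ 1ℤ 1ℤ volume ⟨
    + 2 • volume ∎
  pairing-* false true = begin
    (a * b + 1ℤ • (a′ * b′)) * (a * b′ + -1ℤ • (a′ * b))
      ≡⟨ *-expand 1ℤ -1ℤ _ _ _ _ ⟩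
    ((a * b) * (a * b′) + -1ℤ • ((a′ * b′) * (a′ * b))) + (-1ℤ • ((a * b) * (a′ * b)) + 1ℤ • ((a′ * b′) * (a * b′)))
      ≡⟨ +-both-zero (+-both-zero (*-repeatedˡ a-lin b b′) (•-zero -1ℤ (*-repeatedˡ a′-lin b′ b)))
           (+-both-zero (•-zero -1ℤ (*-repeatedʳ b-lin a a′)) (•-zero 1ℤ (*-repeatedʳ b′-lin a′ a))) ⟩
    0#
      ≡⟨ •-zeroˡ volume ⟨
    0ℤ • volume ∎
  pairing-* true false = trans (pairing-central true (pairing false)) (pairing-* false true)

  -- Degree six in four elements of square zero.
  pairing-volume : ∀ ε → pairing ε * volume ≡ 0#
  pairing-volume false = trans (*-distribʳ volume _ _) (+-both-zero
    (*-repeatedˡ a-lin b _)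
    (trans (•-*ˡ 1ℤ _ volume) (•-zero 1ℤ (begin
      (a′ * b′) * volume                 ≡⟨ cong ((a′ * b′) *_) volume-assoc ⟩
      (a′ * b′) * ((a * b) * (a′ * b′))  ≡⟨ central-swap (linear-*-central a-lin b-lin) (a′ * b′) (a′ * b′) ⟩
      (a * b) * ((a′ * b′) * (a′ * b′))  ≡⟨ cong ((a * b) *_) (*-repeatedˡ a′-lin b′ b′) ⟩
      (a * b) * 0#                       ≡⟨ *-zeroʳ (a * b) ⟩
      0#                                 ∎))))
  pairing-volume true = trans (*-distribʳ volume _ _) (+-both-zero
    (*-repeatedˡ a-lin b′ _)
    (trans (•-*ˡ -1ℤ _ volume) (•-zero -1ℤ (begin
      (a′ * b) * volume                  ≡⟨ cong ((a′ * b) *_) volume-assoc ⟩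
      (a′ * b) * ((a * b) * (a′ * b′))   ≡⟨ *-assoc (a′ * b) (a * b) (a′ * b′) ⟨
      ((a′ * b) * (a * b)) * (a′ * b′)   ≡⟨ cong (_* (a′ * b′)) (*-repeatedʳ b-lin a′ a) ⟩
      0# * (a′ * b′)                     ≡⟨ *-zeroˡ _ ⟩
      0#                                 ∎))))

∂-scaled-weight : ∀ {A : Set} k (f : A → ℤ) (F : List A → Λ n) l → ∂ (λ i → k ℤ.* f i) F l ≡ k • ∂ f F l
∂-scaled-weight k f F [] = sym (•-zeroʳ k)
∂-scaled-weight k f F (i ∷ l) = trans
  (cong₂ _+_ (•-assoc k (f i) (F l)) (∂-scaled-weight k f _ l)) (sym (•-distribˡ k _ _))

leftMultiplication : (x : Λ n) → Equivariant (x *_)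
leftMultiplication x = record { h-plus = *-distribˡ x ; h-none = *-zeroʳ x ; h-act = λ k y → •-*ʳ k x y }

onLine : (x : Λ n) → Equivariant (_• x)
onLine x = record { h-plus = λ k l → •-distribʳ k l x ; h-none = •-zeroˡ x ; h-act = λ k l → •-assoc k l x }

∂-vanish : ∀ {A : Set} f (F : List A → Λ n) l → (∀ l′ → suc (length l′) ≡ length l → F l′ ≡ 0#) → ∂ f F l ≡ 0#
∂-vanish f F l F≡0 = trans (∂-cong f l F≡0) (trans
  (∂-cong f {G = (0# *_) ∘ F} l λ l′ _ → sym (*-zeroˡ (F l′)))
  (trans (∂-natural (leftMultiplication 0#) f F l) (*-zeroˡ _)))

-- Rows stand for crossing requests and columns for characters. The product of the rows is expanded
-- by choosing a column in each row.
module Columns {m n} (g : Vec Bool (suc (suc m)) → Λ n) (g-linear : ∀ z → Linear (g z)) where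

  Row : Set
  Row = Bool × Vec Bool m

  module Column (χ : Vec Bool m) = Quadruple
    (g-linear (false ∷ false ∷ χ)) (g-linear (true ∷ false ∷ χ))
    (g-linear (false ∷ true ∷ χ)) (g-linear (true ∷ true ∷ χ))

  open Column public using (pairing; volume)

  row : List (Vec Bool m) → Row → Λ n
  row [] i = 0#
  row (χ ∷ X) i@(ε , c) = character χ c • pairing χ ε + row X i

  row-central : ∀ X i → Central (row X i)
  row-central [] i = central-0#
  row-central (χ ∷ X) i@(ε , c) = central-+ (central-• (character χ c) (Column.pairing-central χ ε)) (row-central X i)

  rows : List (Vec Bool m) → List Row → Λ n
  rows X l = prod (map (row X) l)

  volumes : List (Vec Bool m) → Λ n
  volumes X = prod (map volume X)

  characterMatch : Vec Bool m → Row → Row → ℤ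
  characterMatch χ i j = match i j ℤ.* (character χ (proj₂ i) ℤ.* character χ (proj₂ j))

  private
    weight : Vec Bool m → Bool → Row → ℤ
    weight χ ε (ε′ , c) = + same ε ε′ ℤ.* character χ c

    weight-match : ∀ χ i j → characterMatch χ i j ≡ character χ (proj₂ i) ℤ.* weight χ (proj₁ i) j
    weight-match χ i j = rearrange (match i j) (character χ (proj₂ i)) (character χ (proj₂ j))
      where
      rearrange : ∀ a b c → a ℤ.* (b ℤ.* c) ≡ b ℤ.* (a ℤ.* c)
      rearrange = solve-∀

  -- The terms in which exactly one row takes its entry from column χ; `second` collects those with
  -- exactly two such rows, which must match because of `pairing-*`.
  first : Vec Bool m → List (Vec Bool m) → List Row → Λ n
  first χ X l = pairing χ false * ∂ (weight χ false) (rows X) l + pairing χ true * ∂ (weight χ true) (rows X) l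

  second : Vec Bool m → List (Vec Bool m) → List Row → Λ n
  second χ X l = (+ 2 • volume χ) * Π (characterMatch χ) (rows X) l

  private
    ∂-match : ∀ χ i F l → ∂ (characterMatch χ i) F l ≡ character χ (proj₂ i) • ∂ (weight χ (proj₁ i)) F l
    ∂-match χ i F l = trans (∂-ext l) (∂-scaled-weight (character χ (proj₂ i)) (weight χ (proj₁ i)) F l)
      where
      ∂-ext : ∀ {F : List Row → Λ n} l → ∂ (characterMatch χ i) F l ≡ ∂ (λ j → character χ (proj₂ i) ℤ.* weight χ (proj₁ i) j) F l
      ∂-ext [] = refl
      ∂-ext {F} (j ∷ l) = cong₂ _+_ (cong (_• F l) (weight-match χ i j)) (∂-ext l)

    pairing-first : ∀ χ ε x y → pairing χ ε * (pairing χ false * x + pairing χ true * y) ≡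
                    + 2 • (volume χ * (+ same ε false • x + + same ε true • y))
    pairing-first χ ε x y = begin
      pairing χ ε * (pairing χ false * x + pairing χ true * y)
        ≡⟨ *-distribˡ (pairing χ ε) _ _ ⟩
      pairing χ ε * (pairing χ false * x) + pairing χ ε * (pairing χ true * y)
        ≡⟨ cong₂ _+_ (term false x) (term true y) ⟩
      + 2 • (volume χ * (+ same ε false • x)) + + 2 • (volume χ * (+ same ε true • y))
        ≡⟨ •-distribˡ (+ 2) _ _ ⟨
      + 2 • (volume χ * (+ same ε false • x) + volume χ * (+ same ε true • y))
        ≡⟨ cong (+ 2 •_) (*-distribˡ (volume χ) _ _) ⟨
      + 2 • (volume χ * (+ same ε false • x + + same ε true • y)) ∎
      where
      term : ∀ ε′ z → pairing χ ε * (pairing χ ε′ * z) ≡ + 2 • (volume χ * (+ same ε ε′ • z))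
      term ε′ z = begin
        pairing χ ε * (pairing χ ε′ * z)                 ≡⟨ *-assoc _ _ z ⟨
        pairing χ ε * pairing χ ε′ * z                   ≡⟨ cong (_* z) (Column.pairing-* χ ε ε′) ⟩
        (+ (2 ℕ.* same ε ε′) • volume χ) * z             ≡⟨ •-*ˡ (+ (2 ℕ.* same ε ε′)) _ z ⟩
        + (2 ℕ.* same ε ε′) • (volume χ * z)             ≡⟨ cong (_• (volume χ * z)) (ℤ.pos-* 2 (same ε ε′)) ⟩
        (+ 2 ℤ.* + same ε ε′) • (volume χ * z)           ≡⟨ •-assoc (+ 2) (+ same ε ε′) _ ⟩
        + 2 • (+ same ε ε′ • (volume χ * z))             ≡⟨ cong (+ 2 •_) (•-*ʳ (+ same ε ε′) (volume χ) z) ⟨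
        + 2 • (volume χ * (+ same ε ε′ • z))             ∎

    select : ∀ ε (f : Bool → Λ n) → + same ε false • f false + + same ε true • f true ≡ f ε
    select false f = trans (cong₂ _+_ (•-identity _) (•-zeroˡ _)) (+-identityʳ _)
    select true f = trans (cong₂ _+_ (•-zeroˡ _) (•-identity _)) (+-identityˡ _)

    -- Either row i is the one that uses column χ, or it takes its entry from the other columns.
    first-∷ : ∀ χ X i l → first χ X (i ∷ l) ≡ (character χ (proj₂ i) • pairing χ (proj₁ i)) * rows X l + row X i * first χ X l
    first-∷ χ X i@(ε , c) l = begin
      p false * (weight χ false i • rows X l + ∂ (weight χ false) (λ l → row X i * rows X l) l) +
      p true * (weight χ true i • rows X l + ∂ (weight χ true) (λ l → row X i * rows X l) l)
        ≡⟨ cong₂ _+_ (term false) (term true) ⟩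
      (+ same ε false • ((character χ c • p false) * rows X l) + row X i * (p false * ∂ (weight χ false) (rows X) l)) +
      (+ same ε true • ((character χ c • p true) * rows X l) + row X i * (p true * ∂ (weight χ true) (rows X) l))
        ≡⟨ +-interchange _ _ _ _ ⟩
      (+ same ε false • ((character χ c • p false) * rows X l) + + same ε true • ((character χ c • p true) * rows X l)) +
      (row X i * (p false * ∂ (weight χ false) (rows X) l) + row X i * (p true * ∂ (weight χ true) (rows X) l))
        ≡⟨ cong₂ _+_ (select ε (λ ε → (character χ c • p ε) * rows X l)) (sym (*-distribˡ (row X i) _ _)) ⟩
      (character χ c • p ε) * rows X l + row X i * first χ X l ∎
      where
      p = pairing χ
      same-sym : ∀ ε ε′ → same ε ε′ ≡ same ε′ ε
      same-sym false false = refl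
      same-sym false true = refl
      same-sym true false = refl
      same-sym true true = refl
      term : ∀ ε′ → p ε′ * (weight χ ε′ i • rows X l + ∂ (weight χ ε′) (λ l → row X i * rows X l) l) ≡
             + same ε ε′ • ((character χ c • p ε′) * rows X l) + row X i * (p ε′ * ∂ (weight χ ε′) (rows X) l)
      term ε′ = trans (*-distribˡ (p ε′) _ _) (cong₂ _+_
        (begin
          p ε′ * (weight χ ε′ i • rows X l)                       ≡⟨ •-*ʳ (weight χ ε′ i) (p ε′) _ ⟩
          weight χ ε′ i • (p ε′ * rows X l)                       ≡⟨ •-assoc (+ same ε′ ε) (character χ c) _ ⟩
          + same ε′ ε • (character χ c • (p ε′ * rows X l))       ≡⟨ cong₂ (λ x y → + x • y) (same-sym ε′ ε) (sym (•-*ˡ (character χ c) (p ε′) _)) ⟩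
          + same ε ε′ • ((character χ c • p ε′) * rows X l)       ∎)
        (begin
          p ε′ * ∂ (weight χ ε′) (λ l → row X i * rows X l) l     ≡⟨ cong (p ε′ *_) (∂-natural (leftMultiplication (row X i)) (weight χ ε′) (rows X) l) ⟩
          p ε′ * (row X i * ∂ (weight χ ε′) (rows X) l)           ≡⟨ central-swap (row-central X i) (p ε′) _ ⟩
          row X i * (p ε′ * ∂ (weight χ ε′) (rows X) l)           ∎))

    second-∷ : ∀ χ X i l → second χ X (i ∷ l) ≡ (character χ (proj₂ i) • pairing χ (proj₁ i)) * first χ X l + row X i * second χ X l
    second-∷ χ X i@(ε , c) l = begin
      (+ 2 • volume χ) * (∂ (characterMatch χ i) (rows X) l + Π (characterMatch χ) (λ l → row X i * rows X l) l)
        ≡⟨ *-distribˡ (+ 2 • volume χ) _ _ ⟩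
      (+ 2 • volume χ) * ∂ (characterMatch χ i) (rows X) l + (+ 2 • volume χ) * Π (characterMatch χ) (λ l → row X i * rows X l) l
        ≡⟨ cong₂ _+_ left right ⟩
      (character χ c • pairing χ ε) * first χ X l + row X i * second χ X l ∎
      where
      left : (+ 2 • volume χ) * ∂ (characterMatch χ i) (rows X) l ≡ (character χ c • pairing χ ε) * first χ X l
      left = begin
        (+ 2 • volume χ) * ∂ (characterMatch χ i) (rows X) l
          ≡⟨ cong ((+ 2 • volume χ) *_) (∂-match χ i (rows X) l) ⟩
        (+ 2 • volume χ) * (character χ c • ∂ (weight χ ε) (rows X) l)
          ≡⟨ trans (•-*ʳ (character χ c) _ _) (cong (character χ c •_) (•-*ˡ (+ 2) (volume χ) _)) ⟩
        character χ c • (+ 2 • (volume χ * ∂ (weight χ ε) (rows X) l))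
          ≡⟨ cong (λ x → character χ c • (+ 2 • (volume χ * x))) (select ε (λ ε → ∂ (weight χ ε) (rows X) l)) ⟨
        character χ c • (+ 2 • (volume χ * (+ same ε false • ∂ (weight χ false) (rows X) l + + same ε true • ∂ (weight χ true) (rows X) l)))
          ≡⟨ cong (character χ c •_) (pairing-first χ ε _ _) ⟨
        character χ c • (pairing χ ε * first χ X l)
          ≡⟨ •-*ˡ (character χ c) (pairing χ ε) _ ⟨
        (character χ c • pairing χ ε) * first χ X l ∎
      right : (+ 2 • volume χ) * Π (characterMatch χ) (λ l → row X i * rows X l) l ≡ row X i * second χ X l
      right = trans (cong ((+ 2 • volume χ) *_) (Π-natural (leftMultiplication (row X i)) (characterMatch χ) (rows X) l))
        (central-swap (row-central X i) (+ 2 • volume χ) _)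

    pairing-second : ∀ χ X k ε l → (k • pairing χ ε) * second χ X l ≡ 0#
    pairing-second χ X k ε l = begin
      (k • pairing χ ε) * ((+ 2 • volume χ) * y)  ≡⟨ *-assoc _ _ y ⟨
      (k • pairing χ ε) * (+ 2 • volume χ) * y    ≡⟨ cong (_* y) (trans (•-*ʳ (+ 2) _ _) (•-zero (+ 2) (trans (•-*ˡ k _ _) (•-zero k (Column.pairing-volume χ ε))))) ⟩
      0# * y                                      ≡⟨ *-zeroˡ y ⟩
      0#                                          ∎
      where y = Π (characterMatch χ) (rows X) l

  -- A column can be used at most twice, because pairing χ ε * volume χ ≡ 0#.

  rows-expand : ∀ χ X l → rows (χ ∷ X) l ≡ rows X l + first χ X l + second χ X l
  rows-expand χ X [] = sym (begin
    1# + (pairing χ false * 0# + pairing χ true * 0#) + (+ 2 • volume χ) * 0#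
      ≡⟨ cong₂ (λ x y → 1# + x + y) (+-both-zero (*-zeroʳ _) (*-zeroʳ _)) (*-zeroʳ _) ⟩
    1# + 0# + 0#
      ≡⟨ trans (+-identityʳ _) (+-identityʳ _) ⟩
    1# ∎)
  rows-expand χ X (i@(ε , c) ∷ l) = begin
    (b + r) * rows (χ ∷ X) l
      ≡⟨ cong ((b + r) *_) (rows-expand χ X l) ⟩
    (b + r) * (rows X l + first χ X l + second χ X l)
      ≡⟨ *-distribʳ _ b r ⟩
    b * (rows X l + first χ X l + second χ X l) + r * (rows X l + first χ X l + second χ X l)
      ≡⟨ cong₂ _+_ (trans (*-distribˡ b _ _) (trans (cong₂ _+_ (*-distribˡ b _ _) (pairing-second χ X (character χ c) ε l)) (+-identityʳ _)))
           (trans (*-distribˡ r _ _) (cong (λ x → x + r * second χ X l) (*-distribˡ r _ _))) ⟩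
    (b * rows X l + b * first χ X l) + (r * rows X l + r * first χ X l + r * second χ X l)
      ≡⟨ +-assoc _ _ _ ⟨
    ((b * rows X l + b * first χ X l) + (r * rows X l + r * first χ X l)) + r * second χ X l
      ≡⟨ cong (λ x → x + r * second χ X l) (trans (+-interchange _ _ _ _) (cong (λ x → x + (b * first χ X l + r * first χ X l)) (+-comm _ _))) ⟩
    ((r * rows X l + b * rows X l) + (b * first χ X l + r * first χ X l)) + r * second χ X l
      ≡⟨ cong (λ x → x + r * second χ X l) (+-assoc-middle _ _ _ _) ⟩
    ((r * rows X l + (b * rows X l + r * first χ X l)) + b * first χ X l) + r * second χ X l
      ≡⟨ +-assoc _ _ _ ⟩
    (r * rows X l + (b * rows X l + r * first χ X l)) + (b * first χ X l + r * second χ X l)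
      ≡⟨ cong₂ (λ x y → r * rows X l + x + y) (first-∷ χ X i l) (second-∷ χ X i l) ⟨
    rows X (i ∷ l) + first χ X (i ∷ l) + second χ X (i ∷ l) ∎
    where
    b = character χ c • pairing χ ε
    r = row X i
    +-assoc-middle : (w x y z : Λ n) → (w + x) + (y + z) ≡ (w + (x + z)) + y
    +-assoc-middle w x y z = begin
      (w + x) + (y + z)  ≡⟨ cong (λ u → (w + x) + u) (+-comm y z) ⟩
      (w + x) + (z + y)  ≡⟨ +-assoc (w + x) z y ⟨
      (w + x) + z + y    ≡⟨ cong (λ u → u + y) (+-assoc w x z) ⟩
      (w + (x + z)) + y  ∎

  -- Each character removes two elements, so something is left over and `δ` is 0.
  ΠΠδ-vanish : ∀ X l → 2 ℕ.* length X ℕ.< length l → ΠΠ characterMatch X δ l ≡ 0ℤ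
  ΠΠδ-vanish [] (_ ∷ _) _ = refl
  ΠΠδ-vanish (χ ∷ X) l 2∣X∣<∣l∣ = trans
    (Π-cong (characterMatch χ) {G = (0ℤ ℤ.*_) ∘ ΠΠ characterMatch X δ} l λ l′ eq → ΠΠδ-vanish X l′
      (ℕ.+-cancelˡ-< 2 _ _ (subst₂ ℕ._<_ (ℕ.*-suc 2 (length X)) (sym eq) 2∣X∣<∣l∣)))
    (Π-natural (scaling 0ℤ) (characterMatch χ) (ΠΠ characterMatch X δ) l)

  -- With at least two rows per column and at most two uses of each column, every column is used
  -- exactly twice. The inequality admits longer lists, for which both sides are 0; the induction
  -- relies on that case to discard `rows X l` and `first`.
  rows-volumes : ∀ X l → 2 ℕ.* length X ℕ.≤ length l →
                 rows X l ≡ (+ (2 ℕ.^ length X) ℤ.* ΠΠ characterMatch X δ l) • volumes X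
  rows-volumes [] [] _ = sym (•-identity 1#)
  rows-volumes [] (i ∷ l) _ = trans (*-zeroˡ _) (sym (•-zeroˡ 1#))
  rows-volumes (χ ∷ X) l 2∣χX∣≤∣l∣ = begin
    rows (χ ∷ X) l
      ≡⟨ rows-expand χ X l ⟩
    rows X l + first χ X l + second χ X l
      -- Using column χ fewer than twice leaves more rows than the other columns can serve.
      ≡⟨ cong (λ x → x + second χ X l) (+-both-zero (vanish l (ℕ.<⇒≤ 2∣X∣+1<∣l∣)) (+-both-zero (∂-rows false) (∂-rows true))) ⟩
    0# + second χ X l
      ≡⟨ +-identityˡ _ ⟩
    (+ 2 • volume χ) * Π (characterMatch χ) (rows X) l
      ≡⟨ cong ((+ 2 • volume χ) *_) (Π-cong (characterMatch χ) l λ l′ eq → trans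
           (rows-volumes X l′ (ℕ.≤-pred (ℕ.≤-pred (subst (suc (suc (2 ℕ.* length X)) ℕ.≤_) (sym eq) 2∣X∣+1<∣l∣))))
           (•-assoc (+ (2 ℕ.^ length X)) (ΠΠ characterMatch X δ l′) (volumes X))) ⟩
    (+ 2 • volume χ) * Π (characterMatch χ) (λ l → + (2 ℕ.^ length X) • (ΠΠ characterMatch X δ l • volumes X)) l
      ≡⟨ cong ((+ 2 • volume χ) *_) (trans (Π-cong (characterMatch χ) l λ l′ _ → •-comm (+ (2 ℕ.^ length X)) (ΠΠ characterMatch X δ l′) (volumes X))
           (Π-natural (onLine (+ (2 ℕ.^ length X) • volumes X)) (characterMatch χ) (ΠΠ characterMatch X δ) l)) ⟩
    (+ 2 • volume χ) * (t • (+ (2 ℕ.^ length X) • volumes X))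
      ≡⟨ trans (•-*ˡ (+ 2) (volume χ) _) (cong (+ 2 •_) (trans (•-*ʳ t (volume χ) _) (cong (t •_) (•-*ʳ (+ (2 ℕ.^ length X)) (volume χ) (volumes X))))) ⟩
    + 2 • (t • (+ (2 ℕ.^ length X) • volumes (χ ∷ X)))
      ≡⟨ cong (+ 2 •_) (•-comm t (+ (2 ℕ.^ length X)) _) ⟩
    + 2 • (+ (2 ℕ.^ length X) • (t • volumes (χ ∷ X)))
      ≡⟨ trans (•-assoc (+ (2 ℕ.^ suc (length X))) t _) (trans (cong (_• (t • volumes (χ ∷ X))) (ℤ.pos-* 2 (2 ℕ.^ length X))) (•-assoc (+ 2) _ _)) ⟨
    (+ (2 ℕ.^ suc (length X)) ℤ.* t) • volumes (χ ∷ X) ∎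
    where
    t = ΠΠ characterMatch (χ ∷ X) δ l
    2∣X∣+1<∣l∣ : suc (suc (2 ℕ.* length X)) ℕ.≤ length l
    2∣X∣+1<∣l∣ = subst (ℕ._≤ length l) (ℕ.*-suc 2 (length X)) 2∣χX∣≤∣l∣
    vanish : ∀ l → 2 ℕ.* length X ℕ.< length l → rows X l ≡ 0#
    vanish l < = begin
      rows X l                                                                ≡⟨ rows-volumes X l (ℕ.<⇒≤ <) ⟩
      (+ (2 ℕ.^ length X) ℤ.* ΠΠ characterMatch X δ l) • volumes X            ≡⟨ cong (λ x → (+ (2 ℕ.^ length X) ℤ.* x) • volumes X) (ΠΠδ-vanish X l <) ⟩
      (+ (2 ℕ.^ length X) ℤ.* 0ℤ) • volumes X                                 ≡⟨ cong (_• volumes X) (ℤ.*-zeroʳ (+ (2 ℕ.^ length X))) ⟩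
      0ℤ • volumes X                                                          ≡⟨ •-zeroˡ _ ⟩
      0#                                                                      ∎
    ∂-rows : ∀ ε → pairing χ ε * ∂ (weight χ ε) (rows X) l ≡ 0#
    ∂-rows ε = trans (cong (pairing χ ε *_) (∂-vanish (weight χ ε) (rows X) l λ l′ eq →
      vanish l′ (ℕ.≤-pred (subst (suc (suc (2 ℕ.* length X)) ℕ.≤_) (sym eq) 2∣X∣+1<∣l∣)))) (*-zeroʳ _)

-- The points of a vector space over the field with two elements

⊕-comm : (x y : Vec Bool m) → x ⊕ y ≡ y ⊕ x
⊕-comm = Vec.zipWith-comm Bool.xor-comm

⊕-assoc : (x y z : Vec Bool m) → (x ⊕ y) ⊕ z ≡ x ⊕ (y ⊕ z)
⊕-assoc = Vec.zipWith-assoc Bool.xor-assoc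

⊕-identityˡ : (x : Vec Bool m) → 𝟎 ⊕ x ≡ x
⊕-identityˡ = Vec.zipWith-identityˡ Bool.xor-identityˡ

⊕-identityʳ : (x : Vec Bool m) → x ⊕ 𝟎 ≡ x
⊕-identityʳ x = trans (⊕-comm x 𝟎) (⊕-identityˡ x)

⊕-self : (x : Vec Bool m) → x ⊕ x ≡ 𝟎
⊕-self [] = refl
⊕-self (b ∷ x) = cong₂ _∷_ (Bool.xor-same b) (⊕-self x)

⊕-cancelˡ : (x y : Vec Bool m) → x ⊕ (x ⊕ y) ≡ y
⊕-cancelˡ x y = begin
  x ⊕ (x ⊕ y)  ≡⟨ ⊕-assoc x x y ⟨
  (x ⊕ x) ⊕ y  ≡⟨ cong (_⊕ y) (⊕-self x) ⟩
  𝟎 ⊕ y        ≡⟨ ⊕-identityˡ y ⟩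
  y            ∎

⊕-zero⇒≡ : {x y : Vec Bool m} → x ⊕ y ≡ 𝟎 → x ≡ y
⊕-zero⇒≡ {x = x} {y} x⊕y≡𝟎 = begin
  x            ≡⟨ ⊕-identityʳ x ⟨
  x ⊕ 𝟎        ≡⟨ cong (x ⊕_) x⊕y≡𝟎 ⟨
  x ⊕ (x ⊕ y)  ≡⟨ ⊕-cancelˡ x y ⟩
  y            ∎

sumL : List (Vec Bool m) → Vec Bool m
sumL = foldr _⊕_ 𝟎

sumL-++ : (xs ys : List (Vec Bool m)) → sumL (xs ++ ys) ≡ sumL xs ⊕ sumL ys
sumL-++ [] ys = sym (⊕-identityˡ _)
sumL-++ (x ∷ xs) ys = trans (cong (x ⊕_) (sumL-++ xs ys)) (sym (⊕-assoc x _ _))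

sumL-↭ : {xs ys : List (Vec Bool m)} → xs ↭ ys → sumL xs ≡ sumL ys
sumL-↭ ↭.refl = refl
sumL-↭ (↭.prep x xs↭ys) = cong (x ⊕_) (sumL-↭ xs↭ys)
sumL-↭ {xs = _ ∷ _ ∷ xs} {ys = _ ∷ _ ∷ ys} (↭.swap x y xs↭ys) = begin
  x ⊕ (y ⊕ sumL xs)  ≡⟨ ⊕-assoc x y _ ⟨
  (x ⊕ y) ⊕ sumL xs  ≡⟨ cong₂ _⊕_ (⊕-comm x y) (sumL-↭ xs↭ys) ⟩
  (y ⊕ x) ⊕ sumL ys  ≡⟨ ⊕-assoc y x _ ⟩
  y ⊕ (x ⊕ sumL ys)  ∎
sumL-↭ (↭.trans xs↭ys ys↭zs) = trans (sumL-↭ xs↭ys) (sumL-↭ ys↭zs)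

-- Arranged so that `points` starts with 𝟎 and `points (suc m)` still unfolds to two copies of
-- `points m`. The nonzero vectors index the columns, 𝟎 being reserved for the hole.
nonzeros : ∀ m → List (Vec Bool m)
nonzeros zero = []
nonzeros (suc m) = map (false ∷_) (nonzeros m) ++ map (true ∷_) (𝟎 ∷ nonzeros m)

points : ∀ m → List (Vec Bool m)
points m = 𝟎 ∷ nonzeros m

points-complete : (x : Vec Bool m) → x ∈ points m
points-complete [] = here refl
points-complete (false ∷ x) = ∈-++⁺ˡ (∈-map⁺ (false ∷_) (points-complete x))
points-complete {suc m} (true ∷ x) = ∈-++⁺ʳ (map (false ∷_) (points m)) (∈-map⁺ (true ∷_) (points-complete x))

points-unique : ∀ m → Unique (points m)
points-unique zero = [] ∷ []
points-unique (suc m) = Unique.++⁺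
  (Unique.map⁺ Vec.∷-injectiveʳ (points-unique m)) (Unique.map⁺ Vec.∷-injectiveʳ (points-unique m))
  λ (x∈ , y∈) → disjoint (∈-map⁻ (false ∷_) x∈) (∈-map⁻ (true ∷_) y∈)
  where
  disjoint : ∀ {z : Vec Bool (suc m)} → ∃[ x ] x ∈ points m × z ≡ false ∷ x → ¬ (∃[ y ] y ∈ points m × z ≡ true ∷ y)
  disjoint (_ , _ , refl) (_ , _ , ())

length-nonzeros : ∀ m → length (nonzeros m) ≡ mersenne m
length-nonzeros zero = refl
length-nonzeros (suc m) = begin
  length (map (false ∷_) (nonzeros m) ++ map (true ∷_) (points m))
    ≡⟨ List.length-++ (map (false ∷_) (nonzeros m)) ⟩
  length (map (false ∷_) (nonzeros m)) ℕ.+ length (map (true ∷_) (points m))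
    ≡⟨ cong₂ ℕ._+_ (trans (List.length-map _ (nonzeros m)) (length-nonzeros m)) (trans (List.length-map _ (points m)) (cong suc (length-nonzeros m))) ⟩
  mersenne m ℕ.+ suc (mersenne m)
    ≡⟨ ℕ.+-suc (mersenne m) (mersenne m) ⟩
  suc (mersenne m ℕ.+ mersenne m)
    ≡⟨ cong (λ x → suc (mersenne m ℕ.+ x)) (ℕ.+-identityʳ (mersenne m)) ⟨
  suc (2 ℕ.* mersenne m) ∎

parity : ℕ → Bool
parity zero = false
parity (suc n) = not (parity n)

parity-even : ∀ n → parity (2 ℕ.* n) ≡ false
parity-even zero = refl
parity-even (suc n) = trans (cong parity (ℕ.*-suc 2 n)) (trans (Bool.not-involutive _) (parity-even n))

sumL-map-∷ : ∀ b (xs : List (Vec Bool m)) → sumL (map (b ∷_) xs) ≡ (b ∧ parity (length xs)) ∷ sumL xs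
sumL-map-∷ false [] = refl
sumL-map-∷ true [] = refl
sumL-map-∷ false (x ∷ xs) = cong ((false ∷ x) ⊕_) (sumL-map-∷ false xs)
sumL-map-∷ true (x ∷ xs) = cong ((true ∷ x) ⊕_) (sumL-map-∷ true xs)

-- The two halves have equal tails, which cancel; the first coordinate adds up `2 ^ suc m` ones, an
-- even number. In dimension one the sum would not vanish.
sumL-points : ∀ m → sumL (points (suc (suc m))) ≡ 𝟎
sumL-points m = begin
  sumL (map (false ∷_) (points (suc m)) ++ map (true ∷_) (points (suc m)))
    ≡⟨ sumL-++ (map (false ∷_) (points (suc m))) (map (true ∷_) (points (suc m))) ⟩
  sumL (map (false ∷_) (points (suc m))) ⊕ sumL (map (true ∷_) (points (suc m)))
    ≡⟨ cong₂ _⊕_ (sumL-map-∷ false (points (suc m))) (sumL-map-∷ true (points (suc m))) ⟩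
  parity (length (points (suc m))) ∷ (sumL (points (suc m)) ⊕ sumL (points (suc m)))
    ≡⟨ cong₂ _∷_ (trans (cong parity (trans (cong suc (length-nonzeros (suc m))) (sym (ℕ.*-suc 2 (mersenne m))))) (parity-even (suc (mersenne m)))) (⊕-self _) ⟩
  𝟎 ∎

Unique-resp-↭ : {A : Set} {xs ys : List A} → xs ↭ ys → Unique xs → Unique ys
Unique-resp-↭ xs↭ys = ↭ₛ.Unique-resp-↭ (setoid _) (↭⇒↭ₛ xs↭ys)

∈⇒↭ : {A : Set} {x : A} {xs : List A} → x ∈ xs → ∃[ ys ] xs ↭ x ∷ ys
∈⇒↭ {x = x} x∈xs with ∈-∃++ x∈xs
... | ys , zs , refl = ys ++ zs , shift x ys zs

complement : (xs : List (Vec Bool m)) → Unique xs → ∃[ zs ] points m ↭ xs ++ zs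
complement [] [] = _ , ↭-refl
complement (x ∷ xs) (x∉xs ∷ xs!) with complement xs xs!
... | zs , points↭ with ∈-++⁻ xs (∈-resp-↭ points↭ (points-complete x))
... | inj₁ x∈xs = contradiction refl (All.lookup x∉xs x∈xs)
... | inj₂ x∈zs with ∈⇒↭ x∈zs
... | ws , zs↭ = ws , ↭-trans points↭ (↭-trans (++⁺ˡ xs zs↭) (shift x xs ws))

-- Extracting pairs from a nonzero product

flatten : {A : Set} → List (A × A) → List A
flatten [] = []
flatten ((x , y) ∷ ps) = x ∷ y ∷ flatten ps

-- Only distinctness of the points is recorded: covering follows from it by counting, and partial
-- lists of requests are allowed.
PairSolution : List (Vec Bool m) → Set
PairSolution {m} vs = ∃[ ps ] map (uncurry _⊕_) ps ≡ vs × Unique (flatten {Vec Bool m} ps)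

•-nonzero : ∀ {k} {x : Λ n} → k ≢ 0ℤ → x ≢ 0# → k • x ≢ 0#
•-nonzero {k = k} {x} k≢0 x≢0 kx≡0 with •-integral k x kx≡0
... | inj₁ k≡0 = k≢0 k≡0
... | inj₂ x≡0 = x≢0 x≡0

2^≢0 : ∀ k → + (2 ℕ.^ k) ≢ 0ℤ
2^≢0 k eq = ℕ.≢-nonZero⁻¹ (2 ℕ.^ k) {{ℕ.m^n≢0 2 k}} (ℤ.+-injective eq)

module Extraction {m n} (U : Vec Bool m → Λ n) (U-linear : ∀ z → Linear (U z)) where

  -- Some monomial U x * U y with x ⊕ y ≡ v can replace F.

  Extractable : Vec Bool m → Λ n → Set
  Extractable v F = ∀ Y Z → (Y * F) * Z ≢ 0# → ∃[ x ] ∃[ y ] x ⊕ y ≡ v × (Y * (U x * U y)) * Z ≢ 0#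

  extractable-+ : ∀ {v F G} → Extractable v F → Extractable v G → Extractable v (F + G)
  extractable-+ F-ext G-ext Y Z ≢0
    with +-nonzero (λ eq → ≢0 (trans (trans (cong (_* Z) (*-distribˡ Y _ _)) (*-distribʳ Z _ _)) eq))
  ... | inj₁ F≢0 = F-ext Y Z F≢0
  ... | inj₂ G≢0 = G-ext Y Z G≢0

  extractable-• : ∀ {v F} k → Extractable v F → Extractable v (k • F)
  extractable-• k F-ext Y Z ≢0 = F-ext Y Z λ eq →
    ≢0 (trans (cong (_* Z) (•-*ʳ k Y _)) (trans (•-*ˡ k _ Z) (•-zero k eq)))

  extractable-sumV : ∀ {k v} (l r : Vec Bool k → Vec Bool m) → (∀ x → l x ⊕ r x ≡ v) →
                     Extractable v (sumV λ x → U (l x) * U (r x))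
  extractable-sumV {k} l r l⊕r≡v Y Z ≢0 with sumV-nonzero (λ x → (Y * (U (l x) * U (r x))) * Z)
    (λ eq → ≢0 (trans (sumV-natural {m = k} (λ F → (Y * F) * Z) (λ F G → trans (cong (_* Z) (*-distribˡ Y F G)) (*-distribʳ Z _ _)) _) eq))
  ... | x , ≢0′ = l x , r x , l⊕r≡v x , ≢0′

  -- The forms are replaced by monomials from left to right, Y being the product of those already
  -- chosen. By multilinearity some monomial of each form keeps the whole product nonzero.
  extract : (fs : List (Vec Bool m × Λ n)) → All (uncurry Extractable) fs → ∀ Y → Y * prod (map proj₂ fs) ≢ 0# →
            ∃[ ps ] map (uncurry _⊕_) ps ≡ map proj₁ fs × Y * prod (map U (flatten ps)) ≢ 0#
  extract [] [] Y ≢0 = [] , refl , ≢0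
  extract ((v , F) ∷ fs) (F-ext ∷ fs-ext) Y ≢0
    with F-ext Y (prod (map proj₂ fs)) (λ eq → ≢0 (trans (sym (*-assoc Y F _)) eq))
  ... | x , y , x⊕y≡v , ≢0′ with extract fs fs-ext (Y * (U x * U y)) ≢0′
  ... | ps , sums , ≢0″ = (x , y) ∷ ps , cong₂ _∷_ x⊕y≡v sums , λ eq →
    ≢0″ (trans (*-assoc Y _ _) (trans (cong (Y *_) (*-assoc (U x) (U y) _)) eq))

  repeated⇒zero : ∀ {z} zs → z ∈ zs → U z * prod (map U zs) ≡ 0#
  repeated⇒zero {z} (z ∷ zs) (here refl) = begin
    U z * (U z * prod (map U zs))  ≡⟨ *-assoc (U z) (U z) _ ⟨
    U z * U z * prod (map U zs)    ≡⟨ cong (_* prod (map U zs)) (linear-square (U-linear z)) ⟩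
    0# * prod (map U zs)           ≡⟨ *-zeroˡ _ ⟩
    0#                             ∎
  repeated⇒zero {z} (y ∷ zs) (there z∈zs) = begin
    U z * (U y * prod (map U zs))          ≡⟨ *-assoc (U z) (U y) _ ⟨
    U z * U y * prod (map U zs)            ≡⟨ cong (_* prod (map U zs)) (linear-anticomm (U-linear z) (U-linear y)) ⟩
    (-1ℤ • (U y * U z)) * prod (map U zs)  ≡⟨ •-*ˡ -1ℤ _ _ ⟩
    -1ℤ • (U y * U z * prod (map U zs))    ≡⟨ •-zero -1ℤ (trans (*-assoc (U y) (U z) _) (trans (cong (U y *_) (repeated⇒zero zs z∈zs)) (*-zeroʳ (U y)))) ⟩
    0#                                     ∎

  nonzero⇒unique : ∀ zs → prod (map U zs) ≢ 0# → Unique zs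
  nonzero⇒unique [] _ = []
  nonzero⇒unique (z ∷ zs) ≢0 = ¬Any⇒All¬ zs (≢0 ∘ repeated⇒zero zs)
    ∷ nonzero⇒unique zs λ eq → ≢0 (trans (cong (U z *_) eq) (*-zeroʳ (U z)))

-- The product of all forms

sumOver : {A : Set} → List A → (A → Λ n) → Λ n
sumOver [] f = 0#
sumOver (x ∷ xs) f = f x + sumOver xs f

sumOver-++ : ∀ {A : Set} xs ys (f : A → Λ n) → sumOver (xs ++ ys) f ≡ sumOver xs f + sumOver ys f
sumOver-++ [] ys f = sym (+-identityˡ _)
sumOver-++ (x ∷ xs) ys f = trans (cong (λ y → f x + y) (sumOver-++ xs ys f)) (sym (+-assoc _ _ _))

sumOver-map : ∀ {A B : Set} (h : A → B) xs (f : B → Λ n) → sumOver (map h xs) f ≡ sumOver xs (f ∘ h)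
sumOver-map h [] f = refl
sumOver-map h (x ∷ xs) f = cong (λ y → f (h x) + y) (sumOver-map h xs f)

sumV-points : (f : Vec Bool m → Λ n) → sumV f ≡ sumOver (points m) f
sumV-points {zero} f = sym (+-identityʳ (f []))
sumV-points {suc m} f = begin
  sumV (f ∘ (false ∷_)) + sumV (f ∘ (true ∷_))
    ≡⟨ cong₂ _+_ (trans (sumV-points (f ∘ (false ∷_))) (sym (sumOver-map (false ∷_) (points m) f)))
         (trans (sumV-points (f ∘ (true ∷_))) (sym (sumOver-map (true ∷_) (points m) f))) ⟩
  sumOver (map (false ∷_) (points m)) f + sumOver (map (true ∷_) (points m)) f
    ≡⟨ sumOver-++ (map (false ∷_) (points m)) (map (true ∷_) (points m)) f ⟨
  sumOver (points (suc m)) f ∎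

bit : Bool → ℤ
bit false = 0ℤ
bit true = 1ℤ

dot : Vec Bool m → Vec Bool m → Bool
dot [] [] = false
dot (p ∷ χ) (q ∷ x) = (p ∧ q) xor dot χ x

sign-* : ∀ p q → sign p ℤ.* sign q ≡ sign (p xor q)
sign-* false false = refl
sign-* false true = refl
sign-* true false = refl
sign-* true true = refl

sign-bit : ∀ p → sign p ≡ 1ℤ ℤ.+ ℤ.- (+ 2) ℤ.* bit p
sign-bit false = refl
sign-bit true = refl

character-dot : (χ x : Vec Bool m) → character χ x ≡ sign (dot χ x)
character-dot [] [] = refl
character-dot (p ∷ χ) (q ∷ x) = trans (cong (sign (p ∧ q) ℤ.*_) (character-dot χ x)) (sign-* (p ∧ q) (dot χ x))

character-𝟎 : (x : Vec Bool m) → character 𝟎 x ≡ 1ℤ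
character-𝟎 [] = refl
character-𝟎 (q ∷ x) = trans (ℤ.*-identityˡ _) (character-𝟎 x)

-- The order of the four generators is that of the factors of `volume`, so `volumes-prod` involves
-- no sign.
quadruples : List (Vec Bool m) → List (Vec Bool (suc (suc m)))
quadruples [] = []
quadruples (χ ∷ X) = (false ∷ false ∷ χ) ∷ (true ∷ false ∷ χ) ∷ (false ∷ true ∷ χ) ∷ (true ∷ true ∷ χ) ∷ quadruples X

∈-quadruples : ∀ {p q χ} (X : List (Vec Bool m)) → (p ∷ q ∷ χ) ∈ quadruples X → χ ∈ X
∈-quadruples (χ ∷ X) (here refl) = here refl
∈-quadruples (χ ∷ X) (there (here refl)) = here refl
∈-quadruples (χ ∷ X) (there (there (here refl))) = here refl
∈-quadruples (χ ∷ X) (there (there (there (here refl)))) = here refl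
∈-quadruples (χ ∷ X) (there (there (there (there z∈)))) = there (∈-quadruples X z∈)

quadruples-fresh : ∀ {p q χ} (X : List (Vec Bool m)) → All (χ ≢_) X → All ((p ∷ q ∷ χ) ≢_) (quadruples X)
quadruples-fresh X χ∉X = ¬Any⇒All¬ _ λ z∈ → All.lookup χ∉X (∈-quadruples X z∈) refl

quadruples-unique : (X : List (Vec Bool m)) → Unique X → Unique (quadruples X)
quadruples-unique [] [] = []
quadruples-unique (χ ∷ X) (χ∉X ∷ X!) =
  ((λ ()) ∷ (λ ()) ∷ (λ ()) ∷ quadruples-fresh X χ∉X) ∷
  ((λ ()) ∷ (λ ()) ∷ quadruples-fresh X χ∉X) ∷
  ((λ ()) ∷ quadruples-fresh X χ∉X) ∷
  quadruples-fresh X χ∉X ∷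
  quadruples-unique X X!

module _ (m : ℕ) where

  -- Leaving out true ∷ _ ∷ 𝟎 makes the generators at 𝟎 available to the form of
  -- the hole only, so that a single monomial survives in the product.

  names : List (Vec Bool (suc (suc m)))
  names = (false ∷ false ∷ 𝟎) ∷ (false ∷ true ∷ 𝟎) ∷ quadruples (nonzeros m)

  𝟎∉nonzeros : All (𝟎 ≢_) (nonzeros m)
  𝟎∉nonzeros with points-unique m
  ... | 𝟎∉ ∷ _ = 𝟎∉

  nonzeros-unique : Unique (nonzeros m)
  nonzeros-unique with points-unique m
  ... | _ ∷ ! = !

  names-unique : Unique names
  names-unique = ((λ ()) ∷ quadruples-fresh (nonzeros m) 𝟎∉nonzeros) ∷ quadruples-fresh (nonzeros m) 𝟎∉nonzeros
    ∷ quadruples-unique (nonzeros m) nonzeros-unique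

crossing : Bool × Vec Bool m → Vec Bool (suc (suc m))
crossing (ε , c) = true ∷ ε ∷ c

module Assembly (m : ℕ) {N} (g : Vec Bool (suc (suc m)) → Λ N) (g-linear : ∀ z → Linear (g z))
                (g-absent : ∀ q → g (true ∷ q ∷ 𝟎) ≡ 0#) (g-names : prod (map g (names m)) ≢ 0#) where

  open Columns {m} g g-linear

  private
    α β : Bool → Vec Bool m → Λ N
    α q χ = g (false ∷ q ∷ χ)
    β q χ = g (true ∷ q ∷ χ)

    -- Only the last m coordinates are transformed. The first two remain as labels of four families
    -- of generators, and the forms correlate one family with another.
    U : Vec Bool (suc (suc m)) → Λ N
    U (p ∷ q ∷ x) = fourier (λ χ → g (p ∷ q ∷ χ)) x

    U-linear : ∀ z → Linear (U z)
    U-linear (p ∷ q ∷ x) = fourier-linear (λ χ → g-linear (p ∷ q ∷ χ)) x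

  open Extraction U U-linear

  -- The coefficient sign ε gives pairing true the same square as pairing false.

  crossingForm : Row → Λ N
  crossingForm (ε , c) = correlation (α false) (β ε) c + sign ε • correlation (α true) (β (not ε)) c

  crossingForm-extractable : ∀ i → Extractable (crossing i) (crossingForm i)
  crossingForm-extractable (ε , c) = extractable-+
    (extractable-sumV (λ x → false ∷ false ∷ x) (λ x → true ∷ ε ∷ (x ⊕ c)) λ x → cong (λ x → true ∷ ε ∷ x) (⊕-cancelˡ x c))
    (extractable-• (sign ε)
      (extractable-sumV (λ x → false ∷ true ∷ x) (λ x → true ∷ not ε ∷ (x ⊕ c)) λ x → cong₂ (λ ε x → true ∷ ε ∷ x) (Bool.not-involutive ε) (⊕-cancelˡ x c)))

  holeForm : Vec Bool m → Λ N
  holeForm c = correlation (α false) (α true) c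

  holeForm-extractable : ∀ c → Extractable (false ∷ true ∷ c) (holeForm c)
  holeForm-extractable c = extractable-sumV (λ x → false ∷ false ∷ x) (λ x → false ∷ true ∷ (x ⊕ c)) λ x → cong (λ x → false ∷ true ∷ x) (⊕-cancelˡ x c)

  pairing-eq : ∀ χ ε → pairing χ ε ≡ α false χ * β ε χ + sign ε • (α true χ * β (not ε) χ)
  pairing-eq χ false = refl
  pairing-eq χ true = refl

  pairing-𝟎 : ∀ ε → pairing 𝟎 ε ≡ 0#
  pairing-𝟎 ε = trans (pairing-eq 𝟎 ε) (+-both-zero
    (trans (cong (α false 𝟎 *_) (g-absent ε)) (*-zeroʳ _))
    (•-zero (sign ε) (trans (cong (α true 𝟎 *_) (g-absent (not ε))) (*-zeroʳ _))))

  -- By Plancherel every character contributes its column; the trivial one drops out since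
  -- `g-absent` removes its `β` generators.
  crossingForm-row : ∀ i → crossingForm i ≡ + (2 ℕ.^ m) • row (nonzeros m) i
  crossingForm-row i@(ε , c) = begin
    correlation (α false) (β ε) c + sign ε • correlation (α true) (β (not ε)) c
      ≡⟨ cong₂ (λ x y → x + sign ε • y) (plancherel (α false) (β ε) c) (plancherel (α true) (β (not ε)) c) ⟩
    + (2 ℕ.^ m) • sumV f₀ + sign ε • (+ (2 ℕ.^ m) • sumV f₁)
      ≡⟨ cong (λ x → + (2 ℕ.^ m) • sumV f₀ + x) (•-comm (sign ε) (+ (2 ℕ.^ m)) (sumV f₁)) ⟩
    + (2 ℕ.^ m) • sumV f₀ + + (2 ℕ.^ m) • (sign ε • sumV f₁)
      ≡⟨ •-distribˡ (+ (2 ℕ.^ m)) _ _ ⟨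
    + (2 ℕ.^ m) • (sumV f₀ + sign ε • sumV f₁)
      ≡⟨ cong (λ x → + (2 ℕ.^ m) • (sumV f₀ + x)) (sumV-natural (sign ε •_) (•-distribˡ (sign ε)) f₁) ⟩
    + (2 ℕ.^ m) • (sumV f₀ + sumV (λ χ → sign ε • f₁ χ))
      ≡⟨ cong (+ (2 ℕ.^ m) •_) (trans (sym (sumV-+ f₀ _)) (sumV-cong merge)) ⟩
    + (2 ℕ.^ m) • sumV (λ χ → character χ c • pairing χ ε)
      ≡⟨ cong (+ (2 ℕ.^ m) •_) (sumV-points {m} λ χ → character χ c • pairing χ ε) ⟩
    + (2 ℕ.^ m) • (character 𝟎 c • pairing 𝟎 ε + sumOver (nonzeros m) (λ χ → character χ c • pairing χ ε))
      ≡⟨ cong (+ (2 ℕ.^ m) •_) (trans (cong₂ _+_ (•-zero (character 𝟎 c) (pairing-𝟎 ε)) (row-sum (nonzeros m))) (+-identityˡ _)) ⟩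
    + (2 ℕ.^ m) • row (nonzeros m) i ∎
    where
    f₀ f₁ : Vec Bool m → Λ N
    f₀ χ = character χ c • (α false χ * β ε χ)
    f₁ χ = character χ c • (α true χ * β (not ε) χ)
    merge : ∀ χ → f₀ χ + sign ε • f₁ χ ≡ character χ c • pairing χ ε
    merge χ = begin
      f₀ χ + sign ε • f₁ χ
        ≡⟨ cong (λ x → f₀ χ + x) (•-comm (sign ε) (character χ c) _) ⟩
      f₀ χ + character χ c • (sign ε • (α true χ * β (not ε) χ))
        ≡⟨ •-distribˡ (character χ c) _ _ ⟨
      character χ c • (α false χ * β ε χ + sign ε • (α true χ * β (not ε) χ))
        ≡⟨ cong (character χ c •_) (pairing-eq χ ε) ⟨
      character χ c • pairing χ ε ∎
    row-sum : ∀ X → sumOver X (λ χ → character χ c • pairing χ ε) ≡ row X i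
    row-sum [] = refl
    row-sum (χ ∷ X) = cong (λ x → character χ c • pairing χ ε + x) (row-sum X)

  prod-crossingForm : ∀ l → prod (map crossingForm l) ≡ + ((2 ℕ.^ m) ℕ.^ length l) • rows (nonzeros m) l
  prod-crossingForm [] = sym (•-identity 1#)
  prod-crossingForm (i ∷ l) = begin
    crossingForm i * prod (map crossingForm l)
      ≡⟨ cong₂ _*_ (crossingForm-row i) (prod-crossingForm l) ⟩
    (+ a • r) * (+ b • rows X l)
      ≡⟨ trans (•-*ˡ (+ a) r _) (cong (+ a •_) (•-*ʳ (+ b) r _)) ⟩
    + a • (+ b • (r * rows X l))
      ≡⟨ •-assoc (+ a) (+ b) _ ⟨
    (+ a ℤ.* + b) • (r * rows X l)
      ≡⟨ cong (_• (r * rows X l)) (ℤ.pos-* a b) ⟨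
    + (a ℕ.* b) • (r * rows X l) ∎
    where
    X = nonzeros m
    a = 2 ℕ.^ m
    b = a ℕ.^ length l
    r = row X i

  private
    α-volumes : ∀ χ X → χ ∈ X → α false χ * volumes X ≡ 0#
    α-volumes χ (χ ∷ X) (here refl) = begin
      α false χ * (volume χ * volumes X)  ≡⟨ *-assoc _ _ _ ⟨
      α false χ * volume χ * volumes X    ≡⟨ cong (_* volumes X) (trans (sym (*-assoc (α false χ) (α false χ) _)) (cong (_* (β false χ * (α true χ * β true χ))) (linear-square (g-linear (false ∷ false ∷ χ))))) ⟩
      0# * (β false χ * (α true χ * β true χ)) * volumes X ≡⟨ cong (_* volumes X) (*-zeroˡ _) ⟩
      0# * volumes X                      ≡⟨ *-zeroˡ _ ⟩
      0#                                  ∎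
    α-volumes χ (χ′ ∷ X) (there χ∈X) = begin
      α false χ * (volume χ′ * volumes X)   ≡⟨ central-swap (Column.volume-central χ′) (α false χ) (volumes X) ⟩
      volume χ′ * (α false χ * volumes X)   ≡⟨ cong (volume χ′ *_) (α-volumes χ X χ∈X) ⟩
      volume χ′ * 0#                        ≡⟨ *-zeroʳ _ ⟩
      0#                                    ∎

    αα-volumes : ∀ χ X → χ ∈ X → (α false χ * α true χ) * volumes X ≡ 0#
    αα-volumes χ X χ∈X = begin
      (α false χ * α true χ) * volumes X          ≡⟨ cong (_* volumes X) (linear-anticomm (g-linear (false ∷ false ∷ χ)) (g-linear (false ∷ true ∷ χ))) ⟩
      (-1ℤ • (α true χ * α false χ)) * volumes X  ≡⟨ •-*ˡ -1ℤ _ _ ⟩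
      -1ℤ • ((α true χ * α false χ) * volumes X)  ≡⟨ •-zero -1ℤ (trans (*-assoc _ _ _) (trans (cong (α true χ *_) (α-volumes χ X χ∈X)) (*-zeroʳ _))) ⟩
      0#                                          ∎

    sumOver-volumes : ∀ X Y c → (∀ {χ} → χ ∈ Y → χ ∈ X) →
                      sumOver Y (λ χ → character χ c • (α false χ * α true χ)) * volumes X ≡ 0#
    sumOver-volumes X [] c _ = *-zeroˡ _
    sumOver-volumes X (χ ∷ Y) c Y⊆X = trans (*-distribʳ _ _ _) (+-both-zero
      (trans (•-*ˡ (character χ c) _ _) (•-zero (character χ c) (αα-volumes χ X (Y⊆X (here refl)))))
      (sumOver-volumes X Y c (Y⊆X ∘ there)))

    volumes-prod : ∀ X → volumes X ≡ prod (map g (quadruples X))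
    volumes-prod [] = refl
    volumes-prod (χ ∷ X) = trans (*-assoc a _ _) (cong (a *_) (trans (*-assoc b _ _) (cong (b *_) (trans (*-assoc a′ b′ _)
      (cong (λ x → a′ * (b′ * x)) (volumes-prod X))))))
      where
      a = α false χ
      b = β false χ
      a′ = α true χ
      b′ = β true χ

  -- A nontrivial χ repeats the factor `α false χ` of `volumes`. The trivial character has value 1
  -- at every c, so the result is the same for every hole.
  holeForm-volumes : ∀ c → holeForm c * volumes (nonzeros m) ≡ + (2 ℕ.^ m) • prod (map g (names m))
  holeForm-volumes c = begin
    holeForm c * volumes X
      ≡⟨ cong (_* volumes X) (trans (plancherel (α false) (α true) c) (cong (+ (2 ℕ.^ m) •_) (sumV-points {m} f))) ⟩
    (+ (2 ℕ.^ m) • (character 𝟎 c • (α false 𝟎 * α true 𝟎) + sumOver X f)) * volumes X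
      ≡⟨ •-*ˡ (+ (2 ℕ.^ m)) _ _ ⟩
    + (2 ℕ.^ m) • ((character 𝟎 c • (α false 𝟎 * α true 𝟎) + sumOver X f) * volumes X)
      ≡⟨ cong (+ (2 ℕ.^ m) •_) (trans (*-distribʳ (volumes X) _ _) (trans (cong₂ _+_ refl (sumOver-volumes X X c λ χ∈ → χ∈)) (+-identityʳ _))) ⟩
    + (2 ℕ.^ m) • ((character 𝟎 c • (α false 𝟎 * α true 𝟎)) * volumes X)
      ≡⟨ cong (λ x → + (2 ℕ.^ m) • (x * volumes X)) (trans (cong (_• (α false 𝟎 * α true 𝟎)) (character-𝟎 c)) (•-identity _)) ⟩
    + (2 ℕ.^ m) • ((α false 𝟎 * α true 𝟎) * volumes X)
      ≡⟨ cong (+ (2 ℕ.^ m) •_) (trans (*-assoc _ _ _) (cong (λ x → α false 𝟎 * (α true 𝟎 * x)) (volumes-prod X))) ⟩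
    + (2 ℕ.^ m) • prod (map g (names m)) ∎
    where
    X = nonzeros m
    f : Vec Bool m → Λ N
    f χ = character χ c • (α false χ * α true χ)

  forms-nonzero : ∀ c l j k → length l ≡ 2 ℕ.* mersenne m → mersenne m ≡ j ℕ.+ k →
                  count false l ≡ 2 ℕ.* j → count true l ≡ 2 ℕ.* k →
                  holeForm c * prod (map crossingForm l) ≢ 0#
  forms-nonzero c l j k ∣l∣ r≡ f≡ t≡ ≡0 =
    •-nonzero (2^≢0 m) g-names (trans (sym (holeForm-volumes c)) (cancel b•≡0))
    where
    X = nonzeros m
    a = (2 ℕ.^ m) ℕ.^ length l
    T = ΠΠ characterMatch X δ l
    b = + (2 ℕ.^ length X) ℤ.* T
    a≢0 : + a ≢ 0ℤ
    a≢0 eq = ℕ.≢-nonZero⁻¹ a {{ℕ.m^n≢0 (2 ℕ.^ m) (length l) {{ℕ.m^n≢0 2 m}}}} (ℤ.+-injective eq)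
    T≢0 : T ≢ 0ℤ
    T≢0 = ΠΠ-nonzero m (λ χ x y → character χ x ℤ.* character χ y) (λ χ x y → bit (dot χ x xor dot χ y))
      (λ χ x y → trans (cong₂ ℤ._*_ (character-dot χ x) (character-dot χ y)) (trans (sign-* (dot χ x) (dot χ y)) (sign-bit (dot χ x xor dot χ y))))
      X l j k (length-nonzeros m) r≡ f≡ t≡
    b•≡0 : + a • (b • (holeForm c * volumes X)) ≡ 0#
    b•≡0 = begin
      + a • (b • (holeForm c * volumes X))    ≡⟨ cong (+ a •_) (•-*ʳ b (holeForm c) (volumes X)) ⟨
      + a • (holeForm c * (b • volumes X))    ≡⟨ cong (λ x → + a • (holeForm c * x)) (rows-volumes X l (ℕ.≤-reflexive (trans (cong (2 ℕ.*_) (length-nonzeros m)) (sym ∣l∣)))) ⟨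
      + a • (holeForm c * rows X l)           ≡⟨ •-*ʳ (+ a) (holeForm c) _ ⟨
      holeForm c * (+ a • rows X l)           ≡⟨ cong (holeForm c *_) (prod-crossingForm l) ⟨
      holeForm c * prod (map crossingForm l)  ≡⟨ ≡0 ⟩
      0#                                      ∎
    cancel : ∀ {x : Λ N} → + a • (b • x) ≡ 0# → x ≡ 0#
    cancel {x} eq with •-integral (+ a) _ eq
    ... | inj₁ a≡0 = contradiction a≡0 a≢0
    ... | inj₂ eq′ with •-integral b x eq′
    ... | inj₂ x≡0 = x≡0
    ... | inj₁ b≡0 with ℤ.i*j≡0⇒i≡0∨j≡0 (+ (2 ℕ.^ length X)) b≡0
    ... | inj₁ ≡0 = contradiction ≡0 (2^≢0 (length X))
    ... | inj₂ ≡0 = contradiction ≡0 T≢0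

  partialSolution : ∀ c l j k → length l ≡ 2 ℕ.* mersenne m → mersenne m ≡ j ℕ.+ k →
                    count false l ≡ 2 ℕ.* j → count true l ≡ 2 ℕ.* k →
                    PairSolution ((false ∷ true ∷ c) ∷ map crossing l)
  partialSolution c l j k ∣l∣ r≡ f≡ t≡ =
    let ps , sums , ≢0 = extract fs (holeForm-extractable c ∷ fs-extractable l) 1# λ eq →
          forms-nonzero c l j k ∣l∣ r≡ f≡ t≡ (begin
            holeForm c * prod (map crossingForm l)       ≡⟨ cong (λ xs → holeForm c * prod xs) (List.map-∘ l) ⟩
            prod (map proj₂ fs)                          ≡⟨ *-identityˡ (prod (map proj₂ fs)) ⟨
            1# * prod (map proj₂ fs)                     ≡⟨ eq ⟩
            0#                                           ∎)
    in ps , trans sums (cong ((false ∷ true ∷ c) ∷_) (sym (List.map-∘ l))) ,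
       nonzero⇒unique (flatten ps) λ eq → ≢0 (trans (*-identityˡ (prod (map U (flatten ps)))) eq)
    where
    fs = (false ∷ true ∷ c , holeForm c) ∷ map (λ i → crossing i , crossingForm i) l
    fs-extractable : ∀ l → All (uncurry Extractable) (map (λ i → crossing i , crossingForm i) l)
    fs-extractable [] = []
    fs-extractable (i ∷ l) = crossingForm-extractable i ∷ fs-extractable l

partialSolution : ∀ {m} c l j k → length l ≡ 2 ℕ.* mersenne m → mersenne m ≡ j ℕ.+ k →
                  count false l ≡ 2 ℕ.* j → count true l ≡ 2 ℕ.* k →
                  PairSolution {suc (suc m)} ((false ∷ true ∷ c) ∷ map crossing l)
partialSolution {m} = Assembly.partialSolution m (generator _≟_ (names m)) (generator-linear _≟_ (names m))
  (λ q → generator-∉ _≟_ (names m) (absent q)) (prod-generator _≟_ (names m) (names-unique m))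
  where
  _≟_ = Vec.≡-dec {n = suc (suc m)} Bool._≟_
  absent : ∀ q → (true ∷ q ∷ 𝟎) ∉ names m
  absent q (there (there z∈)) = All.lookup (𝟎∉nonzeros m) (∈-quadruples (nonzeros m) z∈) refl

-- Coordinates adapted to the hyperplane and the holes

sumL-flatten : (ps : List (Vec Bool m × Vec Bool m)) → sumL (flatten ps) ≡ sumL (map (uncurry _⊕_) ps)
sumL-flatten [] = refl
sumL-flatten ((x , y) ∷ ps) = trans (cong (λ z → x ⊕ (y ⊕ z)) (sumL-flatten ps)) (sym (⊕-assoc x y _))

length-flatten : {A : Set} (ps : List (A × A)) → length (flatten ps) ≡ 2 ℕ.* length ps
length-flatten [] = refl
length-flatten (_ ∷ ps) = trans (cong (λ x → suc (suc x)) (length-flatten ps)) (sym (ℕ.*-suc 2 (length ps)))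

flatten-map : {A B : Set} (f : A → B) (ps : List (A × A)) → flatten (map (Product.map f f) ps) ≡ map f (flatten ps)
flatten-map f [] = refl
flatten-map f ((x , y) ∷ ps) = cong (λ xs → f x ∷ f y ∷ xs) (flatten-map f ps)

second : Vec Bool (suc (suc m)) → Bool
second v = head (tail v)

second-⊕ : (u v : Vec Bool (suc (suc m))) → second (u ⊕ v) ≡ second u xor second v
second-⊕ (_ ∷ _ ∷ _) (_ ∷ _ ∷ _) = refl

second-sumL : (l : List (Bool × Vec Bool m)) → second (sumL (map crossing l)) ≡ parity (count true l)
second-sumL [] = refl
second-sumL ((ε , c) ∷ l) = trans (second-⊕ (true ∷ ε ∷ c) (sumL (map crossing l))) (trans (cong (ε xor_) (second-sumL l)) (step ε))
  where
  step : ∀ ε → ε xor parity (count true l) ≡ parity (same true ε ℕ.+ count true l)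
  step false = refl
  step true = refl

parity-even⁻ : ∀ n → parity n ≡ false → ∃[ k ] n ≡ 2 ℕ.* k
parity-even⁻ n eq with halve n
... | inj₁ even = even
... | inj₂ (k , refl) with trans (cong not (sym (parity-even k))) eq
... | ()

count-total : {B : Set} (l : List (Bool × B)) → count false l ℕ.+ count true l ≡ length l
count-total [] = refl
count-total ((false , _) ∷ l) = cong suc (count-total l)
count-total ((true , _) ∷ l) = trans (ℕ.+-suc (count false l) (count true l)) (cong suc (count-total l))

module _ (a b : Vec Bool m) (l : List (Bool × Vec Bool m)) (∣l∣ : length l ≡ 2 ℕ.* mersenne m) where

  private
    a⁺ b⁺ : Vec Bool (suc (suc m))
    a⁺ = false ∷ true ∷ a
    b⁺ = false ∷ true ∷ b

  twoHoleSolution : sumL (a⁺ ∷ b⁺ ∷ map crossing l) ≡ 𝟎 → PairSolution (b⁺ ∷ a⁺ ∷ map crossing l)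
  -- In the second coordinate the two holes cancel, which leaves the parity of `count true l`.
  twoHoleSolution sum≡𝟎 with parity-even⁻ (count true l) parity≡
    where
    parity≡ : parity (count true l) ≡ false
    parity≡ = begin
      parity (count true l)                                     ≡⟨ second-sumL l ⟨
      second (sumL (map crossing l))                            ≡⟨ Bool.not-involutive _ ⟨
      true xor (true xor second (sumL (map crossing l)))        ≡⟨ cong (true xor_) (second-⊕ b⁺ (sumL (map crossing l))) ⟨
      true xor second (b⁺ ⊕ sumL (map crossing l))               ≡⟨ second-⊕ a⁺ (b⁺ ⊕ sumL (map crossing l)) ⟨
      second (sumL (a⁺ ∷ b⁺ ∷ map crossing l))                    ≡⟨ cong second sum≡𝟎 ⟩
      false                                                     ∎
  ... | k , t≡ = addPair (partialSolution a l (mersenne m ∸ k) k ∣l∣ (sym (ℕ.m∸n+n≡m k≤)) f≡ t≡)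
    where
    total : count false l ℕ.+ 2 ℕ.* k ≡ 2 ℕ.* mersenne m
    total = trans (cong (count false l ℕ.+_) (sym t≡)) (trans (count-total l) ∣l∣)
    k≤ : k ≤ mersenne m
    k≤ = ℕ.*-cancelˡ-≤ 2 (subst (2 ℕ.* k ≤_) total (ℕ.m≤n+m (2 ℕ.* k) (count false l)))
    f≡ : count false l ≡ 2 ℕ.* (mersenne m ∸ k)
    f≡ = begin
      count false l                              ≡⟨ ℕ.m+n∸n≡m (count false l) (2 ℕ.* k) ⟨
      count false l ℕ.+ 2 ℕ.* k ∸ 2 ℕ.* k        ≡⟨ cong (_∸ 2 ℕ.* k) total ⟩
      2 ℕ.* mersenne m ∸ 2 ℕ.* k                 ≡⟨ ℕ.*-distribˡ-∸ 2 (mersenne m) k ⟨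
      2 ℕ.* (mersenne m ∸ k)                     ∎
    addPair : PairSolution (a⁺ ∷ map crossing l) → PairSolution (b⁺ ∷ a⁺ ∷ map crossing l)
    addPair (ps , sums , unique) with complement (flatten ps) unique
    ... | zs , points↭ = finish zs points↭ ∣zs∣
      where
      S = sumL (a⁺ ∷ map crossing l)
      b⁺≡S : b⁺ ≡ S
      b⁺≡S = ⊕-zero⇒≡ (trans (sumL-↭ (↭.swap b⁺ a⁺ (↭-refl {x = map crossing l}))) sum≡𝟎)
      ∣ps∣ : length ps ≡ suc (2 ℕ.* mersenne m)
      ∣ps∣ = begin
        length ps                                ≡⟨ List.length-map (uncurry _⊕_) ps ⟨
        length (map (uncurry _⊕_) ps)            ≡⟨ cong length sums ⟩
        suc (length (map crossing l))            ≡⟨ cong suc (trans (List.length-map crossing l) ∣l∣) ⟩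
        suc (2 ℕ.* mersenne m)                   ∎
      -- Of the 4 r + 4 points, the 2 r + 1 pairs use 4 r + 2, where r is `mersenne m`.
      ∣zs∣ : length zs ≡ 2
      ∣zs∣ = ℕ.+-cancelˡ-≡ (2 ℕ.* length ps) (length zs) 2 (begin
        2 ℕ.* length ps ℕ.+ length zs            ≡⟨ cong (ℕ._+ length zs) (length-flatten ps) ⟨
        length (flatten ps) ℕ.+ length zs        ≡⟨ List.length-++ (flatten ps) ⟨
        length (flatten ps ++ zs)                ≡⟨ ↭-length points↭ ⟨
        suc (length (nonzeros (suc (suc m))))    ≡⟨ cong suc (length-nonzeros (suc (suc m))) ⟩
        suc (suc (2 ℕ.* suc (2 ℕ.* mersenne m))) ≡⟨ cong (λ x → suc (suc (2 ℕ.* x))) ∣ps∣ ⟨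
        suc (suc (2 ℕ.* length ps))              ≡⟨ ℕ.+-comm 2 (2 ℕ.* length ps) ⟩
        2 ℕ.* length ps ℕ.+ 2                    ∎)
      finish : ∀ zs → points (suc (suc m)) ↭ flatten ps ++ zs → length zs ≡ 2 → PairSolution (b⁺ ∷ a⁺ ∷ map crossing l)
      finish (y ∷ y′ ∷ []) points↭ refl = (y , y′) ∷ ps , cong₂ _∷_ y⊕y′≡b⁺ sums ,
        Unique-resp-↭ (↭-trans points↭ (++-comm (flatten ps) _)) (points-unique (suc (suc m)))
        where
        y⊕y′≡b⁺ : y ⊕ y′ ≡ b⁺
        y⊕y′≡b⁺ = sym (trans b⁺≡S (⊕-zero⇒≡ (begin
          S ⊕ (y ⊕ y′)                                 ≡⟨ cong₂ _⊕_ (trans (cong sumL (sym sums)) (sym (sumL-flatten ps))) (cong (y ⊕_) (sym (⊕-identityʳ y′))) ⟩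
          sumL (flatten ps) ⊕ sumL (y ∷ y′ ∷ [])       ≡⟨ sumL-++ (flatten ps) (y ∷ y′ ∷ []) ⟨
          sumL (flatten ps ++ y ∷ y′ ∷ [])             ≡⟨ sumL-↭ points↭ ⟨
          sumL (points (suc (suc m)))                  ≡⟨ sumL-points m ⟩
          𝟎                                            ∎)))

-- Invariance under permutations and linear isomorphisms

flatten-↭ : {A : Set} {ps qs : List (A × A)} → ps ↭ qs → flatten ps ↭ flatten qs
flatten-↭ ↭.refl = ↭-refl
flatten-↭ (prep (x , y) ps↭qs) = prep x (prep y (flatten-↭ ps↭qs))
flatten-↭ {qs = _ ∷ _ ∷ qs} (↭.swap (x , y) (x′ , y′) ps↭qs) = ↭-trans
  (prep x (prep y (prep x′ (prep y′ (flatten-↭ ps↭qs)))))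
  (++-swap x y x′ y′ (flatten qs))
  where
  ++-swap : ∀ {A : Set} (x y x′ y′ : A) zs → x ∷ y ∷ x′ ∷ y′ ∷ zs ↭ x′ ∷ y′ ∷ x ∷ y ∷ zs
  ++-swap x y x′ y′ zs = ↭-trans (prep x (↭.swap y x′ ↭-refl)) (↭-trans (↭.swap x x′ (↭.swap y y′ ↭-refl)) (prep x′ (↭.swap x y′ ↭-refl)))
flatten-↭ (↭.trans ps↭qs qs↭rs) = ↭-trans (flatten-↭ ps↭qs) (flatten-↭ qs↭rs)

PairSolution-↭ : {vs ws : List (Vec Bool m)} → vs ↭ ws → PairSolution vs → PairSolution ws
PairSolution-↭ vs↭ws (ps , refl , unique) with ↭-map-inv (uncurry _⊕_) vs↭ws
... | qs , ws≡ , ps↭qs = qs , sym ws≡ , Unique-resp-↭ (flatten-↭ ps↭qs) unique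

-- Additivity is linearity over the field with two elements.
record LinearIso (m : ℕ) : Set where
  field
    to from : Vec Bool m → Vec Bool m
    to-⊕    : ∀ x y → to (x ⊕ y) ≡ to x ⊕ to y
    from-to : ∀ x → from (to x) ≡ x
    to-from : ∀ x → to (from x) ≡ x

  from-⊕ : ∀ x y → from (x ⊕ y) ≡ from x ⊕ from y
  from-⊕ x y = begin
    from (x ⊕ y)                      ≡⟨ cong₂ (λ x y → from (x ⊕ y)) (to-from x) (to-from y) ⟨
    from (to (from x) ⊕ to (from y))  ≡⟨ cong from (to-⊕ (from x) (from y)) ⟨
    from (to (from x ⊕ from y))       ≡⟨ from-to _ ⟩
    from x ⊕ from y                   ∎

  to-𝟎 : to 𝟎 ≡ 𝟎
  to-𝟎 = begin
    to 𝟎             ≡⟨ cong to (⊕-self 𝟎) ⟨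
    to (𝟎 ⊕ 𝟎)       ≡⟨ to-⊕ 𝟎 𝟎 ⟩
    to 𝟎 ⊕ to 𝟎      ≡⟨ ⊕-self (to 𝟎) ⟩
    𝟎                ∎

  to-≢𝟎 : ∀ {x} → x ≢ 𝟎 → to x ≢ 𝟎
  to-≢𝟎 {x} x≢𝟎 to≡𝟎 = x≢𝟎 (begin
    x             ≡⟨ from-to x ⟨
    from (to x)   ≡⟨ cong from (trans to≡𝟎 (sym to-𝟎)) ⟩
    from (to 𝟎)   ≡⟨ from-to 𝟎 ⟩
    𝟎             ∎)

  to-sumL : ∀ vs → to (sumL vs) ≡ sumL (map to vs)
  to-sumL [] = to-𝟎
  to-sumL (v ∷ vs) = trans (to-⊕ v (sumL vs)) (cong (to v ⊕_) (to-sumL vs))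

  PairSolution-iso : ∀ {vs} → PairSolution (map to vs) → PairSolution vs
  PairSolution-iso {vs} (ps , sums , unique) = map (Product.map from from) ps , (begin
    map (uncurry _⊕_) (map (Product.map from from) ps)  ≡⟨ List.map-∘ ps ⟨
    map (λ (x , y) → from x ⊕ from y) ps                ≡⟨ List.map-cong (λ (x , y) → sym (from-⊕ x y)) ps ⟩
    map (λ (x , y) → from (x ⊕ y)) ps                   ≡⟨ List.map-∘ ps ⟩
    map from (map (uncurry _⊕_) ps)                     ≡⟨ cong (map from) sums ⟩
    map from (map to vs)                                ≡⟨ List.map-∘ vs ⟨
    map (from ∘ to) vs                                  ≡⟨ trans (List.map-cong from-to vs) (List.map-id vs) ⟩
    vs                                                  ∎) ,
    subst Unique (sym (flatten-map from ps)) (Unique.map⁺ (λ {x} {y} eq → trans (sym (to-from x)) (trans (cong to eq) (to-from y))) unique)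

head-⊕ : (u v : Vec Bool (suc m)) → head (u ⊕ v) ≡ head u xor head v
head-⊕ (_ ∷ _) (_ ∷ _) = refl

tail-⊕ : (u v : Vec Bool (suc m)) → tail (u ⊕ v) ≡ tail u ⊕ tail v
tail-⊕ (_ ∷ _) (_ ∷ _) = refl

head-tail : (u : Vec Bool (suc m)) → head u ∷ tail u ≡ u
head-tail (_ ∷ _) = refl

-- Linear functionals as coordinates

Additive : (Vec Bool m → Bool) → Set
Additive L = ∀ x y → L (x ⊕ y) ≡ L x xor L y

additive-𝟎 : (L : Vec Bool m → Bool) → Additive L → L 𝟎 ≡ false
additive-𝟎 L L-⊕ = begin
  L 𝟎              ≡⟨ cong L (⊕-self 𝟎) ⟨
  L (𝟎 ⊕ 𝟎)        ≡⟨ L-⊕ 𝟎 𝟎 ⟩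
  L 𝟎 xor L 𝟎      ≡⟨ Bool.xor-same (L 𝟎) ⟩
  false            ∎

additive-∷ : (L : Vec Bool (suc m) → Bool) → Additive L → ∀ b x → L (b ∷ x) ≡ (b ∧ L (true ∷ 𝟎)) xor L (false ∷ x)
additive-∷ L L-⊕ false x = refl
additive-∷ L L-⊕ true x = trans (cong (λ x → L (true ∷ x)) (sym (⊕-identityˡ x))) (L-⊕ (true ∷ 𝟎) (false ∷ x))

Straightens : LinearIso (suc m) → (Vec Bool (suc m) → Bool) → Set
Straightens iso L = ∀ x → head (LinearIso.to iso x) ≡ L x

-- If L is 1 at the first unit vector, L itself can replace the first coordinate. Otherwise L
-- ignores that coordinate, and the tail is straightened, its new first coordinate being moved to
-- the front.
straighten : (L : Vec Bool (suc m) → Bool) → Additive L → ∀ a → L a ≡ true → ∃[ iso ] Straightens iso L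
straighten L L-⊕ a La≡true with L (true ∷ 𝟎) in Le
straighten L L-⊕ a La≡true | true = record
  { to = λ x → L x ∷ tail x
  ; from = λ x → (head x xor L (false ∷ tail x)) ∷ tail x
  ; to-⊕ = λ x y → cong₂ _∷_ (L-⊕ x y) (tail-⊕ x y)
  ; from-to = λ x → trans (cong (λ b → (b xor L (false ∷ tail x)) ∷ tail x) (L-∷ x))
      (trans (cong (_∷ tail x) (xor-cancelʳ (head x) _)) (head-tail x))
  ; to-from = λ x → trans (cong (_∷ tail x) (trans (L-∷ (_ ∷ tail x)) (xor-cancelʳ (head x) _))) (head-tail x)
  } , λ x → refl
  where
  L-∷ : ∀ x → L x ≡ head x xor L (false ∷ tail x)
  L-∷ (b ∷ x) = trans (additive-∷ L L-⊕ b x) (cong (_xor L (false ∷ x)) (trans (cong (b ∧_) Le) (Bool.∧-identityʳ b)))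
  xor-cancelʳ : ∀ b c → (b xor c) xor c ≡ b
  xor-cancelʳ b c = trans (Bool.xor-assoc b c c) (trans (cong (b xor_) (Bool.xor-same c)) (Bool.xor-identityʳ b))
straighten {zero} L L-⊕ (b ∷ []) La≡true | false = contradiction
  (begin
    true                                     ≡⟨ La≡true ⟨
    L (b ∷ [])                               ≡⟨ additive-∷ L L-⊕ b [] ⟩
    (b ∧ L (true ∷ [])) xor L (false ∷ [])   ≡⟨ cong₂ (λ x y → (b ∧ x) xor y) Le (additive-𝟎 L L-⊕) ⟩
    (b ∧ false) xor false                    ≡⟨ cong (_xor false) (Bool.∧-zeroʳ b) ⟩
    false                                    ∎) λ ()
straighten {suc m} L L-⊕ (b ∷ a) La≡true | false
  with straighten (L ∘ (false ∷_)) (λ x y → L-⊕ (false ∷ x) (false ∷ y)) a (trans (sym (L-∷ (b ∷ a))) La≡true)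
  where
  L-∷ : ∀ x → L x ≡ L (false ∷ tail x)
  L-∷ (b ∷ x) = trans (additive-∷ L L-⊕ b x) (cong (_xor L (false ∷ x)) (trans (cong (b ∧_) Le) (Bool.∧-zeroʳ b)))
... | iso , straight = record
  { to = λ x → head (to (tail x)) ∷ head x ∷ tail (to (tail x))
  ; from = λ x → head (tail x) ∷ from (head x ∷ tail (tail x))
  ; to-⊕ = λ x y → cong₂ _∷_ (trans (cong (head ∘ to) (tail-⊕ x y)) (trans (cong head (to-⊕ (tail x) (tail y))) (head-⊕ (to (tail x)) (to (tail y)))))
      (cong₂ _∷_ (head-⊕ x y) (trans (cong (tail ∘ to) (tail-⊕ x y)) (trans (cong tail (to-⊕ (tail x) (tail y))) (tail-⊕ (to (tail x)) (to (tail y))))))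
  ; from-to = λ x → trans (cong (head x ∷_) (trans (cong from (head-tail (to (tail x)))) (from-to (tail x)))) (head-tail x)
  ; to-from = λ where
      (b ∷ c ∷ x) → cong₂ (λ b x → b ∷ c ∷ x) (cong head (to-from (b ∷ x))) (cong tail (to-from (b ∷ x)))
  } , λ x → trans (straight (tail x)) (sym (L-∷ x))
  where
  open LinearIso iso
  L-∷ : ∀ x → L x ≡ L (false ∷ tail x)
  L-∷ (b ∷ x) = trans (additive-∷ L L-⊕ b x) (cong (_xor L (false ∷ x)) (trans (cong (b ∧_) Le) (Bool.∧-zeroʳ b)))

dot-⊕ : (φ : Vec Bool m) → Additive (dot φ)
dot-⊕ [] [] [] = refl
dot-⊕ (p ∷ φ) (b ∷ x) (c ∷ y) = begin
  (p ∧ (b xor c)) xor dot φ (x ⊕ y)                          ≡⟨ cong₂ _xor_ (Bool.∧-distribˡ-xor p b c) (dot-⊕ φ x y) ⟩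
  ((p ∧ b) xor (p ∧ c)) xor (dot φ x xor dot φ y)            ≡⟨ xor-interchange (p ∧ b) (p ∧ c) (dot φ x) (dot φ y) ⟩
  ((p ∧ b) xor dot φ x) xor ((p ∧ c) xor dot φ y)            ∎
  where
  xor-interchange : ∀ a b c d → (a xor b) xor (c xor d) ≡ (a xor c) xor (b xor d)
  xor-interchange a b c d = begin
    (a xor b) xor (c xor d)   ≡⟨ Bool.xor-assoc a b _ ⟩
    a xor (b xor (c xor d))   ≡⟨ cong (a xor_) (Bool.xor-assoc b c d) ⟨
    a xor ((b xor c) xor d)   ≡⟨ cong (λ x → a xor (x xor d)) (Bool.xor-comm b c) ⟩
    a xor ((c xor b) xor d)   ≡⟨ cong (a xor_) (Bool.xor-assoc c b d) ⟩
    a xor (c xor (b xor d))   ≡⟨ Bool.xor-assoc a c _ ⟨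
    (a xor c) xor (b xor d)   ∎

dot-𝟎ˡ : (x : Vec Bool m) → dot 𝟎 x ≡ false
dot-𝟎ˡ [] = refl
dot-𝟎ˡ (_ ∷ x) = dot-𝟎ˡ x

-- The functionals vanishing at a and those vanishing at b form proper subspaces of the dual, and no
-- vector space is the union of two proper subspaces. The functional found will become the second
-- coordinate.
detect : (a b : Vec Bool m) → a ≢ 𝟎 → b ≢ 𝟎 → ∃[ φ ] dot φ a ≡ true × dot φ b ≡ true
detect [] b a≢𝟎 b≢𝟎 = contradiction refl a≢𝟎
detect (p ∷ a) (q ∷ b) a≢𝟎 b≢𝟎 with Vec.≡-dec Bool._≟_ a 𝟎 | Vec.≡-dec Bool._≟_ b 𝟎
detect (p ∷ a) (q ∷ b) a≢𝟎 b≢𝟎 | no a≢ | no b≢ = let φ , φa , φb = detect a b a≢ b≢ in false ∷ φ , φa , φb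
detect (false ∷ a) (q ∷ b) a≢𝟎 b≢𝟎 | yes refl | _ = contradiction refl a≢𝟎
detect (p ∷ a) (false ∷ b) a≢𝟎 b≢𝟎 | _ | yes refl = contradiction refl b≢𝟎
detect (true ∷ a) (true ∷ b) a≢𝟎 b≢𝟎 | _ | _ = true ∷ 𝟎 , cong not (dot-𝟎ˡ a) , cong not (dot-𝟎ˡ b)
-- The tail of the first vector is 0, so φ has to detect b alone, for which b is passed twice; the
-- leading `true` detects the first vector.
detect (true ∷ a) (false ∷ b) a≢𝟎 b≢𝟎 | yes refl | no b≢ = let φ , φb , _ = detect b b b≢ b≢ in
  true ∷ φ , cong not (additive-𝟎 (dot φ) (dot-⊕ φ)) , φb
detect (false ∷ a) (true ∷ b) a≢𝟎 b≢𝟎 | no a≢ | yes refl = let φ , φa , _ = detect a a a≢ a≢ in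
  true ∷ φ , φa , cong not (additive-𝟎 (dot φ) (dot-⊕ φ))

-- Hyperplanes as kernels of functionals

module Hyperplane {ℓ} {s} (H : Pred (Vec Bool s) ℓ) (isHyperplane : IsHyperplane H) where
  open IsHyperplane isHyperplane
  open IsSubspace isSubspace
  open HasCodimension codimension1

  normal : Vec Bool s
  normal = basis Fin.zero

  -- The coefficient of v in the quotient by H, along its one basis vector. Through it membership in
  -- H becomes decidable.
  functional : Vec Bool s → Bool
  functional v = proj₁ (spanning v) Fin.zero

  private
    ·-false : (v : Vec Bool n) → false · v ≡ 𝟎
    ·-false [] = refl
    ·-false (_ ∷ v) = cong (false ∷_) (·-false v)

    ·-true : (v : Vec Bool n) → true · v ≡ v
    ·-true = Vec.map-id

    linearCombination₁ : ∀ c → linearCombination c basis ≡ c Fin.zero · normal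
    linearCombination₁ c = ⊕-identityʳ _

  normal∉H : ¬ H normal
  normal∉H n∈H with independent (λ _ → true) (subst H (sym (trans (linearCombination₁ (λ _ → true)) (·-true normal))) n∈H) Fin.zero
  ... | ()

  functional-false : ∀ {v} → functional v ≡ false → H v
  functional-false {v} eq with spanning v
  ... | c , v+c∈H = subst H (trans (cong (v ⊕_) (trans (linearCombination₁ c) (trans (cong (_· normal) eq) (·-false normal)))) (⊕-identityʳ v)) v+c∈H

  functional-true : ∀ {v} → functional v ≡ true → H (v ⊕ normal)
  functional-true {v} eq with spanning v
  ... | c , v+c∈H = subst H (cong (v ⊕_) (trans (linearCombination₁ c) (trans (cong (_· normal) eq) (·-true normal)))) v+c∈H

  H⇒functional : ∀ {v} → H v → functional v ≡ false
  H⇒functional {v} v∈H with functional v in eq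
  ... | false = refl
  ... | true = contradiction (subst H (⊕-cancelˡ v normal) (⊕-closed v∈H (functional-true eq))) normal∉H

  ¬H⇒functional : ∀ {v} → ¬ H v → functional v ≡ true
  ¬H⇒functional {v} v∉H with functional v in eq
  ... | true = refl
  ... | false = contradiction (functional-false eq) v∉H

  -- `spanning` merely chooses a coefficient for each v and promises no linearity; that the choice
  -- is forced follows from `normal∉H`.
  functional-⊕ : Additive functional
  functional-⊕ u v with functional u in equ | functional v in eqv
  ... | false | false = H⇒functional (⊕-closed (functional-false equ) (functional-false eqv))
  ... | false | true = ¬H⇒functional λ u⊕v∈H → contradiction
    (trans (sym eqv) (H⇒functional (subst H (⊕-cancelˡ u v) (⊕-closed (functional-false equ) u⊕v∈H)))) λ ()
  ... | true | false = ¬H⇒functional λ u⊕v∈H → contradiction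
    (trans (sym equ) (H⇒functional (subst H (trans (cong (v ⊕_) (⊕-comm u v)) (⊕-cancelˡ v u)) (⊕-closed (functional-false eqv) u⊕v∈H)))) λ ()
  ... | true | true = H⇒functional (subst H (begin
      (u ⊕ normal) ⊕ (v ⊕ normal)   ≡⟨ ⊕-assoc u normal _ ⟩
      u ⊕ (normal ⊕ (v ⊕ normal))   ≡⟨ cong (λ x → u ⊕ (normal ⊕ x)) (⊕-comm v normal) ⟩
      u ⊕ (normal ⊕ (normal ⊕ v))   ≡⟨ cong (u ⊕_) (⊕-cancelˡ normal v) ⟩
      u ⊕ v                         ∎)
    (⊕-closed (functional-true equ) (functional-true eqv)))

-- From lists to indexed pairs

2^≡1+mersenne : ∀ m → 2 ^ m ≡ suc (mersenne m)
2^≡1+mersenne zero = refl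
2^≡1+mersenne (suc m) = trans (cong (2 ℕ.*_) (2^≡1+mersenne m)) (ℕ.*-suc 2 (mersenne m))

sumL-tabulate : (M : Vector (Vec Bool s) n) → sumL (tabulate M) ≡ ∑ M
sumL-tabulate {n = zero} M = refl
sumL-tabulate {n = suc n} M = cong (M Fin.zero ⊕_) (sumL-tabulate (M ∘ Fin.suc))

tabulatePairs : (M : Vector (Vec Bool s) n) (ps : List (Vec Bool s × Vec Bool s)) → map (uncurry _⊕_) ps ≡ tabulate M →
                ∃[ P ] tabulate P ≡ ps × (∀ i → uncurry _⊕_ (P i) ≡ M i)
tabulatePairs {n = zero} M [] eq = (λ ()) , refl , λ ()
tabulatePairs {n = suc n} M (p ∷ ps) eq with tabulatePairs (M ∘ Fin.suc) ps (List.∷-injectiveʳ eq)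
... | P , P≡ , sums = (λ { Fin.zero → p ; (Fin.suc i) → P i }) , cong (p ∷_) P≡ , λ { Fin.zero → List.∷-injectiveˡ eq ; (Fin.suc i) → sums i }

module _ {A : Set} where

  _∈ₚ_ : A → A × A → Set
  z ∈ₚ (x , y) = z ≡ x ⊎ z ≡ y

  ∈-flatten⁺ : (P : Fin n → A × A) → ∀ i {z} → z ∈ₚ P i → z ∈ flatten (tabulate P)
  ∈-flatten⁺ P Fin.zero (inj₁ refl) = here refl
  ∈-flatten⁺ P Fin.zero (inj₂ refl) = there (here refl)
  ∈-flatten⁺ P (Fin.suc i) z∈ = there (there (∈-flatten⁺ (P ∘ Fin.suc) i z∈))

  ∈-flatten⁻ : (P : Fin n → A × A) → ∀ {z} → z ∈ flatten (tabulate P) → ∃[ i ] z ∈ₚ P i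
  ∈-flatten⁻ {n = suc n} P (here z≡) = Fin.zero , inj₁ z≡
  ∈-flatten⁻ {n = suc n} P (there (here z≡)) = Fin.zero , inj₂ z≡
  ∈-flatten⁻ {n = suc n} P (there (there z∈)) = Product.map Fin.suc (λ z∈ → z∈) (∈-flatten⁻ (P ∘ Fin.suc) z∈)

  pairs-disjoint : (P : Fin n → A × A) → Unique (flatten (tabulate P)) → ∀ {i j z} → i ≢ j → z ∈ₚ P i → ¬ (z ∈ₚ P j)
  pairs-disjoint P _ {Fin.zero} {Fin.zero} i≢j _ _ = i≢j refl
  pairs-disjoint P ((_ ∷ x∉) ∷ _ ∷ _) {Fin.zero} {Fin.suc j} _ (inj₁ refl) z∈ = All.lookup x∉ (∈-flatten⁺ (P ∘ Fin.suc) j z∈) refl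
  pairs-disjoint P (_ ∷ y∉ ∷ _) {Fin.zero} {Fin.suc j} _ (inj₂ refl) z∈ = All.lookup y∉ (∈-flatten⁺ (P ∘ Fin.suc) j z∈) refl
  pairs-disjoint P ((_ ∷ x∉) ∷ _ ∷ _) {Fin.suc i} {Fin.zero} _ z∈ (inj₁ refl) = All.lookup x∉ (∈-flatten⁺ (P ∘ Fin.suc) i z∈) refl
  pairs-disjoint P (_ ∷ y∉ ∷ _) {Fin.suc i} {Fin.zero} _ z∈ (inj₂ refl) = All.lookup y∉ (∈-flatten⁺ (P ∘ Fin.suc) i z∈) refl
  pairs-disjoint P (_ ∷ _ ∷ P!) {Fin.suc i} {Fin.suc j} i≢j z∈i z∈j = pairs-disjoint (P ∘ Fin.suc) P! (i≢j ∘ cong Fin.suc) z∈i z∈j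

-- Covering holds by counting: `2 ^ m` disjoint pairs of distinct points exhaust all `2 ^ suc m`
-- points, so the complement is empty.
hadamard : ∀ m (M : Vector (Vec Bool (suc m)) (2 ^ m)) → (∀ i → M i ≢ 𝟎) → PairSolution (tabulate M) → HadamardPairSolution M
hadamard m M M≢𝟎 (ps , sums , unique) with tabulatePairs M ps sums
... | P , refl , P-sums = record
  { x = proj₁ ∘ P
  ; y = proj₂ ∘ P
  ; distinct = λ i x≡y → M≢𝟎 i (trans (sym (P-sums i)) (trans (cong (_⊕ proj₂ (P i)) x≡y) (⊕-self _)))
  ; disjoint = λ i≢j z (z∈i , z∈j) → pairs-disjoint P unique i≢j z∈i z∈j
  ; covering = λ z → ∈-flatten⁻ P (covered z)
  ; sums = P-sums
  }
  where
  covered : ∀ z → z ∈ flatten (tabulate P)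
  covered z with complement (flatten (tabulate P)) unique
  ... | [] , points↭ with ∈-++⁻ (flatten (tabulate P)) (∈-resp-↭ points↭ (points-complete z))
  ... | inj₁ z∈ = z∈
  covered z | w ∷ ws , points↭ = contradiction (begin
    2 ℕ.* 2 ^ m ℕ.+ suc (length ws)                      ≡⟨ cong (λ x → 2 ℕ.* x ℕ.+ suc (length ws)) (List.length-tabulate P) ⟨
    2 ℕ.* length (tabulate P) ℕ.+ suc (length ws)        ≡⟨ cong (ℕ._+ suc (length ws)) (length-flatten (tabulate P)) ⟨
    length (flatten (tabulate P)) ℕ.+ length (w ∷ ws)    ≡⟨ List.length-++ (flatten (tabulate P)) ⟨
    length (flatten (tabulate P) ++ w ∷ ws)              ≡⟨ ↭-length points↭ ⟨
    suc (length (nonzeros (suc m)))                      ≡⟨ cong suc (length-nonzeros (suc m)) ⟩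
    suc (mersenne (suc m))                               ≡⟨ 2^≡1+mersenne (suc m) ⟨
    2 ℕ.* 2 ^ m                                          ∎) (ℕ.m+1+n≢m (2 ℕ.* 2 ^ m))

twoIndices : {i j : Fin n} → i ≢ j → ∃[ ks ] allFin n ↭ i ∷ j ∷ ks
twoIndices {n} {i} {j} i≢j with ∈⇒↭ (∈-allFin i)
... | xs , allFin↭ with ∈-resp-↭ allFin↭ (∈-allFin j)
... | here j≡i = contradiction (sym j≡i) i≢j
... | there j∈xs with ∈⇒↭ j∈xs
... | ks , xs↭ = ks , ↭-trans allFin↭ (prep i xs↭)

theorem15 : ∀ {ℓ : Level} (s : ℕ) → 2 ≤ s →
    (H : Pred (𝔽₂^ s) ℓ) → IsHyperplane H →
    (M : Vector (𝔽₂^ s) (2 ^ (s ∸ 1))) →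
    (∀ i → M i ≢ 𝟎) →
    ∑ M ≡ 𝟎 →
    ExactlyTwo (Internal H M) →
    HadamardPairSolution M
theorem15 (suc zero) (s≤s ())
theorem15 (suc (suc m)) _ H isHyperplane M M≢𝟎 ∑M≡𝟎 (i , j , i≢j , i∈H , j∈H , only)
  -- The first coordinate becomes the functional with kernel H; `normal` witnesses that it is not
  -- identically 0.
  with straighten (Hyperplane.functional H isHyperplane) (Hyperplane.functional-⊕ H isHyperplane)
         (Hyperplane.normal H isHyperplane) (Hyperplane.¬H⇒functional H isHyperplane (Hyperplane.normal∉H H isHyperplane))
-- A hole has first coordinate 0, so its tail is nonzero, and one functional on tails is 1 at both
-- holes.
... | iso₁ , straight₁ with detect (tail (LinearIso.to iso₁ (M i))) (tail (LinearIso.to iso₁ (M j))) (tail≢𝟎 i∈H (M≢𝟎 i)) (tail≢𝟎 j∈H (M≢𝟎 j))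
  where
  open Hyperplane H isHyperplane
  open LinearIso iso₁
  tail≢𝟎 : ∀ {v} → H v → v ≢ 𝟎 → tail (to v) ≢ 𝟎
  tail≢𝟎 {v} v∈H v≢𝟎 eq = to-≢𝟎 v≢𝟎 (trans (sym (head-tail (to v))) (cong₂ _∷_ (trans (straight₁ v) (H⇒functional v∈H)) eq))
-- φ becomes the second coordinate while the first is kept.
... | φ , φi , φj with straighten (dot φ) (dot-⊕ φ) (tail (LinearIso.to iso₁ (M i))) φi | twoIndices i≢j
... | iso₂ , straight₂ | ks , allFin↭ = hadamard (suc m) M M≢𝟎
  -- Read from the inside: the solution in adapted coordinates is recognised as one for the images
  -- of the requests, reordered, and carried back.
  (PairSolution-iso (PairSolution-↭ (↭-sym (↭-trans (map⁺ to M↭) (↭.swap _ _ ↭-refl)))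
    (subst₂ (λ A B → PairSolution (B ∷ A ∷ map to (map M ks))) (sym (hole i∈H φi)) (sym (hole j∈H φj))
      (subst (λ vs → PairSolution ((false ∷ true ∷ rest (M j)) ∷ (false ∷ true ∷ rest (M i)) ∷ vs)) crossings
        (twoHoleSolution (rest (M i)) (rest (M j)) rows ∣rows∣ sum≡𝟎)))))
  where
  open Hyperplane H isHyperplane
  module I₁ = LinearIso iso₁
  module I₂ = LinearIso iso₂
  iso : LinearIso (suc (suc m))
  iso = record
    { to = λ x → head (I₁.to x) ∷ I₂.to (tail (I₁.to x))
    ; from = λ x → I₁.from (head x ∷ I₂.from (tail x))
    ; to-⊕ = λ x y → cong₂ _∷_ (trans (cong head (I₁.to-⊕ x y)) (head-⊕ (I₁.to x) (I₁.to y)))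
        (trans (cong (I₂.to ∘ tail) (I₁.to-⊕ x y)) (trans (cong I₂.to (tail-⊕ (I₁.to x) (I₁.to y))) (I₂.to-⊕ _ _)))
    ; from-to = λ x → trans (cong I₁.from (trans (cong (head (I₁.to x) ∷_) (I₂.from-to _)) (head-tail (I₁.to x)))) (I₁.from-to x)
    ; to-from = λ where
        (b ∷ x) → trans (cong (λ y → head y ∷ I₂.to (tail y)) (I₁.to-from (b ∷ I₂.from x))) (cong (b ∷_) (I₂.to-from x))
    }
  open LinearIso iso
  rest : Vec Bool (suc (suc m)) → Vec Bool m
  rest v = tail (tail (to v))
  hole : ∀ {v} → H v → dot φ (tail (I₁.to v)) ≡ true → to v ≡ false ∷ true ∷ rest v
  hole {v} v∈H φv = cong₂ _∷_ (trans (straight₁ v) (H⇒functional v∈H))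
    (trans (sym (head-tail (I₂.to _))) (cong (_∷ rest v) (trans (straight₂ _) φv)))
  toRow : Vec Bool (suc (suc m)) → Bool × Vec Bool m
  toRow v = head (tail (to v)) , rest v
  rows : List (Bool × Vec Bool m)
  rows = map toRow (map M ks)
  ks-crossing : All (λ k → ¬ H (M k)) ks
  ks-crossing with Unique-resp-↭ allFin↭ (Unique.allFin⁺ (2 ^ suc m))
  ... | (_ ∷ i∉ks) ∷ j∉ks ∷ _ = All.tabulate λ {k} k∈ks k∈H → case-only k∈ks (only k k∈H)
    where
    case-only : ∀ {k} → k ∈ ks → ¬ (k ≡ i ⊎ k ≡ j)
    case-only k∈ks (inj₁ refl) = All.lookup i∉ks k∈ks refl
    case-only k∈ks (inj₂ refl) = All.lookup j∉ks k∈ks refl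
  crossings : map crossing rows ≡ map to (map M ks)
  crossings = go ks ks-crossing
    where
    go : ∀ ks → All (λ k → ¬ H (M k)) ks → map crossing (map toRow (map M ks)) ≡ map to (map M ks)
    go [] [] = refl
    go (k ∷ ks) (k∉H ∷ ks∉H) = cong₂ _∷_
      (cong₂ _∷_ (sym (trans (straight₁ (M k)) (¬H⇒functional k∉H))) (head-tail (I₂.to (tail (I₁.to (M k)))))) (go ks ks∉H)
  M↭ : tabulate M ↭ M i ∷ M j ∷ map M ks
  M↭ = subst (_↭ M i ∷ M j ∷ map M ks) (List.map-tabulate (λ k → k) M) (map⁺ M allFin↭)
  ∣rows∣ : length rows ≡ 2 ℕ.* mersenne m
  ∣rows∣ = ℕ.suc-injective (ℕ.suc-injective (begin
    suc (suc (length rows))         ≡⟨ cong (λ x → suc (suc x)) (trans (List.length-map toRow (map M ks)) (List.length-map M ks)) ⟩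
    suc (suc (length ks))           ≡⟨ ↭-length allFin↭ ⟨
    length (allFin (2 ^ suc m))     ≡⟨ List.length-tabulate (λ k → k) ⟩
    2 ^ suc m                       ≡⟨ 2^≡1+mersenne (suc m) ⟩
    suc (suc (2 ℕ.* mersenne m))    ∎))
  sum≡𝟎 : sumL ((false ∷ true ∷ rest (M i)) ∷ (false ∷ true ∷ rest (M j)) ∷ map crossing rows) ≡ 𝟎
  sum≡𝟎 = begin
    sumL ((false ∷ true ∷ rest (M i)) ∷ (false ∷ true ∷ rest (M j)) ∷ map crossing rows)
      ≡⟨ cong₂ (λ A x → A ⊕ x) (hole i∈H φi) (cong₂ (λ B x → B ⊕ x) (hole j∈H φj) (cong sumL (sym crossings))) ⟨
    sumL (map to (M i ∷ M j ∷ map M ks))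
      ≡⟨ to-sumL (M i ∷ M j ∷ map M ks) ⟨
    to (sumL (M i ∷ M j ∷ map M ks))
      ≡⟨ cong to (trans (sym (sumL-↭ M↭)) (trans (sumL-tabulate M) ∑M≡𝟎)) ⟩
    to 𝟎
      ≡⟨ to-𝟎 ⟩
    𝟎 ∎
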